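{- Let $\alpha$ be an infinite permutation (that is, an $\mathbb N$-permutation). If $\alpha$ is not ultimately periodic, then $p^*_{\alpha}(n)\geq n$ for every integer $n\ge1$. Moreover, $p^*_{\alpha}(n)=n$ for all integers $n\ge 1$ if and only if $\alpha$ is a Sturmian permutation.
   Context: $\mathbb N=\{0,1,2,\dots\}$. An infinite permutation (or $\mathbb N$-permutation) $\alpha$ is an equivalence class of sequences $(a_s)_{s\in\mathbb N}$ of pairwise distinct real numbers, where $(a_s)\sim(b_s)$ if and only if for all $s,r\in\mathbb N$ one has $a_s<a_r \iff b_s<b_r$. Equivalently, it is a linear ordering of the index set $\mathbb N$; we write $\alpha_i<\alpha_j$ or $\alpha_i>\alpha_j$ for this order. The class of a sequence $a$ is denoted $\overline a$. For $i\ne j$ let $\gamma_{ij}\in\{<,>\}$ be the relation such that $\alpha_i\,\gamma_{ij}\,\alpha_j$. $\alpha$ is ultimately periodic if there are $t\ge1$ and $n_0$ such that $\gamma_{ij}=\gamma_{i+t,j+t}$ for all $i\neq j$ with $i,j>n_0$. A window is a finite set $T=\{0,m_1,\dots,m_{k-1}\}\subset\mathbb N$ with $0<m_1<\dots<m_{k-1}$; $\#T=k$. For $n\in\mathbb N$ the $T$-factor $\alpha_{T+n}$ is the restriction of $\alpha$ to $T+n$, regarded as a permutation on $T$ (via the shift by $n$). The number of distinct $T$-factors of $\alpha$ is denoted $p_\alpha(T)$, and the maximal pattern complexity of $\alpha$ is $p^*_\alpha(n)=\max_{\#T=n}p_\alpha(T)$. A one-sided infinite word $w=w_0w_1w_2\cdots$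 on $\{0,1\}$ is Sturmian if for every $n$ it has exactly $n+1$ distinct factors (blocks of consecutive letters) of length $n$. Sturmian permutations: let $w$ be a Sturmian word on $\{0,1\}$ and let $x,y>0$ be real numbers such that $kx\neq ly$ whenever $k$ is the number of $0$'s and $l$ is the number of $1$'s in some nonempty factor of $w$. Let $a_0$ be any real number and, for $i\ge0$, let $a_{i+1}=a_i+x$ if $w_i=0$ and $a_{i+1}=a_i-y$ if $w_i=1$. The $a_i$ are pairwise distinct, and the Sturmian permutation associated with $w,x,y$ is $\alpha(w,x,y)=\overline a$. A Sturmian permutation is any permutation of the form $\alpha(w,x,y)$. -}

module Defs where

open import Algebra.Bundles using (RawMonoid)
open import Data.Fin using (Fin; toℕ)
open import Data.Fin.Patterns using (0F; 1F)
open import Data.Fin.Properties using () renaming (_≟_ to _≟ᶠ_)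
open import Data.List using (List; _∷_; length)
open import Data.List.Membership.Propositional using (_∈_)
open import Data.List.Relation.Unary.Linked using (Linked)
open import Data.Nat as ℕ using (ℕ; zero; suc)
import Data.Nat.Properties as ℕ
open import Data.Product using (∃; ∃-syntax; _×_; _,_)
open import Data.Rational as ℚ using (ℚ; 0ℚ; ½)
import Data.Rational.Properties as ℚ
open import Data.Rational.Solver using (module +-*-Solver)
open import Data.Vec using (Vec; tabulate; count)
open import Function.Bundles using () renaming (_⇔_ to _⟺_)
open import Function.Base using (_∘_)
open import Function.Definitions using (Injective; StrictlySurjective)
open import Level using (Level; 0ℓ)
open import Relation.Binary.Core using (Rel; _⇔_)
open import Relation.Binary.PropositionalEquality
  using (_≡_; _≢_; refl; sym; cong; subst; module ≡-Reasoning)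
open import Relation.Nullary using (¬_)

------------------------------------------------------------------------
-- Real numbers: Cauchy sequences of rationals, with _≈_ as equality

IsCauchy : (ℕ → ℚ) → Set
IsCauchy s = ∀ ε → 0ℚ ℚ.< ε →
  ∃[ N ] ∀ m n → N ℕ.≤ m → N ℕ.≤ n → ℚ.∣ s m ℚ.- s n ∣ ℚ.< ε

record ℝ : Set where
  constructor mkℝ
  field
    approx : ℕ → ℚ
    cauchy : IsCauchy approx

open ℝ public

infix 4 _≈_ _<_

_≈_ : Rel ℝ 0ℓ
x ≈ y = ∀ ε → 0ℚ ℚ.< ε →
  ∃[ N ] ∀ n → N ℕ.≤ n → ℚ.∣ approx x n ℚ.- approx y n ∣ ℚ.< ε

-- The uniform gap ε makes this the strict order of the limits, not just an
-- eventual strict inequality between the approximations.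
_<_ : Rel ℝ 0ℓ
x < y = ∃[ ε ] (0ℚ ℚ.< ε) ×
  ∃[ N ] ∀ n → N ℕ.≤ n → approx x n ℚ.+ ε ℚ.< approx y n

0ℝ : ℝ
0ℝ = mkℝ (λ _ → 0ℚ) (λ ε 0<ε → 0 , λ _ _ _ _ → 0<ε)

private
  half+half : ∀ p → ½ ℚ.* p ℚ.+ ½ ℚ.* p ≡ p
  half+half = solve 1 (λ p → con ½ :* p :+ con ½ :* p := p) refl
    where open +-*-Solver

  0<half : ∀ {p} → 0ℚ ℚ.< p → 0ℚ ℚ.< ½ ℚ.* p
  0<half {p} 0<p =
    subst (ℚ._< ½ ℚ.* p) (ℚ.*-zeroʳ ½) (ℚ.*-monoʳ-<-pos ½ 0<p)

  rearrange : ∀ p q r s →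
    (p ℚ.+ q) ℚ.- (r ℚ.+ s) ≡ (p ℚ.- r) ℚ.+ (q ℚ.- s)
  rearrange = solve 4 (λ p q r s →
    (p :+ q) :- (r :+ s) := (p :- r) :+ (q :- s)) refl
    where open +-*-Solver

  neg-difference : ∀ p q → (ℚ.- p) ℚ.- (ℚ.- q) ≡ ℚ.- (p ℚ.- q)
  neg-difference = solve 2 (λ p q → (:- p) :- (:- q) := :- (p :- q)) refl
    where open +-*-Solver

infixl 6 _+_ _-_
infix  8 -_

_+_ : ℝ → ℝ → ℝ
x + y = mkℝ (λ n → approx x n ℚ.+ approx y n) isCauchy
  where
  isCauchy : IsCauchy (λ n → approx x n ℚ.+ approx y n)
  isCauchy ε 0<ε with cauchy x (½ ℚ.* ε) (0<half 0<ε)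
                    | cauchy y (½ ℚ.* ε) (0<half 0<ε)
  ... | M , close-x | N , close-y = M ℕ.⊔ N , λ m n M⊔N≤m M⊔N≤n →
    let dx = approx x m ℚ.- approx x n
        dy = approx y m ℚ.- approx y n
        open ℚ.≤-Reasoning
    in begin-strict
      ℚ.∣ (approx x m ℚ.+ approx y m) ℚ.- (approx x n ℚ.+ approx y n) ∣
        ≡⟨ cong ℚ.∣_∣ (rearrange (approx x m) (approx y m)
                                 (approx x n) (approx y n)) ⟩
      ℚ.∣ dx ℚ.+ dy ∣          ≤⟨ ℚ.∣p+q∣≤∣p∣+∣q∣ dx dy ⟩
      ℚ.∣ dx ∣ ℚ.+ ℚ.∣ dy ∣
        <⟨ ℚ.+-mono-<
             (close-x m n (ℕ.m⊔n≤o⇒m≤o M N M⊔N≤m) (ℕ.m⊔n≤o⇒m≤o M N M⊔N≤n))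
             (close-y m n (ℕ.m⊔n≤o⇒n≤o M N M⊔N≤m) (ℕ.m⊔n≤o⇒n≤o M N M⊔N≤n)) ⟩
      ½ ℚ.* ε ℚ.+ ½ ℚ.* ε      ≡⟨ half+half ε ⟩
      ε                        ∎

-_ : ℝ → ℝ
- x = mkℝ (λ n → ℚ.- approx x n) isCauchy
  where
  isCauchy : IsCauchy (λ n → ℚ.- approx x n)
  isCauchy ε 0<ε with cauchy x ε 0<ε
  ... | N , close = N , λ m n N≤m N≤n →
    subst (ℚ._< ε) (sym (neg-abs m n)) (close m n N≤m N≤n)
    where
    open ≡-Reasoning
    neg-abs : ∀ m n → ℚ.∣ (ℚ.- approx x m) ℚ.- (ℚ.- approx x n) ∣
                    ≡ ℚ.∣ approx x m ℚ.- approx x n ∣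
    neg-abs m n = begin
      ℚ.∣ (ℚ.- approx x m) ℚ.- (ℚ.- approx x n) ∣
        ≡⟨ cong ℚ.∣_∣ (neg-difference (approx x m) (approx x n)) ⟩
      ℚ.∣ ℚ.- (approx x m ℚ.- approx x n) ∣
        ≡⟨ ℚ.∣-p∣≡∣p∣ (approx x m ℚ.- approx x n) ⟩
      ℚ.∣ approx x m ℚ.- approx x n ∣ ∎

_-_ : ℝ → ℝ → ℝ
x - y = x + (- y)

+-0-rawMonoid : RawMonoid 0ℓ 0ℓ
+-0-rawMonoid = record { Carrier = ℝ ; _≈_ = _≈_ ; _∙_ = _+_ ; ε = 0ℝ }

open import Algebra.Definitions.RawMonoid +-0-rawMonoid public
  using () renaming (_×_ to _·_)

------------------------------------------------------------------------
-- Counting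

-- The family g : ℕ → A takes exactly m values, up to _≈ᴬ_: the indices
-- selected by e represent each value once.
DistinctValues : {a : Level} {A : Set a} → Rel A 0ℓ → (ℕ → A) → ℕ → Set
DistinctValues _≈ᴬ_ g m = ∃[ e ]
  Injective {A = Fin m} _≡_ _≈ᴬ_ (g ∘ e) ×
  StrictlySurjective (λ i j → g i ≈ᴬ g j) e

------------------------------------------------------------------------
-- Infinite permutations

-- The equivalence of sequences whose classes are the permutations.
infix 4 _∼_

_∼_ : Rel (ℕ → ℝ) 0ℓ
a ∼ b = ∀ s r → (a s < a r) ⟺ (b s < b r)

-- A permutation is given by a representative sequence; equality of
-- permutations is _∼_ of representatives.
record Permutation : Set where
  field
    seq      : ℕ → ℝ
    distinct : Injective _≡_ _≈_ seq

open Permutation public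

infix 4 _[_<_]

_[_<_] : Permutation → ℕ → ℕ → Set
α [ i < j ] = seq α i < seq α j

-- For i ≢ j exactly one of α_i < α_j and α_i > α_j holds, so γ_ij and γ_kl
-- are the same symbol iff α_i < α_j and α_k < α_l are equivalent.
UltimatelyPeriodic : Permutation → Set
UltimatelyPeriodic α = ∃[ t ] ∃[ n₀ ] (1 ℕ.≤ t) ×
  (∀ i j → i ≢ j → n₀ ℕ.< i → n₀ ℕ.< j →
     α [ i < j ] ⟺ α [ i ℕ.+ t < j ℕ.+ t ])

------------------------------------------------------------------------
-- Maximal pattern complexity

-- The window {0, m₁, …, m_{k-1}}, where offsets lists m₁ < … < m_{k-1}.
record Window : Set where
  field
    offsets    : List ℕ
    increasing : Linked ℕ._<_ (0 ∷ offsets)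

  elements : List ℕ
  elements = 0 ∷ offsets

open Window public

#_ : Window → ℕ
# T = length (elements T)

-- The T-factor at n: the order induced on T by i ↦ α_{i+n}.
factor : Permutation → (T : Window) → ℕ → Rel (∃ (_∈ elements T)) 0ℓ
factor α T n (i , _) (j , _) = α [ i ℕ.+ n < j ℕ.+ n ]

-- p_α(T) = m
FactorCount : Permutation → Window → ℕ → Set
FactorCount α T m = DistinctValues _⇔_ (factor α T) m

-- p*_α(n) = m
MaxPatternComplexity : Permutation → ℕ → ℕ → Set
MaxPatternComplexity α n m =
  (∃[ T ] (# T ≡ n) × FactorCount α T m) ×
  (∀ T k → # T ≡ n → FactorCount α T k → k ℕ.≤ m)

------------------------------------------------------------------------
-- Sturmian words and permutations

Word : Set
Word = ℕ → Fin 2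

block : Word → (n : ℕ) → ℕ → Vec (Fin 2) n
block w n i = tabulate (λ k → w (i ℕ.+ toℕ k))

∣_∣₀ ∣_∣₁ : ∀ {n} → Vec (Fin 2) n → ℕ
∣ u ∣₀ = count (_≟ᶠ 0F) u
∣ u ∣₁ = count (_≟ᶠ 1F) u

SturmianWord : Word → Set
SturmianWord w = ∀ n → DistinctValues _≡_ (block w n) (suc n)

step : Fin 2 → ℝ → ℝ → ℝ → ℝ
step 0F x y a = a + x
step 1F x y a = a - y

walk : Word → ℝ → ℝ → ℝ → ℕ → ℝ
walk w x y a₀ zero    = a₀
walk w x y a₀ (suc i) = step (w i) x y (walk w x y a₀ i)

NonResonant : Word → ℝ → ℝ → Set
NonResonant w x y = ∀ i n →
  let u = block w (suc n) i in ¬ (∣ u ∣₀ · x ≈ ∣ u ∣₁ · y)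

SturmianPermutation : Permutation → Set
SturmianPermutation α = ∃[ w ] ∃[ x ] ∃[ y ] ∃[ a₀ ]
  SturmianWord w × (0ℝ < x) × (0ℝ < y) × NonResonant w x y ×
  seq α ∼ walk w x y a₀

{-# OPTIONS --safe #-}
module Submission where

-- If the classes of a window do not multiply when further elements are added, they determine how
-- the permutation goes on, which makes it ultimately periodic; this gives p*(n) ≥ n.
--
-- A Sturmian word is balanced, so its vectors of letter counts over a window form a chain in which
-- every element but one takes two values. This leaves at most n patterns for n elements.
--
-- Conversely let every window have at most as many patterns as elements, without α being
-- ultimately periodic. The word of ascents and descents is aperiodic: otherwise all words
-- i ↦ γ_{i,i+m} turn out to be ultimately periodic and α to consist of finitely many monotone
-- progressions, two of which would show five patterns in a window of size four. So it has n + 1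
-- factors of length n and is balanced. Removing one element from an interval merges two patterns,
-- and these must come from factors P01Q and P10Q; hence γ_{i,i+m} depends only on the number of
-- descents between i and i + m. Cutting blocks off each other shows that the slopes of rising and of
-- falling blocks are separated, and a number strictly between them yields the two step lengths.

open import Axiom.ExcludedMiddle using (ExcludedMiddle)
open import Data.Bool using (Bool; true; false; not)
import Data.Bool.Properties as Bool
open import Data.Empty using (⊥; ⊥-elim)
open import Data.Fin as Fin using (Fin; zero; suc; toℕ; fromℕ<; inject≤; funToFin; finToFun)
open import Data.Fin.Patterns using (0F; 1F)
import Data.Fin.Properties as Fin
import Data.Integer as ℤ
import Data.Integer.Properties as ℤ
open import Data.List as List using (List; []; _∷_; length)
import Data.List.Membership.Propositional.Properties as List
import Data.List.Properties as List
open import Data.List.Membership.Propositional using (_∈_)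
open import Data.List.Relation.Unary.Any using (here; there; index)
open import Data.List.Relation.Unary.Linked as Linked using (Linked; []; [-]; _∷_)
import Data.List.Relation.Unary.Linked.Properties as Linked
open import Data.Nat
open import Data.Nat.ListAction using (sum)
open import Data.Nat.Properties
open import Data.Nat.Tactic.RingSolver using (solve-∀)
open import Data.Product using (Σ; ∃₂; ∃-syntax; _×_; _,_; proj₁; proj₂)
open import Data.Rational as ℚ using (ℚ; 0ℚ; 1ℚ; ½; mkℚ; toℚᵘ)
import Data.Rational.Properties as ℚ
open import Data.Rational.Solver using (module +-*-Solver)
open import Data.Rational.Unnormalised as ℚᵘ using (mkℚᵘ; *<*; *≡*)
import Data.Rational.Unnormalised.Properties as ℚᵘ
open import Data.Sum using (_⊎_; inj₁; inj₂; [_,_]′)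
open import Data.Vec as Vec using (tabulate)
import Data.Vec.Properties as Vec
open import Defs hiding (_<_; _+_; _-_; -_; step; _≈_)
import Defs as D
open import Function using (_∘_; case_of_)
open import Function.Bundles using (_⇔_; mk⇔; Equivalence)
open import Level using (0ℓ)
open import Relation.Binary using (IsEquivalence; tri<; tri≈; tri>)
import Relation.Binary.Core as RB
open import Relation.Binary.PropositionalEquality hiding (J; [_])
open import Relation.Nullary using (¬_; yes; no; contradiction)

-- Every use of "at most as many patterns as elements" rests on one mechanism: if `R` has k classes,
-- a refinement of `R` with no more than k classes splits none of them, and one with k + 1 classes
-- splits only one (`split`, `split₂`). The obstacle in the converse is uniformity. Eventual
-- periodicity of each word i ↦ γ_{i,i+m} separately gives no common period. Long distances are
-- controlled by comparing two monotone progressions under growing delay; only finitely many short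
-- distances remain. The step lengths come from two suprema: T, of the proportions of descents in
-- rising blocks, and F, of the proportions of ascents in falling blocks. Separation gives T ≤ 1 -
-- F, and with the midpoint s = (1 + T - F) / 2 one puts x = 2s and y = 2(1 - s); a block of m
-- letters with o descents changes the height by 2(sm - o). Even if T = 1 - F this is never 0: the
-- slope of a fixed block keeps a positive distance from all slopes of the opposite direction
-- (`gap`), since otherwise arbitrarily long rows of blocks with one count would occur.

module Lin where

  open import Data.Bool using (_∧_; _∨_)
  open import Data.Vec using (Vec; []; _∷_; lookup; zipWith; replicate; map; allFin)
  open import Data.Vec.N-ary using (N-ary; _$ⁿ_)

  -- Linear arithmetic over ℕ by Farkas certificates: the checker looks for
  -- coefficients in {0,1,2} for the hypotheses.

  infixl 7 _⊕_
  infix  5 _≼_ _≈ᵉ_ _≺_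
  infixr 4 _⇒_

  data Expr (n : ℕ) : Set where
    var : Fin n → Expr n
    con : ℕ → Expr n
    _⊕_ : Expr n → Expr n → Expr n

  data Rel (n : ℕ) : Set where
    _≼_ _≺_ _≈ᵉ_ : Expr n → Expr n → Rel n

  data Problem (n : ℕ) : Set where
    ⊢_  : Rel n → Problem n
    _⇒_ : Rel n → Problem n → Problem n

  Env : ℕ → Set
  Env = Vec ℕ

  ⟦_⟧ᵉ : ∀ {n} → Expr n → Env n → ℕ
  ⟦ var i ⟧ᵉ   ρ = lookup ρ i
  ⟦ con k ⟧ᵉ   ρ = k
  ⟦ a ⊕ b ⟧ᵉ   ρ = ⟦ a ⟧ᵉ ρ + ⟦ b ⟧ᵉ ρ

  ⟦_⟧ʳ : ∀ {n} → Rel n → Env n → Set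
  ⟦ a ≼ b ⟧ʳ  ρ = ⟦ a ⟧ᵉ ρ ≤ ⟦ b ⟧ᵉ ρ
  ⟦ a ≺ b ⟧ʳ  ρ = ⟦ a ⟧ᵉ ρ < ⟦ b ⟧ᵉ ρ
  ⟦ a ≈ᵉ b ⟧ʳ ρ = ⟦ a ⟧ᵉ ρ ≡ ⟦ b ⟧ᵉ ρ

  ⟦_⟧ᵖ : ∀ {n} → Problem n → Env n → Set
  ⟦ ⊢ r ⟧ᵖ   ρ = ⟦ r ⟧ʳ ρ
  ⟦ r ⇒ p ⟧ᵖ ρ = ⟦ r ⟧ʳ ρ → ⟦ p ⟧ᵖ ρ

  NF : ℕ → Set
  NF n = ℕ × Vec ℕ n

  dot : ∀ {n} → Vec ℕ n → Env n → ℕ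
  dot []       []      = 0
  dot (c ∷ cs) (x ∷ ρ) = c * x + dot cs ρ

  ⟦_⟧ⁿ : ∀ {n} → NF n → Env n → ℕ
  ⟦ k , cs ⟧ⁿ ρ = k + dot cs ρ

  _+ⁿ_ : ∀ {n} → NF n → NF n → NF n
  (k , cs) +ⁿ (l , ds) = k + l , zipWith _+_ cs ds

  unit : ∀ {n} → Fin n → Vec ℕ n
  unit zero    = 1 ∷ replicate _ 0
  unit (suc i) = 0 ∷ unit i

  norm : ∀ {n} → Expr n → NF n
  norm (var i) = 0 , unit i
  norm (con k) = k , replicate _ 0
  norm (a ⊕ b) = norm a +ⁿ norm b

  private
    rearr : ∀ a b c d → (a + b) + (c + d) ≡ (a + c) + (b + d)
    rearr = solve-∀

    rearr′ : ∀ c d x u v → (c + d) * x + (u + v) ≡ (c * x + u) + (d * x + v)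
    rearr′ = solve-∀

  dot-zero : ∀ {n} (ρ : Env n) → dot (replicate n 0) ρ ≡ 0
  dot-zero []      = refl
  dot-zero (x ∷ ρ) = dot-zero ρ

  dot-unit : ∀ {n} (i : Fin n) (ρ : Env n) → dot (unit i) ρ ≡ lookup ρ i
  dot-unit zero    (x ∷ ρ) =
    trans (cong (1 * x +_) (dot-zero ρ)) (trans (+-identityʳ (1 * x)) (*-identityˡ x))
  dot-unit (suc i) (x ∷ ρ) = dot-unit i ρ

  dot-+ : ∀ {n} (cs ds : Vec ℕ n) (ρ : Env n) → dot (zipWith _+_ cs ds) ρ ≡ dot cs ρ + dot ds ρ
  dot-+ []       []       []      = refl
  dot-+ (c ∷ cs) (d ∷ ds) (x ∷ ρ) =
    trans (cong ((c + d) * x +_) (dot-+ cs ds ρ)) (rearr′ c d x (dot cs ρ) (dot ds ρ))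

  +ⁿ-sound : ∀ {n} (a b : NF n) ρ → ⟦ a +ⁿ b ⟧ⁿ ρ ≡ ⟦ a ⟧ⁿ ρ + ⟦ b ⟧ⁿ ρ
  +ⁿ-sound (k , cs) (l , ds) ρ =
    trans (cong (k + l +_) (dot-+ cs ds ρ)) (rearr k l (dot cs ρ) (dot ds ρ))

  norm-sound : ∀ {n} (e : Expr n) ρ → ⟦ norm e ⟧ⁿ ρ ≡ ⟦ e ⟧ᵉ ρ
  norm-sound (var i) ρ = dot-unit i ρ
  norm-sound (con k) ρ = trans (cong (k +_) (dot-zero ρ)) (+-identityʳ k)
  norm-sound (a ⊕ b) ρ =
    trans (+ⁿ-sound (norm a) (norm b) ρ) (cong₂ _+_ (norm-sound a ρ) (norm-sound b ρ))

  leqᵛ : ∀ {n} → Vec ℕ n → Vec ℕ n → Bool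
  leqᵛ []       []       = true
  leqᵛ (c ∷ cs) (d ∷ ds) = (c ≤ᵇ d) ∧ leqᵛ cs ds

  leqⁿ : ∀ {n} → NF n → NF n → Bool
  leqⁿ (k , cs) (l , ds) = (k ≤ᵇ l) ∧ leqᵛ cs ds

  private
    ∧-split : ∀ a {b} → a ∧ b ≡ true → a ≡ true × b ≡ true
    ∧-split true eq = refl , eq

    ≤ᵇ-sound : ∀ a b → (a ≤ᵇ b) ≡ true → a ≤ b
    ≤ᵇ-sound a b eq = ≤ᵇ⇒≤ a b (subst Data.Bool.T (sym eq) _)

  leqᵛ-sound : ∀ {n} (cs ds : Vec ℕ n) ρ → leqᵛ cs ds ≡ true → dot cs ρ ≤ dot ds ρ
  leqᵛ-sound []       []       []      eq = z≤n
  leqᵛ-sound (c ∷ cs) (d ∷ ds) (x ∷ ρ) eq with ∧-split (c ≤ᵇ d) eq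
  ... | p , q = +-mono-≤ (*-monoˡ-≤ x (≤ᵇ-sound c d p)) (leqᵛ-sound cs ds ρ q)

  leqⁿ-sound : ∀ {n} (a b : NF n) ρ → leqⁿ a b ≡ true → ⟦ a ⟧ⁿ ρ ≤ ⟦ b ⟧ⁿ ρ
  leqⁿ-sound (k , cs) (l , ds) ρ eq with ∧-split (k ≤ᵇ l) eq
  ... | p , q = +-mono-≤ (≤ᵇ-sound k l p) (leqᵛ-sound cs ds ρ q)

  Ineq : ℕ → Set
  Ineq n = NF n × NF n

  Holds : ∀ {n} → Env n → Ineq n → Set
  Holds ρ (l , r) = ⟦ l ⟧ⁿ ρ ≤ ⟦ r ⟧ⁿ ρ

  -- Without subtraction in ℕ a hypothesis `l ≤ r` is absorbed into the goal: `a + r ≤ b + l`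
  -- implies `a ≤ b`. What remains is compared coefficientwise.
  search : ∀ {n} → List (Ineq n) → NF n → NF n → Bool
  search []             a b = leqⁿ a b
  search ((l , r) ∷ hs) a b =
    search hs a b ∨ (search hs (a +ⁿ r) (b +ⁿ l) ∨ search hs ((a +ⁿ r) +ⁿ r) ((b +ⁿ l) +ⁿ l))

  data AllHold {n} (ρ : Env n) : List (Ineq n) → Set where
    []  : AllHold ρ []
    _∷_ : ∀ {h hs} → Holds ρ h → AllHold ρ hs → AllHold ρ (h ∷ hs)

  private
    ∨-split : ∀ {A : Set} a {b} → (a ≡ true → A) → (b ≡ true → A) → a ∨ b ≡ true → A
    ∨-split true  f g eq = f eq
    ∨-split false f g eq = g eq

    cancel : ∀ {n} (a b l r : NF n) ρ → Holds ρ (l , r) →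
             Holds ρ (a +ⁿ r , b +ⁿ l) → Holds ρ (a , b)
    cancel a b l r ρ h g = +-cancelʳ-≤ (⟦ r ⟧ⁿ ρ) (⟦ a ⟧ⁿ ρ) (⟦ b ⟧ⁿ ρ)
      (≤-trans (subst₂ _≤_ (+ⁿ-sound a r ρ) (+ⁿ-sound b l ρ) g) (+-monoʳ-≤ (⟦ b ⟧ⁿ ρ) h))

  search-sound : ∀ {n} hs (a b : NF n) ρ → AllHold ρ hs → search hs a b ≡ true → Holds ρ (a , b)
  search-sound []             a b ρ []       eq = leqⁿ-sound a b ρ eq
  search-sound ((l , r) ∷ hs) a b ρ (h ∷ hh) eq =
    ∨-split (search hs a b) (search-sound hs a b ρ hh)
      (∨-split (search hs (a +ⁿ r) (b +ⁿ l))
        (λ e → cancel a b l r ρ h (search-sound hs (a +ⁿ r) (b +ⁿ l) ρ hh e))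
        (λ e → cancel a b l r ρ h (cancel (a +ⁿ r) (b +ⁿ l) l r ρ h
                 (search-sound hs ((a +ⁿ r) +ⁿ r) ((b +ⁿ l) +ⁿ l) ρ hh e)))) eq

  check : ∀ {n} → List (Ineq n) → Problem n → Bool
  check hs (⊢ (a ≼ b))        = search hs (norm a) (norm b)
  check hs (⊢ (a ≺ b))        = search hs (norm (con 1 ⊕ a)) (norm b)
  check hs (⊢ (a ≈ᵉ b))       = search hs (norm a) (norm b) ∧ search hs (norm b) (norm a)
  check hs ((a ≼ b) ⇒ p)      = check ((norm a , norm b) ∷ hs) p
  check hs ((a ≺ b) ⇒ p)      = check ((norm (con 1 ⊕ a) , norm b) ∷ hs) p
  check hs ((a ≈ᵉ b) ⇒ p)     = check ((norm a , norm b) ∷ (norm b , norm a) ∷ hs) p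

  private
    to : ∀ {n} (a b : Expr n) ρ → ⟦ a ⟧ᵉ ρ ≤ ⟦ b ⟧ᵉ ρ → Holds ρ (norm a , norm b)
    to a b ρ = subst₂ _≤_ (sym (norm-sound a ρ)) (sym (norm-sound b ρ))

    from : ∀ {n} (a b : Expr n) ρ → Holds ρ (norm a , norm b) → ⟦ a ⟧ᵉ ρ ≤ ⟦ b ⟧ᵉ ρ
    from a b ρ = subst₂ _≤_ (norm-sound a ρ) (norm-sound b ρ)

  check-sound : ∀ {n} hs (p : Problem n) ρ → AllHold ρ hs → check hs p ≡ true → ⟦ p ⟧ᵖ ρ
  check-sound hs (⊢ (a ≼ b)) ρ hh eq = from a b ρ (search-sound hs _ _ ρ hh eq)
  check-sound hs (⊢ (a ≺ b)) ρ hh eq = from (con 1 ⊕ a) b ρ (search-sound hs _ _ ρ hh eq)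
  check-sound hs (⊢ (a ≈ᵉ b)) ρ hh eq with ∧-split (search hs (norm a) (norm b)) eq
  ... | p , q = ≤-antisym (from a b ρ (search-sound hs _ _ ρ hh p))
                          (from b a ρ (search-sound hs _ _ ρ hh q))
  check-sound hs ((a ≼ b) ⇒ p) ρ hh eq h = check-sound _ p ρ (to a b ρ h ∷ hh) eq
  check-sound hs ((a ≺ b) ⇒ p) ρ hh eq h = check-sound _ p ρ (to (con 1 ⊕ a) b ρ h ∷ hh) eq
  check-sound hs ((a ≈ᵉ b) ⇒ p) ρ hh eq h =
    check-sound _ p ρ (to a b ρ (≤-reflexive h) ∷ to b a ρ (≤-reflexive (sym h)) ∷ hh) eq

  close : ∀ n → N-ary n (Expr n) (Problem n) → Problem n
  close n f = f $ⁿ map var (allFin n)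

  ∀ᵉ : ∀ n → (Env n → Set) → Set
  ∀ᵉ zero    P = P []
  ∀ᵉ (suc n) P = (x : ℕ) → ∀ᵉ n (λ ρ → P (x ∷ ρ))

  ∀ᵉ-intro : ∀ n {P : Env n → Set} → (∀ ρ → P ρ) → ∀ᵉ n P
  ∀ᵉ-intro zero    f = f []
  ∀ᵉ-intro (suc n) f = λ x → ∀ᵉ-intro n (λ ρ → f (x ∷ ρ))

  lin : ∀ n (f : N-ary n (Expr n) (Problem n)) → check [] (close n f) ≡ true →
        ∀ᵉ n ⟦ close n f ⟧ᵖ
  lin n f eq = ∀ᵉ-intro n (λ ρ → check-sound [] (close n f) ρ [] eq)

open Lin using (lin; _⊕_; _≼_; _≺_; _≈ᵉ_; con; _⇒_; ⊢_)

-- Counting equivalence classes; eventually periodic sequences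

1≰0 : ∀ {A : Set} → 1 ≤ 0 → A
1≰0 ()

Rel₀ : Set₁
Rel₀ = ℕ → ℕ → Set

-- Lower bounds carry witnesses, while "at most `k` classes" is the negation of `AtLeast R (suc k)`;
-- exact class counts are thereby avoided.
AtLeast : Rel₀ → ℕ → Set
AtLeast R k = Σ (Fin k → ℕ) λ e → ∀ a b → R (e a) (e b) → a ≡ b

atLeast-antitone : ∀ {R R′ : Rel₀} {k} → (∀ i j → R′ i j → R i j) → AtLeast R k → AtLeast R′ k
atLeast-antitone R′⊆R (e , inj) = e , λ a b → inj a b ∘ R′⊆R _ _

atLeast-≤ : ∀ {R : Rel₀} {k l} → k ≤ l → AtLeast R l → AtLeast R k
atLeast-≤ k≤l (e , inj) = (λ a → e (inject≤ a k≤l)) ,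
  λ a b r → Fin.inject≤-injective k≤l k≤l a b (inj _ _ r)

module _ {R : Rel₀} (eq : IsEquivalence R) where
  open IsEquivalence eq renaming (refl to ≈-refl; sym to ≈-sym; trans to ≈-trans)

  atLeast-suc : ∀ {k} ((e , _) : AtLeast R k) i → (∀ a → ¬ R (e a) i) → AtLeast R (suc k)
  atLeast-suc (e , inj) i new = e′ , inj′
    where
    e′ : Fin _ → ℕ
    e′ zero    = i
    e′ (suc a) = e a
    inj′ : ∀ a b → R (e′ a) (e′ b) → a ≡ b
    inj′ zero    zero    r = refl
    inj′ zero    (suc b) r = contradiction (≈-sym r) (new b)
    inj′ (suc a) zero    r = contradiction r (new a)
    inj′ (suc a) (suc b) r = cong suc (inj a b r)

  covering-≤ : ∀ {k m} (f : Fin m → ℕ) → (∀ i → ∃[ a ] R (f a) i) → AtLeast R k → k ≤ m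
  covering-≤ f cov (e , inj) = Fin.injective⇒≤ {f = λ a → proj₁ (cov (e a))}
    λ {a} {b} q → inj a b (≈-trans (≈-sym (proj₂ (cov (e a))))
      (subst (λ c → R (f c) (e b)) (sym q) (proj₂ (cov (e b)))))

finite-code : ∀ {R : Rel₀} {B} (c : ℕ → Fin B) → (∀ i j → c i ≡ c j → R i j) → ¬ AtLeast R (suc B)
finite-code {B = B} c sep (e , inj) with Fin.pigeonhole (n<1+n B) (c ∘ e)
... | a , b , a<b , q = Fin.<⇒≢ a<b (inj a b (sep _ _ q))

-- Refinements of equivalence relations, counted classically

module Classical (em : ExcludedMiddle 0ℓ) where

  dne : ∀ {A : Set} → ¬ ¬ A → A
  dne {A} ¬¬a with em {A}
  ... | yes a = a
  ... | no ¬a = contradiction ¬a ¬¬a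

  ¬∀⇒∃¬ : ∀ {A : Set} {P : A → Set} → ¬ (∀ x → P x) → ∃[ x ] ¬ P x
  ¬∀⇒∃¬ ¬all = dne λ none → ¬all λ x → dne λ ¬p → none (x , ¬p)

  least : ∀ (P : ℕ → Set) n → P n → ∃[ m ] P m × (∀ k → k < m → ¬ P k)
  least P n p = go (suc n) n ≤-refl p
    where
    go : ∀ B n → n < B → P n → ∃[ m ] P m × (∀ k → k < m → ¬ P k)
    go (suc B) n n<B p with em {∃[ k ] k < n × P k}
    ... | yes (k , k<n , pk) = go B k (≤-trans k<n (s≤s⁻¹ n<B)) pk
    ... | no none = n , p , λ k k<n pk → none (k , k<n , pk)

  greatest : ∀ (P : ℕ → Set) B → P 0 → ¬ P (suc B) → ∃[ m ] m ≤ B × P m × ¬ P (suc m)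
  greatest P zero    p0 ¬p = 0 , z≤n , p0 , ¬p
  greatest P (suc B) p0 ¬p with em {P (suc B)}
  ... | yes p = suc B , ≤-refl , p , ¬p
  ... | no ¬q = let m , m≤B , pm , ¬pm = greatest P B p0 ¬q in m , m≤n⇒m≤1+n m≤B , pm , ¬pm

  collision : ∀ (R : Rel₀) {k} → ¬ AtLeast R k → (e : Fin k → ℕ) →
              ∃₂ λ a b → R (e a) (e b) × a ≢ b
  collision R ¬al e = dne λ none → ¬al (e , λ a b r → dne λ a≢b → none (a , b , r , a≢b))

  module _ {R R′ : Rel₀} (eq : IsEquivalence R) (eq′ : IsEquivalence R′)
           (R′⊆R : ∀ i j → R′ i j → R i j) where
    private
      module E  = IsEquivalence eq
      module E′ = IsEquivalence eq′

    -- If no representative lies in the `R′`-class of `p`, then `p` is a new one. Otherwise `q` is: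
    -- the only representative `R`-related to `q` is the one of `p`, from which `R′` separates it.
    split : ∀ {k} p q → R p q → ¬ R′ p q → AtLeast R k → AtLeast R′ (suc k)
    split p q rpq ¬r′pq al@(e , inj) with em {∃[ a ] R′ (e a) p}
    ... | no ¬ex = atLeast-suc eq′ (atLeast-antitone R′⊆R al) p λ a r → ¬ex (a , r)
    ... | yes (a , r) = atLeast-suc eq′ (atLeast-antitone R′⊆R al) q λ b r′ →
      let b≡a = inj b a (E.trans (R′⊆R _ _ r′) (E.trans (E.sym rpq) (E.sym (R′⊆R _ _ r))))
      in ¬r′pq (E′.trans (E′.sym r) (subst (λ c → R′ (e c) q) b≡a r′))

    split-unique : ∀ {k} → AtLeast R k → ¬ AtLeast R′ (suc k) → ∀ {p q} → R p q → R′ p q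
    split-unique al ¬al r = dne λ ¬r′ → ¬al (split _ _ r ¬r′ al)

  -- First only the class of p is split (mid), then the rest.
  split₂ : ∀ {R R′ : Rel₀} → IsEquivalence R → IsEquivalence R′ → (∀ i j → R′ i j → R i j) →
           ∀ {k} p q p′ q′ → R p q → ¬ R′ p q → R p′ q′ → ¬ R′ p′ q′ → ¬ R p′ p →
           AtLeast R k → AtLeast R′ (suc (suc k))
  split₂ {R} {R′} eq eq′ R′⊆R p q p′ q′ rpq ¬pq rp′q′ ¬p′q′ apart al =
    split mid eq′ (λ i j r → R′⊆R i j r , λ _ → r) p′ q′ (rp′q′ , λ r → contradiction r apart) ¬p′q′
      (split eq mid (λ _ _ → proj₁) p q rpq (λ r → ¬pq (proj₂ r E.refl)) al)
    where
    module E  = IsEquivalence eq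
    module E′ = IsEquivalence eq′
    mid : IsEquivalence (λ x y → R x y × (R x p → R′ x y))
    mid = record
      { refl  = E.refl , λ _ → E′.refl
      ; sym   = λ (r , f) → E.sym r , λ s → E′.sym (f (E.trans r s))
      ; trans = λ (r , f) (s , g) → E.trans r s ,
                  λ t → E′.trans (f t) (g (E.trans (E.sym r) t))
      }

  atLeast-or-class : ∀ {R : Rel₀} {k} → IsEquivalence R → ((e , _) : AtLeast R k) →
                     ¬ AtLeast R (suc k) → ∀ i → ∃[ a ] R (e a) i
  atLeast-or-class eq al ¬al i = dne λ none → ¬al (atLeast-suc eq al i λ a r → none (a , r))

UP : ∀ {A : Set} → (ℕ → A) → Set
UP f = ∃[ P ] ∃[ N ] 1 ≤ P × (∀ i → N ≤ i → f i ≡ f (P + i))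

up-multiple : ∀ {A : Set} (f : ℕ → A) P N → (∀ i → N ≤ i → f i ≡ f (P + i)) →
              ∀ c i → N ≤ i → f i ≡ f (c * P + i)
up-multiple f P N h zero    i N≤i = refl
up-multiple f P N h (suc c) i N≤i = trans (up-multiple f P N h c i N≤i)
  (trans (h _ (≤-trans N≤i (m≤n+m i (c * P)))) (cong f (sym (+-assoc P (c * P) i))))

1≤* : ∀ {m n} → 1 ≤ m → 1 ≤ n → 1 ≤ m * n
1≤* = *-mono-≤

-- `G k M N` is meant as "`k` is good with period `M` from `N` on". Multiples of the period and
-- larger thresholds preserve this, so finitely many `k` share the product of their periods.
combine : ∀ (G : ℕ → ℕ → ℕ → Set) →
          (∀ k M N c → 1 ≤ c → G k M N → G k (c * M) N) →
          (∀ k M {N N′} → N ≤ N′ → G k M N → G k M N′) →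
          ∀ K → (∀ k → k < K → ∃₂ λ M N → 1 ≤ M × G k M N) →
          ∃₂ λ M N → 1 ≤ M × (∀ k → k < K → G k M N)
combine G mult mono zero    h = 1 , 0 , ≤-refl , λ _ ()
combine G mult mono (suc K) h
  with combine G mult mono K (λ k k<K → h k (m<n⇒m<1+n k<K)) | h K ≤-refl
... | M , N , 1≤M , all | M′ , N′ , 1≤M′ , g =
  M′ * M , N ⊔ N′ , 1≤* 1≤M′ 1≤M , λ k k<sK → case m<1+n⇒m<n∨m≡n k<sK of λ where
    (inj₁ k<K)  → mono k _ (m≤m⊔n N N′) (mult k M N M′ 1≤M′ (all k k<K))
    (inj₂ refl) → mono k _ (m≤n⊔m N N′)
      (subst (λ x → G k x N′) (*-comm M M′) (mult k M′ N′ M 1≤M g))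

up-common : ∀ {A : Set} (f : ℕ → ℕ → A) K → (∀ k → k < K → UP (f k)) →
            ∃₂ λ P N → 1 ≤ P × (∀ k → k < K → ∀ i → N ≤ i → f k i ≡ f k (P + i))
up-common f K h = combine (λ k P N → ∀ i → N ≤ i → f k i ≡ f k (P + i))
  (λ k P N c _ g i N≤i → up-multiple (f k) P N g c i N≤i)
  (λ k P N≤N′ g i N′≤i → g i (≤-trans N≤N′ N′≤i)) K h

monotone-bound : ∀ (G : ℕ → ℕ → Set) → (∀ k {N N′} → N ≤ N′ → G k N → G k N′) →
                 ∀ K → (∀ k → k < K → ∃[ N ] G k N) → ∃[ N ] (∀ k → k < K → G k N)
monotone-bound G mono K h
  with combine (λ k _ N → G k N) (λ _ _ _ _ _ g → g) (λ k _ → mono k) K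
         (λ k k<K → let N , g = h k k<K in 1 , N , ≤-refl , g)
... | _ , N , _ , all = N , all

first-change : ∀ (f : ℕ → Bool) b n → f 0 ≡ b → f n ≡ not b →
               ∃[ k ] k < n × f k ≡ b × f (suc k) ≡ not b
first-change f b zero    f0 fn = contradiction (trans (sym fn) f0) (Bool.not-¬ refl ∘ sym)
first-change f b (suc n) f0 fn with f n Bool.≟ b
... | yes q = n , ≤-refl , q , fn
... | no ¬q = let k , k<n , p = first-change f b n f0 (Bool.¬-not ¬q) in k , m<n⇒m<1+n k<n , p

residue : ∀ M i → 1 ≤ M → ∃₂ λ s r → r < M × i ≡ s * M + r
residue (suc M) i _ = i / suc M , i % suc M , m%n<n i (suc M) ,
  trans (m≡m%n+[m/n]*n i (suc M)) (+-comm (i % suc M) _)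
  where open import Data.Nat.DivMod

-- Morse–Hedlund, and balance of words of minimal complexity

swap-+ : ∀ a b c → a + (b + c) ≡ b + (a + c)
swap-+ = solve-∀

split-< : ∀ {k n} → k < n → ∃[ l ] k + suc l ≡ n
split-< {k} k<n = let l , q = m≤n⇒∃[o]m+o≡n k<n in l , trans (+-suc k l) q

split-≤ : ∀ {k n} → k ≤ n → ∃[ l ] l + k ≡ n
split-≤ {k} k≤n = let l , q = m≤n⇒∃[o]m+o≡n k≤n in l , trans (+-comm l k) q

bit : Bool → ℕ
bit true  = 1
bit false = 0

bit≤1 : ∀ b → bit b ≤ 1
bit≤1 true  = ≤-refl
bit≤1 false = z≤n

bit-injective : ∀ {a b} → bit a ≡ bit b → a ≡ b
bit-injective {true}  {true}  _ = refl
bit-injective {false} {false} _ = refl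

bit-suc : ∀ {a b} → bit a ≡ suc (bit b) → a ≡ true × b ≡ false
bit-suc {true} {false} _ = refl , refl

-- Factors and letter counts of a word

module Word (w : ℕ → Bool) where

  record Blk (n i j : ℕ) : Set where
    constructor blk
    field at : ∀ k → k < n → w (k + i) ≡ w (k + j)
  open Blk public

  blk-equiv : ∀ n → IsEquivalence (Blk n)
  blk-equiv n = record
    { refl  = blk λ _ _ → refl
    ; sym   = λ r → blk λ k k<n → sym (at r k k<n)
    ; trans = λ r s → blk λ k k<n → trans (at r k k<n) (at s k k<n)
    }

  module B {n} = IsEquivalence (blk-equiv n)

  blk-≤ : ∀ {m n} → m ≤ n → ∀ i j → Blk n i j → Blk m i j
  blk-≤ m≤n i j r = blk λ k k<m → at r k (≤-trans k<m m≤n)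

  blk-len : ∀ {m n i j} → m ≡ n → Blk m i j → Blk n i j
  blk-len refl r = r

  blk-shift : ∀ n d {i j} → Blk (n + d) i j → Blk n (d + i) (d + j)
  blk-shift n d {i} {j} r = blk λ k k<n → trans (cong w (sym (+-assoc k d i)))
    (trans (at r (k + d) (+-monoˡ-< d k<n)) (cong w (+-assoc k d j)))

  blk-tail : ∀ {n i j} → Blk (suc n) i j → Blk n (suc i) (suc j)
  blk-tail {n} r = blk-shift n 1 (blk-len (+-comm 1 n) r)

  blk-cons : ∀ {n i j} → w i ≡ w j → Blk n (suc i) (suc j) → Blk (suc n) i j
  blk-cons q r = blk λ where
    zero    _    → q
    (suc k) k<sn → trans (cong w (sym (+-suc k _)))
      (trans (at r k (s≤s⁻¹ k<sn)) (cong w (+-suc k _)))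

  blk-snoc : ∀ {n i j} → Blk n i j → w (n + i) ≡ w (n + j) → Blk (suc n) i j
  blk-snoc r q = blk λ k k<sn → case m<1+n⇒m<n∨m≡n k<sn of λ where
    (inj₁ k<n)  → at r k k<n
    (inj₂ refl) → q

  blk-finite : ∀ n → ¬ AtLeast (Blk n) (suc (2 ^ n))
  blk-finite n = finite-code code sep
    where
    enc : Bool → Fin 2
    enc true  = suc zero
    enc false = zero
    enc-inj : ∀ {a b} → enc a ≡ enc b → a ≡ b
    enc-inj {true}  {true}  _ = refl
    enc-inj {false} {false} _ = refl
    row : ℕ → Fin n → Fin 2
    row i k = enc (w (toℕ k + i))
    code : ℕ → Fin (2 ^ n)
    code i = funToFin (row i)
    sep : ∀ i j → code i ≡ code j → Blk n i j
    sep i j q = blk λ k k<n → subst (λ m → w (m + i) ≡ w (m + j)) (Fin.toℕ-fromℕ< k<n)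
      (enc-inj (trans (sym (Fin.finToFun-funToFin (row i) (fromℕ< k<n)))
        (trans (cong (λ c → finToFun c (fromℕ< k<n)) q)
               (Fin.finToFun-funToFin (row j) (fromℕ< k<n)))))

  cnt : ℕ → ℕ → ℕ
  cnt zero    i = 0
  cnt (suc n) i = bit (w i) + cnt n (suc i)

  cnt-+ : ∀ m n i → cnt (m + n) i ≡ cnt m i + cnt n (m + i)
  cnt-+ zero    n i = refl
  cnt-+ (suc m) n i = trans (cong (bit (w i) +_) (trans (cnt-+ m n (suc i))
    (cong (λ x → cnt m (suc i) + cnt n x) (+-suc m i))))
    (sym (+-assoc (bit (w i)) (cnt m (suc i)) _))

  cnt-1 : ∀ i → cnt 1 i ≡ bit (w i)
  cnt-1 i = +-identityʳ _

  cnt-snoc : ∀ n i → cnt (suc n) i ≡ cnt n i + bit (w (n + i))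
  cnt-snoc n i = trans (cong (λ m → cnt m i) (+-comm 1 n))
    (trans (cnt-+ n 1 i) (cong (cnt n i +_) (cnt-1 (n + i))))

  blk⇒cnt : ∀ n {i j} → Blk n i j → cnt n i ≡ cnt n j
  blk⇒cnt zero    r = refl
  blk⇒cnt (suc n) r = cong₂ _+_ (cong bit (at r 0 z<s)) (blk⇒cnt n (blk-tail r))

  cnt⇒blk : ∀ n {i j} → (∀ k → k ≤ n → cnt k i ≡ cnt k j) → Blk n i j
  cnt⇒blk n {i} {j} h = blk λ k k<n → bit-injective (+-cancelˡ-≡ (cnt k i) _ _ (begin
    cnt k i + bit (w (k + i)) ≡⟨ cnt-snoc k i ⟨
    cnt (suc k) i             ≡⟨ h (suc k) k<n ⟩
    cnt (suc k) j             ≡⟨ cnt-snoc k j ⟩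
    cnt k j + bit (w (k + j)) ≡⟨ cong (_+ _) (h k (<⇒≤ k<n)) ⟨
    cnt k i + bit (w (k + j)) ∎))
    where open ≡-Reasoning

  cnt-reverse : ∀ n x y → (∀ a b → a + suc b ≡ n → w (a + x) ≡ w (b + y)) → cnt n x ≡ cnt n y
  cnt-reverse zero    x y h = refl
  cnt-reverse (suc n) x y h = begin
    bit (w x) + cnt n (suc x)     ≡⟨ cong₂ _+_ (cong bit (h 0 n refl))
                                      (cnt-reverse n (suc x) y λ a b q →
                                        trans (cong w (+-suc a x)) (h (suc a) b (cong suc q))) ⟩
    bit (w (n + y)) + cnt n y     ≡⟨ +-comm _ (cnt n y) ⟩
    cnt n y + bit (w (n + y))     ≡⟨ cnt-snoc n y ⟨
    cnt (suc n) y                 ∎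
    where open ≡-Reasoning

  Balanced : Set
  Balanced = ∀ n i j → cnt n i ≤ suc (cnt n j)

module WordsClassical (em : ExcludedMiddle 0ℓ) where
  open Classical em

  shift-UP : ∀ (w : ℕ → Bool) N → UP (λ i → w (i + N)) → UP w
  shift-UP w N (P , N₀ , 1≤P , h) = P , N₀ + N , 1≤P , per
    where
    per : ∀ i → N₀ + N ≤ i → w i ≡ w (P + i)
    per i le with split-≤ le
    ... | l , refl = trans (cong w (sym (+-assoc l N₀ N)))
      (trans (h (l + N₀) (m≤n+m N₀ l))
        (cong w (trans (+-assoc P (l + N₀) N) (cong (P +_) (+-assoc l N₀ N)))))

  module _ (w : ℕ → Bool) where
    open Word w

    -- Morse–Hedlund: without growth from n to n + 1 every factor of length n
    -- determines the following letter.
    morse-hedlund : ¬ UP w → ∀ n → AtLeast (Blk n) (suc n)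
    morse-hedlund ¬up zero = (λ _ → 0) , λ { zero zero _ → refl }
    morse-hedlund ¬up (suc n) with em {∃₂ λ i j → Blk n i j × w (n + i) ≢ w (n + j)}
    ... | yes (i , j , r , ≢) =
      split (blk-equiv n) (blk-equiv (suc n)) (blk-≤ (n≤1+n n)) i j r (λ r′ → ≢ (at r′ n ≤-refl))
        (morse-hedlund ¬up n)
    ... | no none = contradiction up ¬up
      where
      det : ∀ {i j} → Blk n i j → w (n + i) ≡ w (n + j)
      det r = dne λ ≢ → none (_ , _ , r , ≢)
      iter : ∀ r {i j} → Blk n i j → Blk n (r + i) (r + j)
      iter zero    b = b
      iter (suc r) b = blk-tail (blk-snoc (iter r b) (det (iter r b)))
      periodic : ∀ {i j} → i < j → Blk n i j → UP w
      periodic {i} {j} i<j b with split-< i<j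
      ... | l , refl = suc l , n + i , z<s , λ x le → case split-≤ le of λ where
          (y , refl) → trans (cong w (swap-+ y n i)) (trans (det (iter y b))
            (cong w (lem y n i l)))
        where
        lem : ∀ y n i l → n + (y + (i + suc l)) ≡ suc l + (y + (n + i))
        lem = solve-∀
      up : UP w
      up with collision (Blk n) (blk-finite n) toℕ
      ... | a , b , r , a≢b with <-cmp (toℕ a) (toℕ b)
      ... | tri< a<b _ _ = periodic a<b r
      ... | tri≈ _ a≡b _ = contradiction (Fin.toℕ-injective a≡b) a≢b
      ... | tri> _ _ b<a = periodic b<a (B.sym r)

  -- Aperiodic words with at most n + 1 factors of each length n

  module Complexity (w : ℕ → Bool) (¬up : ¬ UP w)
                    (few : ∀ n → ¬ AtLeast (Word.Blk w n) (2 + n)) where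
    open Word w

    -- The tail from `N` on is aperiodic too and shows `suc n` factors by itself; `few` leaves no
    -- further factor that could occur only earlier.
    recurrent : ∀ n N i → ∃[ j ] N ≤ j × Blk n i j
    recurrent n N i = e a + N , m≤n+m N (e a) , B.sym r
      where
      w′ : ℕ → Bool
      w′ j = w (j + N)
      e    = proj₁ (morse-hedlund w′ (¬up ∘ shift-UP w N) n)
      e-inj = proj₂ (morse-hedlund w′ (¬up ∘ shift-UP w N) n)
      al : AtLeast (Blk n) (suc n)
      al = (λ a → e a + N) , λ a b r → e-inj a b (Word.blk λ k k<n →
        trans (cong w (+-assoc k (e a) N)) (trans (at r k k<n) (cong w (sym (+-assoc k (e b) N)))))
      a = proj₁ (atLeast-or-class (blk-equiv n) al (few n) i)
      r = proj₂ (atLeast-or-class (blk-equiv n) al (few n) i)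

    -- Two different right special factors of length `n` would each split into two, giving `3 + n`
    -- factors of length `suc n`.
    right-special-unique : ∀ n {p q p′ q′} → Blk n p q → w (n + p) ≢ w (n + q) →
                           Blk n p′ q′ → w (n + p′) ≢ w (n + q′) → Blk n p′ p
    right-special-unique n r ≢ r′ ≢′ = dne λ apart → few (suc n)
      (split₂ (blk-equiv n) (blk-equiv (suc n)) (blk-≤ (n≤1+n n)) _ _ _ _
        r (λ s → ≢ (at s n ≤-refl)) r′ (λ s → ≢′ (at s n ≤-refl)) apart (morse-hedlund w ¬up n))

    -- For a palindrome u of length N with factors cuc (at i) and c̄uc̄ (at j) such that cuc̄ does
    -- not occur, c̄u is the only right special factor of its length; by the palindrome property it
    -- does not occur among the N + 2 positions from i on, where a repetition then forces a period.
    module Palindrome (N i j : ℕ) (c : Bool)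
      (wi : w i ≡ c) (wi′ : w (N + suc i) ≡ c) (wj : w j ≡ not c) (wj′ : w (N + suc j) ≡ not c)
      (same : Blk N (suc i) (suc j))
      (pal : ∀ k l → k + suc l ≡ N → w (k + suc i) ≡ w (l + suc i))
      (none : ∀ p → w p ≡ c → Blk N (suc p) (suc i) → w (N + suc p) ≢ not c) where

      Z : ℕ → Set
      Z p = Blk (suc N) p j

      clash : ∀ {x} → w x ≡ c → w x ≢ not c
      clash p q = Bool.not-¬ refl (sym (trans (sym q) p))

      -- An occurrence of c̄u that starts inside u covers the final c of cuc. In this occurrence
      -- that c is the letter of u mirror to the one serving as the leading c̄, so the palindrome
      -- property would make c and c̄ equal.
      outside : ∀ s → s ≤ suc N → ¬ Z (s + i)
      outside zero    _   z = clash wi (trans (at z 0 z<s) wj)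
      outside (suc s) s≤N z with m≤n⇒m<n∨m≡n (s≤s⁻¹ s≤N)
      ... | inj₂ refl = clash wi′ (trans (cong w (+-suc s i)) (trans (at z 0 z<s) wj))
      ... | inj₁ s<N with split-< s<N
      ... | l , q = clash (begin
          w (s + suc i)            ≡⟨ pal s l q ⟩
          w (l + suc i)            ≡⟨ at same l (subst (l <_) q (m≤n+m (suc l) s)) ⟩
          w (l + suc j)            ≡⟨ cong w (+-suc l j) ⟩
          w (suc l + j)            ≡⟨ at z (suc l) (s≤s (subst (suc l ≤_) q (m≤n+m (suc l) s))) ⟨
          w (suc l + (suc s + i))  ≡⟨ cong w (trans (lem l s i) (cong (_+ suc i) q)) ⟩
          w (N + suc i)            ≡⟨ wi′ ⟩
          c                        ∎)
          (trans (cong w (+-suc s i)) (trans (at z 0 z<s) wj))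
        where
        open ≡-Reasoning
        lem : ∀ l s i → suc l + (suc s + i) ≡ (s + suc l) + suc i
        lem = solve-∀

      special : ∀ {p q} → Blk (suc N) p q → w (suc N + p) ≢ w (suc N + q) → Blk N (suc p) (suc i)
      special {p} {q} r ≢ = right-special-unique N same (λ e → clash wi′ (trans e wj′)) (blk-tail r)
        (λ e → ≢ (trans (cong w (sym (+-suc N p))) (trans e (cong w (+-suc N q)))))

      -- A right special factor of length `suc N` must have the tail u. It begins with c, as
      -- otherwise it is c̄u; but then one of its two continuations is the excluded cuc̄.
      determined : ∀ {p q} → Blk (suc N) p q → ¬ Z p → w (suc N + p) ≡ w (suc N + q)
      determined {p} {q} r ¬z with w (suc N + p) Bool.≟ w (suc N + q)
      ... | yes e = e
      ... | no ≢ with w p Bool.≟ c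
      ...   | no wp =
              contradiction (blk-cons (trans (Bool.¬-not wp) (sym wj)) (B.trans (special r ≢) same)) ¬z
      ...   | yes wp with w (suc N + p) Bool.≟ not c
      ...     | yes e = contradiction (trans (cong w (+-suc N p)) e) (none p wp (special r ≢))
      ...     | no ≢′ = contradiction
          (trans (cong w (+-suc N q)) (Bool.¬-not λ e → ≢ (trans (Bool.¬-not ≢′)
            (trans (Bool.not-involutive c) (sym e)))))
          (none q (trans (sym (at r 0 z<s)) wp) (B.trans (B.sym (blk-tail r)) (special r ≢)))

      repetition : ∀ {s s′} → s < s′ → s′ ≤ suc N → ¬ Blk (suc N) (s + i) (s′ + i)
      repetition {s} s<s′ s′≤ r with split-< s<s′
      ... | l , refl = ¬up (P , x , z<s , λ y le → case split-≤ le of λ where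
              (t , refl) → trans (at (proj₁ (iter t)) 0 z<s) (cong w (swap-+ t P x)))
        where
        P = suc l
        x = s + i
        -- The second component keeps the next `P` positions off c̄u, so that the following letter
        -- is determined. The position entering this range carries the same factor as the one
        -- leaving it.
        iter : ∀ t → Blk (suc N) (t + x) (t + (P + x)) × (∀ u → u < P → ¬ Z (u + (t + x)))
        iter zero = subst (Blk (suc N) x) (lem s l i) r , λ u u<P →
          subst (λ y → ¬ Z y) (+-assoc u s i) (outside (u + s)
            (≤-trans (+-monoˡ-≤ s (<⇒≤ u<P)) (≤-trans (≤-reflexive (+-comm P s)) s′≤)))
          where
          lem : ∀ s l i → (s + suc l) + i ≡ suc l + (s + i)
          lem = solve-∀
        iter (suc t) = let b , out = iter t in
          blk-tail (blk-snoc b (determined b (out 0 z<s))) , λ u u<P →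
            case m<1+n⇒m<n∨m≡n u<P of λ where
              (inj₁ u<l)  → subst (λ y → ¬ Z y) (sym (+-suc u (t + x))) (out (suc u) (s≤s u<l))
              (inj₂ refl) → λ z → out 0 z<s (B.trans b (subst Z (lem u t x) z))
          where
          lem : ∀ u t x → u + (suc t + x) ≡ t + (suc u + x)
          lem = solve-∀

      -- The position `j` and the `2 + N` positions from `i` on are one more than the possible
      -- factors of length `suc N`.
      absurd : ⊥
      absurd with collision (Blk (suc N)) (few (suc N)) e
        where
        e : Fin (3 + N) → ℕ
        e zero    = j
        e (suc a) = toℕ a + i
      ... | zero  , zero  , r , ≢ = ≢ refl
      ... | zero  , suc b , r , ≢ = outside (toℕ b) (s≤s⁻¹ (Fin.toℕ<n b)) (B.sym r)
      ... | suc a , zero  , r , ≢ = outside (toℕ a) (s≤s⁻¹ (Fin.toℕ<n a)) r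
      ... | suc a , suc b , r , ≢ with <-cmp (toℕ a) (toℕ b)
      ... | tri< a<b _ _ = repetition a<b (s≤s⁻¹ (Fin.toℕ<n b)) r
      ... | tri≈ _ a≡b _ = ≢ (cong suc (Fin.toℕ-injective a≡b))
      ... | tri> _ _ b<a = repetition b<a (s≤s⁻¹ (Fin.toℕ<n a)) (B.sym r)

    Unbalanced : ℕ → Set
    Unbalanced n = ∃₂ λ i j → 2 + cnt n j ≤ cnt n i

    -- A shortest unbalanced pair has the form 1u1, 0u0 with u a palindrome.
    module Shortest (N i j : ℕ) (unb : 2 + cnt (2 + N) j ≤ cnt (2 + N) i)
                    (min : ∀ k → k < 2 + N → ¬ Unbalanced k) where

      bal : ∀ k → k < 2 + N → ∀ x y → cnt k x ≤ suc (cnt k y)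
      bal k k< x y = ≮⇒≥ λ lt → min k k< (x , y , lt)

      -- Both parts of the block are shorter than the minimal unbalanced length, so each contributes
      -- at most one to a difference of at least two, hence exactly one.
      prefix : ∀ k → k < suc N → cnt (suc k) i ≡ suc (cnt (suc k) j)
      prefix k k< with split-< k<
      ... | l , q = lin 6 (λ a b a′ b′ n n′ → (a ≼ con 1 ⊕ a′) ⇒ (b ≼ con 1 ⊕ b′) ⇒
              (n ≈ᵉ a ⊕ b) ⇒ (n′ ≈ᵉ a′ ⊕ b′) ⇒ (con 2 ⊕ n′ ≼ n) ⇒ (⊢ (a ≈ᵉ con 1 ⊕ a′)))
            refl (cnt (suc k) i) (cnt (suc l) (suc k + i)) (cnt (suc k) j) (cnt (suc l) (suc k + j))
            (cnt (2 + N) i) (cnt (2 + N) j)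
            (bal (suc k) (s≤s k<) i j)
            (bal (suc l) (s≤s (subst (suc l ≤_) q (m≤n+m (suc l) k))) _ _)
            (dec i) (dec j) unb
        where
        dec : ∀ x → cnt (2 + N) x ≡ cnt (suc k) x + cnt (suc l) (suc k + x)
        dec x = trans (cong (λ m → cnt m x) (cong suc (sym q))) (cnt-+ (suc k) (suc l) x)

      ends : w i ≡ true × w j ≡ false
      ends = bit-suc (trans (sym (cnt-1 i)) (trans (prefix 0 z<s) (cong suc (cnt-1 j))))

      same : Blk N (suc i) (suc j)
      same = blk λ k k<N → trans (cong w (+-suc k i)) (trans (bit-injective
        (lin 6 (λ a a′ b b′ n n′ → (n ≈ᵉ a ⊕ b) ⇒ (n′ ≈ᵉ a′ ⊕ b′) ⇒ (n ≈ᵉ con 1 ⊕ n′) ⇒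
                  (a ≈ᵉ con 1 ⊕ a′) ⇒ (⊢ (b ≈ᵉ b′))) refl
          (cnt (suc k) i) (cnt (suc k) j) (bit (w (suc k + i))) (bit (w (suc k + j)))
          (cnt (2 + k) i) (cnt (2 + k) j)
          (cnt-snoc (suc k) i) (cnt-snoc (suc k) j) (prefix (suc k) (s≤s k<N))
          (prefix k (m<n⇒m<1+n k<N))))
        (cong w (sym (+-suc k j))))

      ends′ : w (N + suc i) ≡ true × w (N + suc j) ≡ false
      ends′ = bit-suc (≤-antisym
          (≤-trans (bit≤1 _) (s≤s z≤n))
          (lin 6 (λ a a′ b b′ n n′ → (n ≈ᵉ a ⊕ b) ⇒ (n′ ≈ᵉ a′ ⊕ b′) ⇒ (con 2 ⊕ n′ ≼ n) ⇒
                  (a ≈ᵉ con 1 ⊕ a′) ⇒ (⊢ (con 1 ⊕ b′ ≼ b))) refl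
          (cnt (suc N) i) (cnt (suc N) j) (bit (w (N + suc i))) (bit (w (N + suc j)))
          (cnt (2 + N) i) (cnt (2 + N) j)
          (last i) (last j) unb (prefix N ≤-refl)))
        where
        last : ∀ x → cnt (2 + N) x ≡ cnt (suc N) x + bit (w (N + suc x))
        last x = trans (cnt-snoc (suc N) x) (cong (λ y → cnt (suc N) x + bit (w y)) (sym (+-suc N x)))

      cnt-wrap : ∀ k y → cnt (2 + k) y ≡ bit (w y) + (cnt k (suc y) + bit (w (k + suc y)))
      cnt-wrap k y = cong (bit (w y) +_) (cnt-snoc k (suc y))

      cnt-mid : ∀ k l {x y} → k + suc l ≡ N → Blk N x y → cnt k (suc l + x) ≡ cnt k (suc l + y)
      cnt-mid k l q r = blk⇒cnt k (blk-shift k (suc l) (blk-len (sym q) r))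

      -- By induction the first and the last `k` letters of u mirror each other and have equal
      -- counts. If the next letters inwards differed, adding them and the outer letters of 1u1 and
      -- 0u0 would give an unbalanced pair of length `2 + k`.
      palindrome : ∀ k l → k + suc l ≡ N → w (k + suc i) ≡ w (l + suc i)
      palindrome k = go (suc k) k ≤-refl
        where
        go : ∀ B k → k < B → ∀ l → k + suc l ≡ N → w (k + suc i) ≡ w (l + suc i)
        go (suc B) k k<B l q = case-split (w (k + suc i)) (w (l + suc i)) refl refl
          where
          k<N : k < N
          k<N = subst (k <_) q (m<m+n k z<s)
          l<N : l < N
          l<N = subst (l <_) q (m≤n+m (suc l) k)
          rev : cnt k (suc i) ≡ cnt k (suc l + suc i)
          rev = cnt-reverse k (suc i) (suc l + suc i) λ a b q′ →
            trans (go B a (≤-trans (subst (a <_) q′ (m<m+n a z<s)) (s≤s⁻¹ k<B)) (b + suc l)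
                    (trans (lem a b l) (trans (cong (_+ suc l) q′) q)))
                  (cong w (+-assoc b (suc l) (suc i)))
            where
            lem : ∀ a b l → a + suc (b + suc l) ≡ (a + suc b) + suc l
            lem = solve-∀
          last : ∀ x → k + (suc l + x) ≡ N + x
          last x = trans (sym (+-assoc k (suc l) x)) (cong (_+ x) q)
          case-split : ∀ a b → w (k + suc i) ≡ a → w (l + suc i) ≡ b → w (k + suc i) ≡ w (l + suc i)
          case-split true  true  p q = trans p (sym q)
          case-split false false p q = trans p (sym q)
          case-split false true  p p′ = contradiction (l + suc i , j , ≤-reflexive
            (trans (cong (2 +_) cj) (sym ci))) (min (2 + k) (s≤s (s≤s k<N)))
            where
            cj : cnt (2 + k) j ≡ cnt k (suc i)
            cj = trans (cnt-wrap k j) (cong₂ _+_ (cong bit (proj₂ ends)) (trans (cong₂ _+_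
              (sym (blk⇒cnt k (blk-≤ (<⇒≤ k<N) _ _ same)))
              (cong bit (trans (sym (at same k k<N)) p))) (+-identityʳ _)))
            ci : cnt (2 + k) (l + suc i) ≡ 2 + cnt k (suc i)
            ci = trans (cnt-wrap k (l + suc i)) (cong₂ _+_ (cong bit p′) (trans (cong₂ _+_
              (sym rev) (cong bit (trans (cong w (last (suc i))) (proj₁ ends′)))) (+-comm _ 1)))
          case-split true  false p p′ = contradiction (i , l + suc j , ≤-reflexive
            (trans (cong (2 +_) cj) (sym ci))) (min (2 + k) (s≤s (s≤s k<N)))
            where
            ci : cnt (2 + k) i ≡ 2 + cnt k (suc i)
            ci = trans (cnt-wrap k i) (cong₂ _+_ (cong bit (proj₁ ends)) (trans (cong₂ _+_
              refl (cong bit p)) (+-comm _ 1)))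
            cj : cnt (2 + k) (l + suc j) ≡ cnt k (suc i)
            cj = trans (cnt-wrap k (l + suc j)) (cong₂ _+_ (cong bit (trans (sym (at same l l<N)) p′))
              (trans (cong₂ _+_ (trans (sym (cnt-mid k l q same)) (sym rev))
                (cong bit (trans (cong w (last (suc j))) (proj₂ ends′)))) (+-identityʳ _)))

      -- If both 1u0 and 0u1 occurred, then 1u and 0u would be two right special factors of one
      -- length. The word that is missing decides which letter plays the role of c.
      absurd : ⊥
      absurd with em {∃[ p ] w p ≡ true × Blk N (suc p) (suc i) × w (N + suc p) ≡ false}
      ... | no no-tuf = Palindrome.absurd N i j true (proj₁ ends) (proj₁ ends′) (proj₂ ends)
              (proj₂ ends′) same palindrome λ p wp b e → no-tuf (p , wp , b , e)
      ... | yes (p , wp , b , e) = Palindrome.absurd N j i false (proj₂ ends) (proj₂ ends′)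
              (proj₁ ends) (proj₁ ends′) (B.sym same)
              (λ k l q → trans (sym (at same k (subst (k <_) q (m<m+n k z<s))))
                (trans (palindrome k l q) (at same l (subst (l <_) q (m≤n+m (suc l) k)))))
              λ q wq b′ e′ → true≢false (trans (sym (proj₁ ends)) (trans
                (at (right-special-unique (suc N)
                  (blk-cons {j = q} (trans (proj₂ ends) (sym wq)) (B.sym b′))
                  (λ s → true≢false (sym (trans (sym (proj₂ ends′)) (trans (cong w (+-suc N j))
                     (trans s (trans (cong w (sym (+-suc N q))) e′))))))
                  (blk-cons {j = p} (trans (proj₁ ends) (sym wp)) (B.sym b))
                  (λ s → true≢false (trans (sym (proj₁ ends′)) (trans (cong w (+-suc N i))
                     (trans s (trans (cong w (sym (+-suc N p))) e)))))
                  ) 0 z<s) (proj₂ ends)))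
        where
        true≢false : true ≢ false
        true≢false ()

    balanced : Balanced
    balanced n i j = ≮⇒≥ λ unb → case least Unbalanced n (i , j , unb) of λ where
      (0 , (_ , _ , ()) , _)
      (1 , (x , y , u) , _) → 1≰0 (lin 2 (λ a b → (con 2 ⊕ b ≼ a) ⇒ (a ≼ con 1) ⇒ (⊢ (con 1 ≼ con 0)))
          refl (cnt 1 x) (cnt 1 y) u (subst (_≤ 1) (sym (cnt-1 x)) (bit≤1 (w x))))
      (suc (suc N) , (x , y , u) , min) → Shortest.absurd N x y u min

-- Balanced aperiodic words

cnt-cong : ∀ (v w : ℕ → Bool) n {i j} → (∀ k → k < n → v (k + i) ≡ w (k + j)) →
           Word.cnt v n i ≡ Word.cnt w n j
cnt-cong v w zero    h = refl
cnt-cong v w (suc n) h = cong₂ _+_ (cong bit (h 0 z<s)) (cnt-cong v w n λ k k<n →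
  trans (cong v (+-suc k _)) (trans (h (suc k) (s≤s k<n)) (cong w (sym (+-suc k _)))))

cnt-not : ∀ (w : ℕ → Bool) n i → Word.cnt w n i + Word.cnt (not ∘ w) n i ≡ n
cnt-not w zero    i = refl
cnt-not w (suc n) i = trans (lem (bit (w i)) _ (bit (not (w i))) _)
  (cong₂ _+_ (one (w i)) (cnt-not w n (suc i)))
  where
  lem : ∀ a b c d → (a + b) + (c + d) ≡ (a + c) + (b + d)
  lem = solve-∀
  one : ∀ b → bit b + bit (not b) ≡ 1
  one true  = refl
  one false = refl

module Balance (em : ExcludedMiddle 0ℓ) where
  open Classical em

  module Balanced (w : ℕ → Bool) (¬up : ¬ UP w) (bal : Word.Balanced w) where
    open Word w hiding (Balanced)

    -- Between two lengths the excess of `p` over `q` changes by the excess over the remaining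
    -- letters, which balance bounds by one. In this form balance orders count vectors into a chain.
    balanced₂ : ∀ s t p q → cnt s p + cnt t q ≤ suc (cnt s q + cnt t p)
    balanced₂ s t p q with ≤-total s t
    ... | inj₁ s≤t with m≤n⇒∃[o]m+o≡n s≤t
    ... | d , refl = lin 6 (λ a b c e f g → (f ≈ᵉ b ⊕ c) ⇒ (g ≈ᵉ a ⊕ e) ⇒ (c ≼ con 1 ⊕ e) ⇒
            (⊢ (a ⊕ f ≼ con 1 ⊕ (b ⊕ g)))) refl
          (cnt s p) (cnt s q) (cnt d (s + q)) (cnt d (s + p)) (cnt (s + d) q) (cnt (s + d) p)
          (cnt-+ s d q) (cnt-+ s d p) (bal d _ _)
    balanced₂ s t p q | inj₂ t≤s with m≤n⇒∃[o]m+o≡n t≤s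
    ... | d , refl = lin 6 (λ a b c e f g → (f ≈ᵉ b ⊕ c) ⇒ (g ≈ᵉ a ⊕ e) ⇒ (e ≼ con 1 ⊕ c) ⇒
            (⊢ (g ⊕ b ≼ con 1 ⊕ (f ⊕ a)))) refl
          (cnt t p) (cnt t q) (cnt d (t + q)) (cnt d (t + p)) (cnt (t + d) q) (cnt (t + d) p)
          (cnt-+ t d q) (cnt-+ t d p) (bal d _ _)

    cnt-blocks-≥ : ∀ M K L i → (∀ j → j < L → K ≤ cnt M (j * M + i)) → L * K ≤ cnt (L * M) i
    cnt-blocks-≥ M K zero    i h = z≤n
    cnt-blocks-≥ M K (suc L) i h = subst (suc L * K ≤_) (sym (cnt-+ M (L * M) i))
      (+-mono-≤ (h 0 z<s) (cnt-blocks-≥ M K L (M + i) λ j j<L →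
        subst (λ x → K ≤ cnt M x) (lem M (j * M) i) (h (suc j) (s≤s j<L))))
      where
      lem : ∀ M x i → (M + x) + i ≡ x + (M + i)
      lem = solve-∀

    cnt-blocks-≤ : ∀ M K L i → (∀ j → j < L → cnt M (j * M + i) ≤ K) → cnt (L * M) i ≤ L * K
    cnt-blocks-≤ M K zero    i h = z≤n
    cnt-blocks-≤ M K (suc L) i h = subst (_≤ suc L * K) (sym (cnt-+ M (L * M) i))
      (+-mono-≤ (h 0 z<s) (cnt-blocks-≤ M K L (M + i) λ j j<L →
        subst (λ x → cnt M x ≤ K) (lem M (j * M) i) (h (suc j) (s≤s j<L))))
      where
      lem : ∀ M x i → (M + x) + i ≡ x + (M + i)
      lem = solve-∀

    one-sided : ∀ M K → (∀ i → K ≤ cnt M i) ⊎ (∀ i → cnt M i ≤ K)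
    one-sided M K with em {∃[ p ] cnt M p < K}
    ... | yes (p , lt) = inj₂ λ i → ≤-trans (bal M i p) lt
    ... | no none      = inj₁ λ i → ≮⇒≥ λ lt → none (i , lt)

    -- If arbitrarily long concatenations of M-blocks with K true letters occur, then by balance
    -- each progression with difference M starts at most one block with another count.
    constant-counts : ∀ M K → 1 ≤ M → ¬ (∀ L → ∃[ i ] (∀ j → j < L → cnt M (j * M + i) ≡ K))
    constant-counts M K 1≤M long = ¬up (M , N * M , 1≤M , per)
      where
      block-sum : ∀ L → ∃[ i ] cnt (L * M) i ≡ L * K
      block-sum L = let i , h = long L in i , ≤-antisym
        (cnt-blocks-≤ M K L i λ j j<L → ≤-reflexive (h j j<L))
        (cnt-blocks-≥ M K L i λ j j<L → ≤-reflexive (sym (h j j<L)))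
      three : ∀ j q → cnt ((2 + j) * M) q ≡ cnt M q + (cnt (j * M) (M + q) + cnt M (suc j * M + q))
      three j q = trans (cnt-+ M (M + j * M) q) (cong (cnt M q +_) (trans
        (cong (λ x → cnt x (M + q)) (+-comm M (j * M))) (trans (cnt-+ (j * M) M (M + q))
        (cong (λ x → cnt (j * M) (M + q) + cnt M x) (lem (j * M) M q)))))
        where
        lem : ∀ x M q → x + (M + q) ≡ (M + x) + q
        lem = solve-∀
      once : ∀ q → cnt M q ≢ K → ∀ j → cnt M (suc j * M + q) ≡ K
      once q ≢K j with one-sided M K | block-sum (2 + j)
      ... | inj₁ low | i , total = ≤-antisym
        (lin 7 (λ k jk a b c t t′ → (k ≺ a) ⇒ (jk ≼ b) ⇒ (t ≈ᵉ a ⊕ (b ⊕ c)) ⇒ (t′ ≈ᵉ k ⊕ (k ⊕ jk)) ⇒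
          (t ≼ con 1 ⊕ t′) ⇒ (⊢ (c ≼ k))) refl
          K (j * K) (cnt M q) (cnt (j * M) (M + q)) (cnt M (suc j * M + q)) (cnt ((2 + j) * M) q)
          (cnt ((2 + j) * M) i) (≤∧≢⇒< (low q) (≢K ∘ sym)) (cnt-blocks-≥ M K j _ λ _ _ → low _)
          (three j q) total (bal ((2 + j) * M) q i)) (low _)
      ... | inj₂ up | i , total = ≤-antisym (up _)
        (lin 7 (λ k jk a b c t t′ → (a ≺ k) ⇒ (b ≼ jk) ⇒ (t ≈ᵉ a ⊕ (b ⊕ c)) ⇒ (t′ ≈ᵉ k ⊕ (k ⊕ jk)) ⇒
          (t′ ≼ con 1 ⊕ t) ⇒ (⊢ (k ≼ c))) refl
          K (j * K) (cnt M q) (cnt (j * M) (M + q)) (cnt M (suc j * M + q)) (cnt ((2 + j) * M) q)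
          (cnt ((2 + j) * M) i) (≤∧≢⇒< (up q) ≢K) (cnt-blocks-≤ M K j _ λ _ _ → up _)
          (three j q) total (bal ((2 + j) * M) i q))
      eventually : ∃[ N ] (∀ r → r < M → ∀ s → N ≤ s → cnt M (s * M + r) ≡ K)
      eventually = monotone-bound (λ r N → ∀ s → N ≤ s → cnt M (s * M + r) ≡ K)
        (λ r N≤N′ h s N′≤s → h s (≤-trans N≤N′ N′≤s)) M λ r _ → from r
        where
        from : ∀ r → ∃[ N ] (∀ s → N ≤ s → cnt M (s * M + r) ≡ K)
        from r with em {∃[ s ] cnt M (s * M + r) ≢ K}
        ... | no none = 0 , λ s _ → dne λ ≢ → none (s , ≢)
        ... | yes (s , bad) = suc s , λ s′ s<s′ → case split-≤ s<s′ of λ where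
                (l , refl) → trans (cong (cnt M) (lem l s M r)) (once _ bad l)
          where
          lem : ∀ l s M r → (l + suc s) * M + r ≡ suc l * M + (s * M + r)
          lem = solve-∀
      N = proj₁ eventually
      good : ∀ i → N * M ≤ i → cnt M i ≡ K
      good i le with residue M i 1≤M
      ... | s , r , r<M , refl = proj₂ eventually r r<M s (≮⇒≥ λ s<N →
        <⇒≱ (<-≤-trans (+-monoʳ-< (s * M) r<M) (≤-trans (≤-reflexive (+-comm (s * M) M))
          (*-monoˡ-≤ M s<N))) le)
      per : ∀ i → N * M ≤ i → w i ≡ w (M + i)
      per i le = bit-injective (+-cancelˡ-≡ K _ _ (begin
        K + bit (w i)                ≡⟨ +-comm K _ ⟩
        bit (w i) + K                ≡⟨ cong (bit (w i) +_) (good (suc i) (m≤n⇒m≤1+n le)) ⟨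
        cnt (suc M) i                ≡⟨ cnt-snoc M i ⟩
        cnt M i + bit (w (M + i))    ≡⟨ cong (_+ _) (good i le) ⟩
        K + bit (w (M + i))          ∎))
        where open ≡-Reasoning

    run-bound : ∀ b → ∃[ R ] (∀ i → ∃[ k ] k < R × w (k + i) ≡ b)
    run-bound b = dne λ none → constant-counts 1 (bit (not b)) ≤-refl λ L → dne λ ¬ex →
      none (L , λ i → dne λ ¬hit → ¬ex (i , λ j j<L → trans (cnt-1 _) (cong bit
        (trans (cong (λ x → w (x + i)) (*-identityʳ j)) (Bool.¬-not λ e → ¬hit (j , j<L , e))))))

    -- Let `y` and `N * q + y` carry false. By `after-zero` the count of a multiple of `q` letters
    -- after a false letter does not depend on the place, so cutting `N * q` letters off either end
    -- of a long block after `y` leaves the same count. Hence all `N * q`-blocks in a row have one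
    -- count.
    no-true-progression : ∀ q c → 1 ≤ q → ¬ (∀ s → w (s * q + c) ≡ true)
    no-true-progression q c 1≤q h = constant-counts (N * q) (cnt (N * q) (suc y)) (1≤* 1≤N 1≤q)
      λ _ → suc y , λ k _ → +-cancelˡ-≡ (E (k * N)) _ _ (begin
        E (k * N) + cnt (N * q) (k * (N * q) + suc y)
          ≡⟨ cong (λ x → E (k * N) + cnt (N * q) (x + suc y)) (*-assoc k N q) ⟨
        E (k * N) + cnt (N * q) (k * N * q + suc y)
          ≡⟨ cnt-+ (k * N * q) (N * q) (suc y) ⟨
        cnt (k * N * q + N * q) (suc y)
          ≡⟨ cong (λ x → cnt x (suc y)) (+-comm (k * N * q) (N * q)) ⟩
        cnt (N * q + k * N * q) (suc y)
          ≡⟨ cnt-+ (N * q) (k * N * q) (suc y) ⟩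
        E N + cnt (k * N * q) (N * q + suc y)
          ≡⟨ cong (λ x → E N + cnt (k * N * q) x) (+-suc (N * q) y) ⟩
        E N + cnt (k * N * q) (suc (N * q + y))
          ≡⟨ cong (E N +_) (after-zero (k * N) wy′ wy) ⟩
        E N + E (k * N)
          ≡⟨ +-comm (E N) _ ⟩
        E (k * N) + E N ∎)
      where
      open ≡-Reasoning
      -- Blocks of length L * q + 1 starting in the progression have the same letter at both ends,
      -- which leaves only one possible count after a false letter.
      after-zero : ∀ L {j j′} → w j ≡ false → w j′ ≡ false → cnt (L * q) (suc j) ≡ cnt (L * q) (suc j′)
      after-zero zero    _  _   = refl
      after-zero (suc L) {j} {j′} wj wj′ with em {∃₂ λ s s′ → cnt M (s * q + c) < cnt M (s′ * q + c)}
        where M = suc L * q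
      ... | no none = contradiction (λ _ → c , λ k _ → trans
          (cong (λ x → cnt M (x + c)) (sym (*-assoc k (suc L) q)))
          (≤-antisym (≮⇒≥ λ lt → none (0 , k * suc L , lt)) (≮⇒≥ λ lt → none (k * suc L , 0 , lt))))
          (constant-counts M (cnt M c) (1≤* {suc L} (s≤s z≤n) 1≤q))
        where M = suc L * q
      ... | yes (s , s′ , lt) = trans (value wj) (sym (value wj′))
        where
        M = suc L * q
        x′ = s′ * q + c
        value : ∀ {j} → w j ≡ false → cnt M (suc j) ≡ cnt M x′
        value {j} wj = ≤-antisym
          (≤-trans (bal M (suc j) (s * q + c)) lt)
          (lin 5 (λ a b t t′ x → (t′ ≈ᵉ b ⊕ x) ⇒ (x ≈ᵉ con 1) ⇒ (t ≈ᵉ a) ⇒ (t′ ≼ con 1 ⊕ t) ⇒ (⊢ (b ≼ a)))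
            refl (cnt M (suc j)) (cnt M x′) (cnt (suc M) j) (cnt (suc M) x′) (bit (w (M + x′)))
            (cnt-snoc M x′) (cong bit (trans (cong w (lem (suc L) s′ q c)) (h (suc L + s′))))
            (cong (λ b → bit b + cnt M (suc j)) wj) (bal (suc M) x′ j))
          where
          lem : ∀ L s q c → L * q + (s * q + c) ≡ (L + s) * q + c
          lem = solve-∀
      -- Each of `suc q` consecutive stretches of length `R` contains a false letter; two of these
      -- positions agree modulo `q`.
      zeros : ∃₂ λ N y → 1 ≤ N × w y ≡ false × w (N * q + y) ≡ false
      zeros with run-bound false
      ... | R , hit = pick (Fin.pigeonhole (n<1+n q) (λ a → fromℕ< (r<q a)))
        where
        z : Fin (suc q) → ℕ
        z a = proj₁ (hit (toℕ a * R)) + toℕ a * R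
        wz : ∀ a → w (z a) ≡ false
        wz a = proj₂ (proj₂ (hit (toℕ a * R)))
        z-mono : ∀ a b → toℕ a < toℕ b → z a < z b
        z-mono a b a<b = <-≤-trans (+-monoˡ-< (toℕ a * R) (proj₁ (proj₂ (hit (toℕ a * R)))))
          (≤-trans (*-monoˡ-≤ R a<b) (m≤n+m _ _))
        r : Fin (suc q) → ℕ
        r a = proj₁ (proj₂ (residue q (z a) 1≤q))
        r<q : ∀ a → r a < q
        r<q a = proj₁ (proj₂ (proj₂ (residue q (z a) 1≤q)))
        s : Fin (suc q) → ℕ
        s a = proj₁ (residue q (z a) 1≤q)
        z≡ : ∀ a → z a ≡ s a * q + r a
        z≡ a = proj₂ (proj₂ (proj₂ (residue q (z a) 1≤q)))
        pick : (∃₂ λ a b → a Fin.< b × fromℕ< (r<q a) ≡ fromℕ< (r<q b)) → _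
        pick (a , b , a<b , eq) = proj₁ gap , z a , proj₁ (proj₂ gap) , wz a ,
            trans (cong w (sym (proj₂ (proj₂ gap)))) (wz b)
          where
          ra≡rb : r a ≡ r b
          ra≡rb = trans (sym (Fin.toℕ-fromℕ< (r<q a))) (trans (cong toℕ eq) (Fin.toℕ-fromℕ< (r<q b)))
          sa<sb : s a < s b
          sa<sb = *-cancelʳ-< q (s a) (s b) (+-cancelʳ-< (r a) (s a * q) (s b * q)
            (subst₂ _<_ (z≡ a) (trans (z≡ b) (cong (s b * q +_) (sym ra≡rb))) (z-mono a b a<b)))
          gap : ∃[ N ] 1 ≤ N × z b ≡ N * q + z a
          gap with split-< sa<sb
          ... | l , e = suc l , z<s , trans (z≡ b) (trans (cong₂ (λ x y → x * q + y) (sym e) (sym ra≡rb))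
                (trans (lem (s a) (suc l) q (r a)) (cong (suc l * q +_) (sym (z≡ a)))))
            where
            lem : ∀ s l q r → (s + l) * q + r ≡ l * q + (s * q + r)
            lem = solve-∀
      N = proj₁ zeros
      y = proj₁ (proj₂ zeros)
      1≤N : 1 ≤ N
      1≤N = proj₁ (proj₂ (proj₂ zeros))
      wy : w y ≡ false
      wy = proj₁ (proj₂ (proj₂ (proj₂ zeros)))
      wy′ : w (N * q + y) ≡ false
      wy′ = proj₂ (proj₂ (proj₂ (proj₂ zeros)))
      E : ℕ → ℕ
      E L = cnt (L * q) (suc y)

    -- The blocks of length `P` that follow one another in `z` from `N` on are all equal; as long
    -- factors of `z` occur in `w`, so do long rows of blocks with one count.
    not-periodic-factors : ∀ (z : ℕ → Bool) → UP z →
      ¬ (∀ n i → ∃[ j ] (∀ k → k < n → z (k + i) ≡ w (k + j)))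
    not-periodic-factors z (P , N , 1≤P , per) sub =
      constant-counts P (Word.cnt z P N) 1≤P λ L → let j , h = sub (L * P) N in
        j , λ l l<L → trans (sym (cnt-cong z w P λ k k<P →
            trans (cong z (sym (+-assoc k (l * P) N))) (trans
              (h (k + l * P) (<-≤-trans (+-monoˡ-< (l * P) k<P) (*-monoˡ-≤ P l<L)))
              (cong w (+-assoc k (l * P) j)))))
          (cnt-cong z z P λ k k<P → sym (trans (up-multiple z P N per l (k + N) (m≤n+m N k))
            (cong z (swap-+ (l * P) k N))))

  module _ (w : ℕ → Bool) (¬up : ¬ UP w) (bal : Word.Balanced w) where

    not-balanced : Word.Balanced (not ∘ w)
    not-balanced n i j = lin 5 (λ a b a′ b′ m → (a ⊕ a′ ≈ᵉ m) ⇒ (b ⊕ b′ ≈ᵉ m) ⇒ (b ≼ con 1 ⊕ a) ⇒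
        (⊢ (a′ ≼ con 1 ⊕ b′))) refl
      (Word.cnt w n i) (Word.cnt w n j) (Word.cnt (not ∘ w) n i) (Word.cnt (not ∘ w) n j) n
      (cnt-not w n i) (cnt-not w n j) (bal n j i)

    not-aperiodic : ¬ UP (not ∘ w)
    not-aperiodic (P , N , 1≤P , h) = ¬up (P , N , 1≤P , λ i le → Bool.not-injective (h i le))

    no-constant-progression : ∀ b q c → 1 ≤ q → ¬ (∀ s → w (s * q + c) ≡ b)
    no-constant-progression true  q c 1≤q h = Balanced.no-true-progression w ¬up bal q c 1≤q h
    no-constant-progression false q c 1≤q h =
      Balanced.no-true-progression (not ∘ w) not-aperiodic not-balanced q c 1≤q (cong not ∘ h)

-- Patterns of a linear order on ℕ

record Order : Set where
  field
    lt       : ℕ → ℕ → Bool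
    lt-irrefl : ∀ i → lt i i ≡ false
    lt-trans : ∀ {i j k} → lt i j ≡ true → lt j k ≡ true → lt i k ≡ true
    lt-total : ∀ {i j} → i ≢ j → lt i j ≡ not (lt j i)

∈⇒≤sum : ∀ {a L} → a ∈ L → a ≤ sum L
∈⇒≤sum {a} {x ∷ L} (here refl) = m≤m+n a (sum L)
∈⇒≤sum {a} {x ∷ L} (there a∈L) = ≤-trans (∈⇒≤sum a∈L) (m≤n+m (sum L) x)

ap : ℕ → ℕ → List ℕ
ap m zero    = []
ap m (suc n) = n * m ∷ ap m n

length-ap : ∀ m n → length (ap m n) ≡ n
length-ap m zero    = refl
length-ap m (suc n) = cong suc (length-ap m n)

∈-ap : ∀ {m n k} → k < n → k * m ∈ ap m n
∈-ap {m} {suc n} k<sn with m<1+n⇒m<n∨m≡n k<sn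
... | inj₁ k<n  = there (∈-ap k<n)
... | inj₂ refl = here refl

module Patterns (O : Order) where
  open Order O public

  γ : ℕ → ℕ → Bool
  γ m i = lt i (m + i)

  -- The word of ascents along the progression with difference `m` that starts at `ρ`.
  step : ℕ → ℕ → ℕ → Bool
  step m ρ s = γ m (s * m + ρ)

  -- One period and one threshold serve all distances `m`. Eventual periodicity of every single
  -- `γ m` is weaker.
  UPₒ : Set
  UPₒ = ∃[ t ] ∃[ N ] 1 ≤ t × (∀ i → N ≤ i → ∀ m → 1 ≤ m → γ m i ≡ γ m (t + i))

  record Pat (L : List ℕ) (i j : ℕ) : Set where
    constructor pat
    field same : ∀ a b → a ∈ L → b ∈ L → lt (a + i) (b + i) ≡ lt (a + j) (b + j)
  open Pat public

  pat-equiv : ∀ L → IsEquivalence (Pat L)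
  pat-equiv L = record
    { refl  = pat λ _ _ _ _ → refl
    ; sym   = λ r → pat λ a b a∈ b∈ → sym (same r a b a∈ b∈)
    ; trans = λ r s → pat λ a b a∈ b∈ → trans (same r a b a∈ b∈) (same s a b a∈ b∈)
    }

  module P {L} = IsEquivalence (pat-equiv L)

  pat-⊆ : ∀ {K L} → (∀ {a} → a ∈ K → a ∈ L) → ∀ i j → Pat L i j → Pat K i j
  pat-⊆ K⊆L i j r = pat λ a b a∈ b∈ → same r a b (K⊆L a∈) (K⊆L b∈)

  patternBound : ℕ → ℕ
  patternBound n = (2 ^ n) ^ n

  pat-finite : ∀ L → ¬ AtLeast (Pat L) (suc (patternBound (length L)))
  pat-finite L = finite-code code sep
    where
    n = length L
    enc : Bool → Fin 2
    enc true  = suc zero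
    enc false = zero
    enc-inj : ∀ {a b} → enc a ≡ enc b → a ≡ b
    enc-inj {true}  {true}  _ = refl
    enc-inj {false} {false} _ = refl
    row : ℕ → Fin n → Fin n → Fin 2
    row i a b = enc (lt (List.lookup L a + i) (List.lookup L b + i))
    code : ℕ → Fin (patternBound n)
    code i = funToFin λ a → funToFin (row i a)
    decode : ∀ i a b → finToFun (finToFun (code i) a) b ≡ row i a b
    decode i a b = trans (cong (λ c → finToFun c b) (Fin.finToFun-funToFin (λ a → funToFin (row i a)) a))
                         (Fin.finToFun-funToFin (row i a) b)
    lookup-index : ∀ {K : List ℕ} {a} (a∈ : a ∈ K) → List.lookup K (index a∈) ≡ a
    lookup-index (here refl) = refl
    lookup-index (there a∈)  = lookup-index a∈
    sep : ∀ i j → code i ≡ code j → Pat L i j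
    sep i j q = pat λ a b a∈ b∈ → subst₂ (λ x y → lt (x + i) (y + i) ≡ lt (x + j) (y + j))
      (lookup-index a∈) (lookup-index b∈) (enc-inj (trans (sym (decode i (index a∈) (index b∈)))
        (trans (cong (λ c → finToFun (finToFun c (index a∈)) (index b∈)) q)
               (decode j (index a∈) (index b∈)))))

  pat-shift : ∀ {K L} c → (∀ {a} → a ∈ K → ∃[ b ] b ∈ L × a ≡ b + c) →
              ∀ i j → Pat L (c + i) (c + j) → Pat K i j
  pat-shift c cover i j r = pat λ a b a∈ b∈ → case cover a∈ of λ where
    (a′ , a′∈ , refl) → case cover b∈ of λ where
      (b′ , b′∈ , refl) → subst₂ _≡_
        (sym (cong₂ lt (+-assoc a′ c i) (+-assoc b′ c i)))
        (sym (cong₂ lt (+-assoc a′ c j) (+-assoc b′ c j))) (same r a′ b′ a′∈ b′∈)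

  pat-γ : ∀ {L i j} → Pat L i j → ∀ a m → a ∈ L → m + a ∈ L → γ m (a + i) ≡ γ m (a + j)
  pat-γ {L} {i} {j} r a m a∈ b∈ = trans (cong (lt (a + i)) (sym (+-assoc m a i)))
    (trans (same r a (m + a) a∈ b∈) (cong (lt (a + j)) (+-assoc m a j)))

  pat-step : ∀ m n {ρ ρ′ s s′} → Pat (ap m (suc n)) (s * m + ρ) (s′ * m + ρ′) →
             ∀ k → k < n → step m ρ (k + s) ≡ step m ρ′ (k + s′)
  pat-step m n {ρ} {ρ′} {s} {s′} r k k<n = trans (cong (γ m) (lem k s m ρ))
    (trans (pat-γ r (k * m) m (∈-ap (m<n⇒m<1+n k<n)) (∈-ap {k = suc k} (s≤s k<n)))
           (cong (γ m) (sym (lem k s′ m ρ′))))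
    where
    lem : ∀ k s m ρ → (k + s) * m + ρ ≡ k * m + (s * m + ρ)
    lem = solve-∀

  lt-flip : ∀ {i j b} → i ≢ j → lt i j ≡ b → lt j i ≡ not b
  lt-flip i≢j q = trans (lt-total (i≢j ∘ sym)) (cong not q)

  lt-asym : ∀ {i j} → lt i j ≡ true → lt j i ≢ true
  lt-asym p q with trans (sym (lt-irrefl _)) (lt-trans p q)
  ... | ()

  m+i≢i : ∀ {m} i → 1 ≤ m → i ≢ m + i
  m+i≢i {suc m} i _ q = m≢1+n+m i q

  chain : ∀ b m i → (∀ k → γ m (k * m + i) ≡ b) → 1 ≤ m → ∀ c → 1 ≤ c → γ (c * m) i ≡ b
  chain b m i h 1≤m (suc zero) _ = trans (cong (λ x → γ x i) (+-identityʳ m)) (h 0)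
  chain b m i h 1≤m (suc (suc c)) _ = compose b (chain b m i h 1≤m (suc c) (s≤s z≤n)) (h (suc c))
    where
    x = suc c * m + i
    compose : ∀ b → lt i x ≡ b → lt x (m + x) ≡ b → γ (suc (suc c) * m) i ≡ b
    compose true p q = trans (cong (lt i) (+-assoc m (suc c * m) i)) (lt-trans p q)
    compose false p q = trans (cong (lt i) (+-assoc m (suc c * m) i))
      (lt-flip (λ e → m+i≢i i (≤-trans 1≤m (m≤m+n m _)) (trans (sym e) (sym (+-assoc m (suc c * m) i))))
        (lt-trans (lt-flip (m+i≢i x 1≤m) q) (lt-flip (m+i≢i i (≤-trans 1≤m (m≤m+n m _))) p)))

  bit-at : ∀ a b → a ≢ b → (∃[ m ] 1 ≤ m × (∀ i → lt (a + i) (b + i) ≡ γ m (a + i)))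
                         ⊎ (∃[ m ] 1 ≤ m × (∀ i → lt (a + i) (b + i) ≡ not (γ m (b + i))))
  bit-at a b a≢b with <-cmp a b
  ... | tri≈ _ a≡b _ = contradiction a≡b a≢b
  ... | tri< a<b _ _ with split-< a<b
  ... | l , refl = inj₁ (suc l , s≤s z≤n , λ i → cong (lt (a + i))
          (trans (cong (_+ i) (+-comm a (suc l))) (+-assoc (suc l) a i)))
  bit-at a b a≢b | tri> _ _ b<a with split-< b<a
  ... | l , refl = inj₂ (suc l , s≤s z≤n , λ i → trans
          (lt-total λ q → a≢b (+-cancelʳ-≡ i a b q))
          (cong (not ∘ lt (b + i)) (trans (cong (_+ i) (+-comm b (suc l))) (+-assoc (suc l) b i))))

  module _ (t N : ℕ) (1≤t : 1 ≤ t) (per : ∀ i → N ≤ i → ∀ m → 1 ≤ m → γ m i ≡ γ m (t + i)) where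

    pat-period : ∀ L i → N ≤ i → Pat L i (t + i)
    pat-period L i N≤i = pat λ a b _ _ → case a ≟ b of λ where
        (yes refl) → trans (lt-irrefl _) (sym (lt-irrefl _))
        (no a≢b)   → case bit-at a b a≢b of λ where
          (inj₁ (m , 1≤m , h)) → trans (h i) (trans (step-t a m 1≤m) (sym (h (t + i))))
          (inj₂ (m , 1≤m , h)) → trans (h i) (trans (cong not (step-t b m 1≤m)) (sym (h (t + i))))
      where
      step-t : ∀ a m → 1 ≤ m → γ m (a + i) ≡ γ m (a + (t + i))
      step-t a m 1≤m = trans (per (a + i) (≤-trans N≤i (m≤n+m i a)) m 1≤m)
                             (cong (γ m) (swap-+ t a i))

    pat-period-multiple : ∀ L c i → N ≤ i → Pat L i (c * t + i)
    pat-period-multiple L zero    i N≤i = P.refl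
    pat-period-multiple L (suc c) i N≤i = P.trans (pat-period-multiple L c i N≤i)
      (subst (Pat L _) (sym (+-assoc t (c * t) i))
        (pat-period L _ (≤-trans N≤i (m≤n+m i (c * t)))))

    -- The bound is independent of the window, so an ultimately periodic order has bounded
    -- complexity and cannot satisfy p*(n) = n for all n.
    periodic-bound : ∀ {L k} → AtLeast (Pat L) k → k ≤ N + t
    periodic-bound {L} = covering-≤ (pat-equiv L) toℕ cover
      where
      cover : ∀ i → ∃[ a ] Pat L (toℕ {N + t} a) i
      cover i with i <? N
      ... | yes i<N = fromℕ< i< , subst (λ x → Pat L x i) (sym (Fin.toℕ-fromℕ< i<)) P.refl
        where i< = ≤-trans i<N (m≤m+n N t)
      ... | no i≮N with split-≤ (≮⇒≥ i≮N)
      ... | l , refl with residue t l 1≤t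
      ... | s , r , r<t , refl = fromℕ< r< , subst₂ (Pat L) (sym (Fin.toℕ-fromℕ< r<))
              (lem s t r N) (pat-period-multiple L s (N + r) (m≤m+n N r))
        where
        r< = +-monoʳ-< N r<t
        lem : ∀ s t r N → s * t + (N + r) ≡ s * t + r + N
        lem = solve-∀

dual : Order → Order
dual O = record
  { lt        = λ i j → lt j i
  ; lt-irrefl = lt-irrefl
  ; lt-trans  = λ p q → lt-trans q p
  ; lt-total  = λ i≢j → lt-total (i≢j ∘ sym)
  }
  where open Order O

module PatternsClassical (em : ExcludedMiddle 0ℓ) (O : Order) where
  open Classical em
  open WordsClassical em
  open Patterns O

  -- `γ m` interleaves the words `step m ρ` with `ρ < m`; their common period `P` becomes `P * m`.
  step-UP⇒γ-UP : ∀ m → 1 ≤ m → (∀ ρ → UP (step m ρ)) → UP (γ m)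
  step-UP⇒γ-UP m 1≤m h with up-common (step m) m (λ ρ _ → h ρ)
  ... | P , N , 1≤P , per = P * m , N * m + m , 1≤* 1≤P 1≤m , λ i le → from i le (residue m i 1≤m)
    where
    lem : ∀ P s m r → (P + s) * m + r ≡ P * m + (s * m + r)
    lem = solve-∀
    from : ∀ i → N * m + m ≤ i → (∃₂ λ s r → r < m × i ≡ s * m + r) → γ m i ≡ γ m (P * m + i)
    from i le (s , r , r<m , refl) = trans (per r r<m s N≤s) (cong (γ m) (lem P s m r))
      where
      N≤s : N ≤ s
      N≤s = ≮⇒≥ λ s<N → <⇒≱ (≤-trans (+-mono-≤-< (*-monoˡ-≤ m (<⇒≤ s<N)) r<m) le) ≤-refl

  pat-UP : (∀ m → 1 ≤ m → UP (γ m)) → ∀ L → ∃₂ λ P N → 1 ≤ P × (∀ i → N ≤ i → Pat L i (P + i))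
  pat-UP up L = let P , N , 1≤P , h = all in P , N , 1≤P , λ i N≤i → pat λ a b a∈ b∈ →
      trans (h a (bound a∈) b (bound b∈) i N≤i)
        (cong₂ lt (swap-+ P a i) (swap-+ P b i))
    where
    K = suc (sum L)
    bound : ∀ {a} → a ∈ L → a < K
    bound a∈ = s≤s (∈⇒≤sum a∈)
    Good : ℕ → ℕ → ℕ → ℕ → Set
    Good a b P N = ∀ i → N ≤ i → lt (a + i) (b + i) ≡ lt (P + (a + i)) (P + (b + i))
    single : ∀ a b → ∃₂ λ P N → 1 ≤ P × Good a b P N
    single a b with a ≟ b
    ... | yes refl = 1 , 0 , ≤-refl , λ i _ → trans (lt-irrefl _) (sym (lt-irrefl _))
    ... | no a≢b with bit-at a b a≢b
    ... | inj₁ (m , 1≤m , h) = let P , N , 1≤P , per = up m 1≤m in P , N , 1≤P , λ i N≤i →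
          trans (h i) (trans (per _ (≤-trans N≤i (m≤n+m i a))) (sym (trans
            (cong₂ lt (swap-+ P a i) (swap-+ P b i)) (trans (h (P + i)) (cong (γ m) (swap-+ a P i))))))
    ... | inj₂ (m , 1≤m , h) = let P , N , 1≤P , per = up m 1≤m in P , N , 1≤P , λ i N≤i →
          trans (h i) (trans (cong not (per _ (≤-trans N≤i (m≤n+m i b)))) (sym (trans
            (cong₂ lt (swap-+ P a i) (swap-+ P b i)) (trans (h (P + i))
              (cong (not ∘ γ m) (swap-+ b P i))))))
    mult : ∀ a b P N c → 1 ≤ c → Good a b P N → Good a b (c * P) N
    mult a b P N c _ g i N≤i = trans (up-multiple (λ i → lt (a + i) (b + i)) P N
        (λ i N≤i → trans (g i N≤i) (cong₂ lt (swap-+ P a i) (swap-+ P b i))) c i N≤i)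
      (cong₂ lt (swap-+ a (c * P) i) (swap-+ b (c * P) i))
    mono : ∀ a b P {N N′} → N ≤ N′ → Good a b P N → Good a b P N′
    mono a b P N≤N′ g i N′≤i = g i (≤-trans N≤N′ N′≤i)
    all : ∃₂ λ P N → 1 ≤ P × (∀ a → a < K → ∀ b → b < K → Good a b P N)
    all = combine (λ a P N → ∀ b → b < K → Good a b P N)
      (λ a P N c 1≤c g b b<K → mult a b P N c 1≤c (g b b<K))
      (λ a P le g b b<K → mono a b P le (g b b<K)) K
      λ a _ → combine (Good a) (mult a) (mono a) K λ b _ → single a b

  -- If some progression has an aperiodic word of steps, Morse-Hedlund supplies enough patterns in
  -- an arithmetic window. Otherwise the patterns of any fixed window are eventually periodic, and a
  -- window that no further element refines passes its period on to all `γ m` at once.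
  many-patterns : ¬ UPₒ → ∀ n → ∃[ L ] length L ≡ n × AtLeast (Pat (0 ∷ L)) (suc n)
  many-patterns ¬up with em {∃₂ λ m ρ → 1 ≤ m × ¬ UP (step m ρ)}
  ... | yes (m , ρ , 1≤m , ¬upv) = λ n → ap′ n , length-ap′ n ,
        (let e , inj = morse-hedlund (step m ρ) ¬upv n in
         (λ a → e a * m + ρ) , λ a b r → inj a b (Word.blk (pat-step m n (pat-⊆ (ap⊆ n) _ _ r))))
    where
    ap′ : ℕ → List ℕ
    ap′ zero    = []
    ap′ (suc n) = suc n * m ∷ ap′ n
    length-ap′ : ∀ n → length (ap′ n) ≡ n
    length-ap′ zero    = refl
    length-ap′ (suc n) = cong suc (length-ap′ n)
    ap⊆ : ∀ n {a} → a ∈ ap m (suc n) → a ∈ 0 ∷ ap′ n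
    ap⊆ zero    (here refl) = here refl
    ap⊆ (suc n) (here refl) = there (here refl)
    ap⊆ (suc n) (there a∈)  = case ap⊆ n a∈ of λ where
      (here q)   → here q
      (there a∈) → there (there a∈)
  ... | no none = grow
    where
    γ-UP : ∀ m → 1 ≤ m → UP (γ m)
    γ-UP m 1≤m = step-UP⇒γ-UP m 1≤m λ ρ → dne λ ¬upv → none (m , ρ , 1≤m , ¬upv)
    grow : ∀ n → ∃[ L ] length L ≡ n × AtLeast (Pat (0 ∷ L)) (suc n)
    grow zero = [] , refl , (λ _ → 0) , λ { zero zero _ → refl }
    grow (suc n) with grow n
    ... | L , len , al with em {∃[ i ] ∃[ j ] ∃[ m ] 1 ≤ m × Pat (0 ∷ L) i j × γ m i ≢ γ m j}
    ... | yes (i , j , m , _ , r , ≢) = m ∷ L , cong suc len ,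
          split (pat-equiv (0 ∷ L)) (pat-equiv (0 ∷ m ∷ L))
            (pat-⊆ λ { (here q) → here q ; (there a∈) → there (there a∈) }) i j r
            (λ r′ → ≢ (same r′ 0 m (here refl) (there (here refl)))) al
    ... | no stuck = contradiction (P , N , 1≤P , λ i N≤i m 1≤m →
            dne λ ≢ → stuck (i , P + i , m , 1≤m , per i N≤i , ≢)) ¬up
      where
      period = pat-UP γ-UP (0 ∷ L)
      P = proj₁ period
      N = proj₁ (proj₂ period)
      1≤P = proj₁ (proj₂ (proj₂ period))
      per = proj₂ (proj₂ (proj₂ period))

-- Orders in which all progressions with some difference are eventually monotone

-- Stated for arbitrary nonempty lists, unsorted and possibly with repetitions, so that windows can
-- be written down as they arise; `toWindow` leads back to proper windows.
FewPatterns : Order → Set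
FewPatterns O = ∀ x L → ¬ AtLeast (Patterns.Pat O (x ∷ L)) (2 + length L)

few-dual : ∀ O → FewPatterns O → FewPatterns (dual O)
few-dual O few x L al = few x L (atLeast-antitone
  {R = Dual.Pat (x ∷ L)} {R′ = P.Pat (x ∷ L)} (λ i j r → Dual.pat λ a b a∈ b∈ → P.same r b a b∈ a∈) al)
  where
  module P = Patterns O
  module Dual = Patterns (dual O)

strictly-increasing : ∀ (O : Order) (A : ℕ → ℕ) → (∀ s → Order.lt O (A s) (A (suc s)) ≡ true) →
                      ∀ s l → Order.lt O (A s) (A (suc l + s)) ≡ true
strictly-increasing O A h s zero    = h s
strictly-increasing O A h s (suc l) = Order.lt-trans O (strictly-increasing O A h s l) (h (suc l + s))

module TwoProgressions (em : ExcludedMiddle 0ℓ) (O : Order) (few : FewPatterns O)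
                       (M δ r : ℕ) where
  open Classical em
  open Patterns O

  A E : ℕ → ℕ
  A s = s * M + r
  E s = δ + (s * M + r)

  h u : ℕ → ℕ → Bool
  h s d = lt (A s) (E (d + s))
  u s d = lt (A (suc s)) (E (d + s))

  -- Only large `s` and large delays `d` are asked for: bounded delays amount to finitely many
  -- distances, which have periods of their own.
  Stable : Set
  Stable = ∃[ J ] (∀ s d → J ≤ s → J ≤ d → h s d ≡ h (suc s) d)

  true≢false : ∀ {b} → b ≡ true → b ≢ false
  true≢false refl ()

  module _ (incA : ∀ s → lt (A s) (A (suc s)) ≡ true) where

    upA : ∀ s l → lt (A s) (A (suc l + s)) ≡ true
    upA = strictly-increasing O A incA

    A≤ : ∀ {x} s l → lt (A (l + s)) x ≡ true → lt (A s) x ≡ true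
    A≤ s zero    q = q
    A≤ s (suc l) q = lt-trans (upA s l) q

    opposite : (∀ s → lt (E (suc s)) (E s) ≡ true) → Stable
    opposite decE with em {∃₂ λ s d → h s d ≡ false}
    ... | no none = 0 , λ s d _ _ → trans (yes! s d) (sym (yes! (suc s) d))
      where
      yes! : ∀ s d → h s d ≡ true
      yes! s d = Bool.¬-not λ q → none (s , d , q)
    ... | yes (s , d , q) = d + s , λ s′ d′ le _ →
            trans (no! s′ d′ le) (sym (no! (suc s′) d′ (m≤n⇒m≤1+n le)))
      where
      E≥ : ∀ {x} s l → lt x (E (l + s)) ≡ true → lt x (E s) ≡ true
      E≥ s zero    q = q
      E≥ s (suc l) q = lt-trans q (strictly-increasing (dual O) E decE s l)
      no! : ∀ s′ d′ → d + s ≤ s′ → h s′ d′ ≡ false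
      no! s′ d′ le with split-≤ le
      ... | l , refl = Bool.¬-not λ q′ → true≢false
            (E≥ (d + s) (d′ + l) (A≤ s (l + d) (subst₂ (λ x y → lt (A x) (E y) ≡ true)
              (sym (+-assoc l d s)) (sym (+-assoc d′ l (d + s))) q′))) q

    module _ (incE : ∀ s → lt (E s) (E (suc s)) ≡ true) where

      E≤ : ∀ {x} s l → lt x (E s) ≡ true → lt x (E (l + s)) ≡ true
      E≤ s zero    q = q
      E≤ s (suc l) q = lt-trans q (strictly-increasing O E incE s l)

      u⇒h : ∀ s d → u s d ≡ true → h s d ≡ true
      u⇒h s d q = lt-trans (incA s) q

      module Five (d₁ d₂ p₀ p₁ p₂ p₃ p₄ : ℕ)
        (u₁p₀ : u p₀ d₁ ≡ true) (u₂p₀ : u p₀ d₂ ≡ true)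
        (h₁p₁ : h p₁ d₁ ≡ true) (u₁p₁ : u p₁ d₁ ≡ false) (u₂p₁ : u p₁ d₂ ≡ true)
        (h₁p₂ : h p₂ d₁ ≡ false) (u₂p₂ : u p₂ d₂ ≡ true)
        (h₂p₃ : h p₃ d₂ ≡ true) (u₂p₃ : u p₃ d₂ ≡ false)
        (h₂p₄ : h p₄ d₂ ≡ false) where

        -- Numbers the stages in which the pair `A s`, `A (suc s)` overtakes the two delayed
        -- elements of `E`. The delay `d₂` takes priority: the comparisons for `d₁` are read only
        -- while the whole pair is below `E (d₂ + s)`.
        code : Bool → Bool → Bool → Bool → ℕ
        code h₁ u₁ false u₂    = 4
        code h₁ u₁ true  false = 3
        code false u₁ true true = 2
        code true false true true = 1
        code true true true true = 0

        code-at : ℕ → ℕ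
        code-at s = code (h s d₁) (u s d₁) (h s d₂) (u s d₂)

        e : Fin 5 → ℕ
        e zero                         = p₀
        e (suc zero)                   = p₁
        e (suc (suc zero))             = p₂
        e (suc (suc (suc zero)))       = p₃
        e (suc (suc (suc (suc zero)))) = p₄

        bits : ∀ {a b c d a′ b′ c′ d′} → a ≡ a′ → b ≡ b′ → c ≡ c′ → d ≡ d′ →
               code a b c d ≡ code a′ b′ c′ d′
        bits refl refl refl refl = refl

        code-e : ∀ a → code-at (e a) ≡ toℕ a
        code-e zero = bits (u⇒h p₀ d₁ u₁p₀) u₁p₀ (u⇒h p₀ d₂ u₂p₀) u₂p₀
        code-e (suc zero) = bits h₁p₁ u₁p₁ (u⇒h p₁ d₂ u₂p₁) u₂p₁
        code-e (suc (suc zero)) = bits {b = u p₂ d₁} h₁p₂ refl (u⇒h p₂ d₂ u₂p₂) u₂p₂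
        code-e (suc (suc (suc zero))) = bits {a = h p₃ d₁} {b = u p₃ d₁} refl refl h₂p₃ u₂p₃
        code-e (suc (suc (suc (suc zero)))) =
          bits {a = h p₄ d₁} {b = u p₄ d₁} {d = u p₄ d₂} refl refl h₂p₄ refl

        window : List ℕ
        window = M ∷ (δ + d₁ * M) ∷ (δ + d₂ * M) ∷ []

        E-at : ∀ d s → (δ + d * M) + A s ≡ E (d + s)
        E-at d s = lem δ d M s r
          where
          lem : ∀ δ d M s r → (δ + d * M) + (s * M + r) ≡ δ + ((d + s) * M + r)
          lem = solve-∀

        code-pat : ∀ {s s′} → Pat (0 ∷ window) (A s) (A s′) → code-at s ≡ code-at s′
        code-pat {s} {s′} p = bits (h-bit d₁ (there (there (here refl)))) (u-bit d₁ (there (there (here refl))))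
            (h-bit d₂ (there (there (there (here refl))))) (u-bit d₂ (there (there (there (here refl)))))
          where
          h-bit : ∀ d → δ + d * M ∈ 0 ∷ window → h s d ≡ h s′ d
          h-bit d d∈ = subst₂ (λ x y → lt (A s) x ≡ lt (A s′) y) (E-at d s) (E-at d s′)
            (same p 0 (δ + d * M) (here refl) d∈)
          u-bit : ∀ d → δ + d * M ∈ 0 ∷ window → u s d ≡ u s′ d
          u-bit d d∈ = subst₂ _≡_ (cong₂ lt (sym (+-assoc M (s * M) r)) (E-at d s))
            (cong₂ lt (sym (+-assoc M (s′ * M) r)) (E-at d s′))
            (same p M (δ + d * M) (there (here refl)) d∈)

        absurd : ⊥
        absurd = few 0 window (A ∘ e , λ a b p → Fin.toℕ-injective
          (trans (sym (code-e a)) (trans (code-pat {e a} {e b} p) (code-e b))))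

      -- When `u` turns false at `suc k`, `A (suc k)` is below `E (d + k)` and hence below the next
      -- element of `E`, while `A (2 + k)` is not.
      middle : ∀ d s₁ → u 0 d ≡ true → h s₁ d ≡ false →
               ∃[ k ] suc k ≤ s₁ × h (suc k) d ≡ true × u (suc k) d ≡ false
      middle d s₁ u0 hs with first-change (λ s → u s d) true s₁ u0
                               (Bool.¬-not λ q → true≢false (u⇒h s₁ d q) hs)
      ... | k , k<s₁ , uk , uk′ = k , k<s₁ ,
            lt-trans uk (subst (λ x → lt (E (d + k)) (E x) ≡ true) (sym (+-suc d k)) (incE (d + k))) , uk′

      -- With two delays d₁ and d₂ that are far apart, the window formed by A s, A (s + 1), E (s + d₁)
      -- and E (s + d₂) has five patterns.
      unbounded-absurd : (∀ s → ∃[ d ] h s d ≡ true) → (∀ d → ∃[ s ] h s d ≡ false) → ⊥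
      unbounded-absurd reach far with reach 1
      ... | d , hd with far (suc d)
      ... | s₁ , h₁ with reach (suc s₁)
      ... | d′ , hd′ = go (far (suc d + (d′ + suc s₁)))
        where
        d₁ = suc d
        -- So large that `A (suc s)` is below `E (d₂ + s)` for all `s ≤ s₁`: the stages of `d₂`
        -- begin only after those of `d₁`.
        d₂ = d₁ + (d′ + suc s₁)
        u₁ : u 0 d₁ ≡ true
        u₁ = subst (λ x → lt (A 1) (E x) ≡ true) (trans (+-comm d 1) (sym (+-identityʳ d₁))) hd
        u₂ : ∀ l s → l + s ≡ s₁ → u s d₂ ≡ true
        u₂ l s q = A≤ (suc s) l (subst₂ (λ x y → lt (A x) (E y) ≡ true)
            (sym (trans (+-suc l s) (cong suc q))) (lem d₁ d′ s₁ s)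
            (E≤ (d′ + suc s₁) (d₁ + s) hd′))
          where
          lem : ∀ a b c s → a + s + (b + suc c) ≡ a + (b + suc c) + s
          lem = solve-∀
        go : ∃[ s₂ ] h s₂ d₂ ≡ false → ⊥
        go (s₂ , h₂) with middle d₁ s₁ u₁ h₁ | middle d₂ s₂ (u₂ s₁ 0 (+-identityʳ s₁)) h₂
        ... | k , k< , hk , uk | k′ , _ , hk′ , uk′ =
          Five.absurd d₁ d₂ 0 (suc k) s₁ (suc k′) s₂ u₁ (u₂ s₁ 0 (+-identityʳ s₁))
            hk uk (let l , q = split-≤ k< in u₂ l (suc k) q) h₁ (u₂ 0 s₁ refl) hk′ uk′ h₂

      -- Either some `A s` is below no later element of `E`, or one delay puts `E` above `A` for
      -- every `s`, or the necessary delay grows without bound. Only the last case needs the bound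
      -- on patterns.
      parallel : Stable
      parallel with em {∃[ s ] (∀ d → h s d ≡ false)}
      ... | yes (s₁ , never) = s₁ , λ s d le _ → trans (no! s d le) (sym (no! (suc s) d (m≤n⇒m≤1+n le)))
        where
        no! : ∀ s d → s₁ ≤ s → h s d ≡ false
        no! s d le with split-≤ le
        ... | l , refl = Bool.¬-not λ q → true≢false (A≤ s₁ l (subst (λ x → lt (A (l + s₁)) (E x) ≡ true)
              (sym (+-assoc d l s₁)) q)) (never (d + l))
      ... | no some with em {∃[ D ] (∀ s → h s D ≡ true)}
      ... | yes (D , always) = D , λ s d _ le → trans (yes! s d le) (sym (yes! (suc s) d le))
        where
        yes! : ∀ s d → D ≤ d → h s d ≡ true
        yes! s d le with split-≤ le
        ... | l , refl = subst (λ x → lt (A s) (E x) ≡ true) (sym (+-assoc l D s)) (E≤ (D + s) l (always s))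
      ... | no unbounded = ⊥-elim (unbounded-absurd
              (λ s → dne λ ¬ex → some (s , λ d → Bool.¬-not λ q → ¬ex (d , q)))
              (λ d → dne λ ¬ex → unbounded (d , λ s → Bool.¬-not λ q → ¬ex (s , q))))

module Monotonicity (em : ExcludedMiddle 0ℓ) (O : Order) (few : FewPatterns O) where
  open Classical em
  open Patterns O
  open PatternsClassical em O

  module _ (M N : ℕ) (1≤M : 1 ≤ M) (mono : ∀ i → N ≤ i → γ M i ≡ γ M (M + i)) where

    private
      module T  δ r = TwoProgressions em O few M (suc δ) r
      module T′ δ r = TwoProgressions em (dual O) (few-dual O few) M (suc δ) r

    constant-step : ∀ i → N ≤ i → ∀ s → γ M (s * M + i) ≡ γ M i
    constant-step i N≤i s = sym (up-multiple (γ M) M N mono s i N≤i)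

    stable : ∀ δ r → N ≤ r → T.Stable δ r
    stable δ r N≤r = cases (γ M r) (γ M (suc δ + r)) refl refl
      where
      stepA : ∀ s → lt (T.A δ r s) (T.A δ r (suc s)) ≡ γ M r
      stepA s = trans (cong (lt (s * M + r)) (+-assoc M (s * M) r)) (constant-step r N≤r s)
      stepE : ∀ s → lt (T.E δ r s) (T.E δ r (suc s)) ≡ γ M (suc δ + r)
      stepE s = trans (cong₂ lt (swap-+ (suc δ) (s * M) r) (lem δ M s r))
        (constant-step (suc δ + r) (m≤n⇒m≤o+n (suc δ) N≤r) s)
        where
        lem : ∀ δ M s r → suc δ + (M + s * M + r) ≡ M + (s * M + (suc δ + r))
        lem = solve-∀
      A≢E : ∀ s d → T.A δ r s ≢ T.E δ r (d + s)
      A≢E s d q = m≢1+n+m (s * M + r) {δ + d * M} (trans q (lem δ d s M r))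
        where
        lem : ∀ δ d s M r → suc δ + ((d + s) * M + r) ≡ suc ((δ + d * M) + (s * M + r))
        lem = solve-∀
      A≢ : ∀ s → T.A δ r s ≢ T.A δ r (suc s)
      A≢ s q = m+i≢i (s * M + r) 1≤M (trans q (+-assoc M (s * M) r))
      E≢ : ∀ s → T.E δ r s ≢ T.E δ r (suc s)
      E≢ s q = A≢ s (+-cancelˡ-≡ (suc δ) _ _ q)
      undual : T′.Stable δ r → T.Stable δ r
      undual (J , st) = J , λ s d J≤s J≤d → trans (lt-total (A≢E s d))
        (trans (cong not (st s d J≤s J≤d)) (sym (lt-total (A≢E (suc s) d))))
      cases : ∀ σ τ → γ M r ≡ σ → γ M (suc δ + r) ≡ τ → T.Stable δ r
      cases true true p q = T.parallel δ r (λ s → trans (stepA s) p) (λ s → trans (stepE s) q)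
      cases true false p q = T.opposite δ r (λ s → trans (stepA s) p)
        (λ s → lt-flip (E≢ s) (trans (stepE s) q))
      cases false false p q = undual (T′.parallel δ r
        (λ s → lt-flip (A≢ s) (trans (stepA s) p)) (λ s → lt-flip (E≢ s) (trans (stepE s) q)))
      cases false true p q = undual (T′.opposite δ r
        (λ s → lt-flip (A≢ s) (trans (stepA s) p)) (λ s → trans (stepE s) q))

    -- A distance has the form `suc (d * M + δ)` with `δ < M`. For large `d` stability gives the
    -- period `M`; the finitely many smaller distances have a common period `P`.
    eventually-monotone⇒UPₒ : (∀ m → 1 ≤ m → UP (γ m)) → UPₒ
    eventually-monotone⇒UPₒ γ-UP = P * M , N′ , 1≤* 1≤P 1≤M , per
      where
      Good : ℕ → ℕ → ℕ → Set
      Good ρ δ J = ∀ s d → J ≤ s → J ≤ d → T.h δ (N + ρ) s d ≡ T.h δ (N + ρ) (suc s) d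
      Good-mono : ∀ ρ δ {J J′} → J ≤ J′ → Good ρ δ J → Good ρ δ J′
      Good-mono ρ δ le g s d a b = g s d (≤-trans le a) (≤-trans le b)
      common = monotone-bound (λ ρ J → ∀ δ → δ < M → Good ρ δ J)
        (λ ρ le g δ δ< → Good-mono ρ δ le (g δ δ<)) M λ ρ _ →
          monotone-bound (Good ρ) (Good-mono ρ) M λ δ _ → stable δ (N + ρ) (m≤m+n N ρ)
      J = proj₁ common
      short = up-common (λ k → γ (suc k)) (J * M) λ k _ → γ-UP (suc k) (s≤s z≤n)
      P = proj₁ short
      N₂ = proj₁ (proj₂ short)
      1≤P = proj₁ (proj₂ (proj₂ short))
      N′ = N₂ + (N + J * M)
      long : ∀ k → J * M ≤ k → ∀ i → N + J * M ≤ i → γ (suc k) i ≡ γ (suc k) (M + i)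
      long k J*M≤k i le with split-≤ (≤-trans (m≤m+n N (J * M)) le)
      ... | l , refl with residue M k 1≤M | residue M l 1≤M
      ... | d , δ , δ<M , refl | s , ρ , ρ<M , refl =
            subst₂ _≡_ (cong₂ lt (lem₁ s M ρ N) (lem₂ s M ρ N δ d))
              (cong₂ lt (lem₃ s M ρ N) (lem₄ s M ρ N δ d))
              (proj₂ common ρ ρ<M δ δ<M s d (large s ρ ρ<M (+-cancelʳ-≤ N _ _ (≤-trans (≤-reflexive (+-comm (J * M) N)) le)))
                (large d δ δ<M J*M≤k))
        where
        large : ∀ s ρ → ρ < M → J * M ≤ s * M + ρ → J ≤ s
        large s ρ ρ<M le = ≮⇒≥ λ s<J → <⇒≱ (<-≤-trans (+-monoʳ-< (s * M) ρ<M)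
          (≤-trans (≤-reflexive (+-comm (s * M) M)) (*-monoˡ-≤ M s<J))) le
        lem₁ : ∀ s M ρ N → s * M + (N + ρ) ≡ s * M + ρ + N
        lem₁ = solve-∀
        lem₂ : ∀ s M ρ N δ d → suc δ + ((d + s) * M + (N + ρ)) ≡ suc (d * M + δ) + (s * M + ρ + N)
        lem₂ = solve-∀
        lem₃ : ∀ s M ρ N → M + s * M + (N + ρ) ≡ M + (s * M + ρ + N)
        lem₃ = solve-∀
        lem₄ : ∀ s M ρ N δ d → suc δ + ((d + suc s) * M + (N + ρ)) ≡ suc (d * M + δ) + (M + (s * M + ρ + N))
        lem₄ = solve-∀
      per : ∀ i → N′ ≤ i → ∀ m → 1 ≤ m → γ m i ≡ γ m (P * M + i)
      per i le (suc k) _ with k <? J * M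
      ... | yes k< = trans (up-multiple (γ (suc k)) P N₂ (proj₂ (proj₂ (proj₂ short)) k k<) M i
              (≤-trans (m≤m+n N₂ _) le)) (cong (λ x → γ (suc k) (x + i)) (*-comm M P))
      ... | no k≮ = up-multiple (γ (suc k)) M (N + J * M) (long k (≮⇒≥ k≮)) P i
              (≤-trans (m≤n+m _ N₂) le)

-- The word of ascents and descents is aperiodic

module Aperiodic (em : ExcludedMiddle 0ℓ) (O : Order) (few : FewPatterns O) where
  open Classical em
  open WordsClassical em
  open Balance em
  open Patterns O
  open PatternsClassical em O

  few-step : ∀ m ρ n → ¬ AtLeast (Word.Blk (step m ρ) n) (2 + n)
  few-step m ρ n (e , inj) = few (n * m) (ap m n) (subst (λ k → AtLeast (Pat (ap m (suc n))) (2 + k))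
    (sym (length-ap m n)) ((λ a → e a * m + ρ) , λ a b r → inj a b (Word.blk (pat-step m n {ρ} {ρ} {e a} {e b} r))))

  module _ (¬up : ¬ UPₒ) where

    balanced-step : ∀ m ρ → ¬ UP (step m ρ) → Word.Balanced (step m ρ)
    balanced-step m ρ ¬upv = Complexity.balanced (step m ρ) ¬upv (few-step m ρ)

    w : ℕ → Bool
    w = γ 1

    both-letters : ∀ b N → ∃[ i ] N ≤ i × w i ≡ b
    both-letters b N = dne λ none → ¬up (1 , N , ≤-refl , λ i N≤i m 1≤m →
      let const : ∀ i → N ≤ i → γ m i ≡ not b
          const i N≤i = trans (cong (λ x → γ x i) (sym (*-identityʳ m)))
            (chain (not b) 1 i (λ k → Bool.¬-not λ q → none (_ , ≤-trans N≤i (m≤n+m i (k * 1)) , q))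
              ≤-refl m 1≤m)
      in trans (const i N≤i) (sym (const (suc i) (m≤n⇒m≤1+n N≤i))))

    -- The window {0, 1, m} has at most three patterns, so one of the two letters determines γ m.
    one-letter-determines : ∀ m → ∃[ b ] (∀ i j → w i ≡ b → w j ≡ b → γ m i ≡ γ m j)
    one-letter-determines m = dne λ none →
      case (splits none true , splits none false) of λ where
        ((p , q , wp , wq , ≢) , (p′ , q′ , wp′ , wq′ , ≢′)) →
          few 0 (1 ∷ m ∷ []) (split₂ sameLetter (pat-equiv _)
            (λ i j r → same r 0 1 (here refl) (there (here refl))) p q p′ q′
            (trans wp (sym wq)) (λ r → ≢ (same r 0 m (here refl) (there (there (here refl)))))
            (trans wp′ (sym wq′)) (λ r → ≢′ (same r 0 m (here refl) (there (there (here refl)))))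
            (λ r → case trans (sym wp′) (trans r wp) of λ ())
            two)
      where
      Same : Rel₀
      Same i j = w i ≡ w j
      sameLetter : IsEquivalence Same
      sameLetter = record { refl = refl ; sym = sym ; trans = trans }
      two : AtLeast Same 2
      two = e , inj
        where
        e : Fin 2 → ℕ
        e zero    = proj₁ (both-letters true 0)
        e (suc _) = proj₁ (both-letters false 0)
        w-e : ∀ a → w (e a) ≡ (case a of λ { zero → true ; (suc _) → false })
        w-e zero    = proj₂ (proj₂ (both-letters true 0))
        w-e (suc _) = proj₂ (proj₂ (both-letters false 0))
        inj : ∀ a b → Same (e a) (e b) → a ≡ b
        inj zero zero r = refl
        inj zero (suc zero) r = case trans (sym (w-e zero)) (trans r (w-e (suc zero))) of λ ()
        inj (suc zero) zero r = case trans (sym (w-e (suc zero))) (trans r (w-e zero)) of λ ()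
        inj (suc zero) (suc zero) r = refl
      splits : ¬ (∃[ b ] (∀ i j → w i ≡ b → w j ≡ b → γ m i ≡ γ m j)) → ∀ b →
               ∃₂ λ i j → w i ≡ b × w j ≡ b × γ m i ≢ γ m j
      splits none b = dne λ ¬ex → none (b , λ i j wi wj → dne λ ≢ → ¬ex (i , j , wi , wj , ≢))

    module PeriodicSteps (P N₀ : ℕ) (1≤P : 1 ≤ P) (per : ∀ i → N₀ ≤ i → w i ≡ w (P + i)) where

      -- Of the two letters, the one that determines `γ m` is repeated with difference `P` by the
      -- periodicity of `w`.
      constant-progression : ∀ m → ∃₂ λ c g → ∀ s → γ m (s * P + c) ≡ g
      constant-progression m with one-letter-determines m
      ... | b , det with both-letters b N₀
      ... | c , N₀≤c , wc = c , γ m c , λ s →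
            det _ _ (trans (sym (up-multiple w P N₀ per s c N₀≤c)) wc) wc

      -- If `step m ρ` were aperiodic, its factors would exhaust the patterns of the arithmetic
      -- window, so `step m c` would have no others. This is impossible for a periodic `step m c`,
      -- while an aperiodic one is balanced but constant along a progression.
      step-UP : ∀ m → 1 ≤ m → ∀ ρ → UP (step m ρ)
      step-UP m 1≤m ρ = case constant-progression m of λ where
          (c , g , const) → dne λ ¬upv → from c g const ¬upv
        where
        lem : ∀ s P m c → (s * P + 0) * m + c ≡ s * m * P + c
        lem = solve-∀
        factors : ∀ c → ¬ UP (step m ρ) → ∀ n i →
                  ∃[ j ] (∀ k → k < n → step m c (k + i) ≡ step m ρ (k + j))
        factors c ¬upv n i = case morse-hedlund (step m ρ) ¬upv n of λ where
          (e , inj) → case atLeast-or-class (pat-equiv (ap m (suc n)))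
                             ((λ a → e a * m + ρ) , λ a b r → inj a b (Word.blk (pat-step m n {ρ} {ρ} {e a} {e b} r)))
                             (subst (λ k → ¬ AtLeast (Pat (ap m (suc n))) (2 + k)) (length-ap m n)
                               (few (n * m) (ap m n))) (i * m + c) of λ where
            (a , r) → e a , λ k k<n → sym (pat-step m n {ρ} {c} {e a} {i} r k k<n)
        from : ∀ c g → (∀ s → γ m (s * P + c) ≡ g) → ¬ ¬ UP (step m ρ)
        from c g const ¬upv = case em {UP (step m c)} of λ where
          (yes upz) → Balanced.not-periodic-factors (step m ρ) ¬upv (balanced-step m ρ ¬upv)
                        (step m c) upz (factors c ¬upv)
          (no ¬upz) → no-constant-progression (step m c) ¬upz (balanced-step m c ¬upz) g P 0 1≤P
                        λ s → trans (cong (γ m) (lem s P m c)) (const (s * m))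

      γ-UP : ∀ m → 1 ≤ m → UP (γ m)
      γ-UP m 1≤m = step-UP⇒γ-UP m 1≤m (step-UP m 1≤m)

      Good : ℕ → ℕ → ℕ → Set
      Good ρ q N = 1 ≤ q × ∀ s → N ≤ s → ∀ k → γ (q * P) (k * (q * P) + (s * P + ρ)) ≡ γ (q * P) (s * P + ρ)

      -- With q the least period of z, the window {0, P, ..., qP} has the q phases of z and one
      -- monotone pattern, so the q-fold step cannot split any of them.
      module Phases (c : ℕ) (g : Bool) (const : ∀ s → γ P (s * P + c) ≡ g) (ρ s₀ : ℕ) where
        z : ℕ → Bool
        z = step P ρ
        Per : ℕ → Set
        Per q = 1 ≤ q × (∀ s → s₀ ≤ s → z s ≡ z (q + s))

        module _ (q : ℕ) (1≤q : 1 ≤ q) (zq : ∀ s → s₀ ≤ s → z s ≡ z (q + s))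
                 (min : ∀ k → k < q → ¬ Per k) where

          -- Since `z` has period `q`, agreement with a shift over `q` consecutive letters extends
          -- to all later ones.
          blocks⇒Per : ∀ a p → 1 ≤ p → (∀ k → k < q → z (k + (a + s₀)) ≡ z (k + (p + (a + s₀)))) → Per p
          blocks⇒Per a p 1≤p h = 1≤p , λ s s₀≤s → begin
            z s                ≡⟨ up-multiple z q s₀ zq a s s₀≤s ⟩
            z (a * q + s)      ≡⟨ beyond (a * q + s) (+-mono-≤ (m≤m*n′ a) s₀≤s) ⟩
            z (p + (a * q + s)) ≡⟨ cong z (swap-+ p (a * q) s) ⟩
            z (a * q + (p + s)) ≡⟨ up-multiple z q s₀ zq a (p + s) (≤-trans s₀≤s (m≤n+m s p)) ⟨
            z (p + s)          ∎
            where
            open ≡-Reasoning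
            m≤m*n′ : ∀ a → a ≤ a * q
            m≤m*n′ a = subst (_≤ a * q) (*-identityʳ a) (*-monoʳ-≤ a 1≤q)
            x₀ = a + s₀
            lem : ∀ p c r x → p + (c + r + x) ≡ c + (r + (p + x))
            lem = solve-∀
            beyond : ∀ x → x₀ ≤ x → z x ≡ z (p + x)
            beyond x le with split-≤ le
            ... | l , refl with residue q l 1≤q
            ... | c , r , r<q , refl = begin
              z (c * q + r + x₀)       ≡⟨ cong z (+-assoc (c * q) r x₀) ⟩
              z (c * q + (r + x₀))     ≡⟨ up-multiple z q s₀ zq c _ (≤-trans (m≤n+m s₀ a) (m≤n+m x₀ r)) ⟨
              z (r + x₀)               ≡⟨ h r r<q ⟩
              z (r + (p + x₀))         ≡⟨ up-multiple z q s₀ zq c _ (≤-trans (m≤n+m s₀ a)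
                                            (≤-trans (m≤n+m x₀ p) (m≤n+m _ r))) ⟩
              z (c * q + (r + (p + x₀))) ≡⟨ cong z (lem p (c * q) r x₀) ⟨
              z (p + (c * q + r + x₀)) ∎

          Row : Rel₀
          Row i j = ∀ k → k < q → γ P (k * P + i) ≡ γ P (k * P + j)
          row-equiv : IsEquivalence Row
          row-equiv = record
            { refl  = λ _ _ → refl
            ; sym   = λ r k k<q → sym (r k k<q)
            ; trans = λ r s k k<q → trans (r k k<q) (s k k<q)
            }

          at-phase : ∀ k s → γ P (k * P + (s * P + ρ)) ≡ z (k + s)
          at-phase k s = cong (γ P) (lem k s P ρ)
            where
            lem : ∀ k s P ρ → k * P + (s * P + ρ) ≡ (k + s) * P + ρ
            lem = solve-∀

          phases : q ≢ 1 → AtLeast Row (suc q)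
          phases q≢1 = e , inj
            where
            e : Fin (suc q) → ℕ
            e zero    = c
            e (suc a) = (toℕ a + s₀) * P + ρ
            not-const : ∀ a → ¬ (∀ k → k < q → z (k + (a + s₀)) ≡ g)
            not-const a h = min 1 (≤∧≢⇒< 1≤q (q≢1 ∘ sym))
              (blocks⇒Per a 1 ≤-refl λ k k<q → trans (h k k<q) (sym (next k k<q)))
              where
              next : ∀ k → k < q → z (k + (1 + (a + s₀))) ≡ g
              next k k<q with m≤n⇒m<n∨m≡n k<q
              ... | inj₁ sk<q = trans (cong z (+-suc k (a + s₀))) (h (suc k) sk<q)
              ... | inj₂ refl = trans (cong z (+-suc k (a + s₀)))
                    (trans (sym (zq (a + s₀) (m≤n+m s₀ a))) (h 0 z<s))
            earlier : ∀ a b → toℕ a < toℕ b → ¬ Row (e (suc a)) (e (suc b))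
            earlier a b a<b r with split-< a<b
            ... | l , eq = min (suc l) (≤-trans (subst (suc l <_) (trans (cong suc (+-comm (suc l) (toℕ a)))
                    (cong suc eq)) (s≤s (m≤m+n (suc l) (toℕ a)))) (Fin.toℕ<n b))
                (blocks⇒Per (toℕ a) (suc l) (s≤s z≤n) λ k k<q →
                  trans (sym (at-phase k (toℕ a + s₀))) (trans (r k k<q) (trans (at-phase k (toℕ b + s₀))
                    (cong (λ x → z (k + x)) (trans (cong (_+ s₀) (sym eq)) (lem (toℕ a) l s₀))))))
              where
              lem : ∀ a l s → a + suc l + s ≡ suc l + (a + s)
              lem = solve-∀
            inj : ∀ a b → Row (e a) (e b) → a ≡ b
            inj zero zero r = refl
            inj zero (suc b) r = contradiction (λ k k<q → trans (sym (at-phase k _)) (trans (sym (r k k<q)) (const k)))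
              (not-const (toℕ b))
            inj (suc a) zero r = contradiction (λ k k<q → trans (sym (at-phase k _)) (trans (r k k<q) (const k)))
              (not-const (toℕ a))
            inj (suc a) (suc b) r with <-cmp (toℕ a) (toℕ b)
            ... | tri< a<b _ _ = contradiction r (earlier a b a<b)
            ... | tri≈ _ a≡b _ = cong suc (Fin.toℕ-injective a≡b)
            ... | tri> _ _ b<a = contradiction (IsEquivalence.sym row-equiv {e (suc a)} {e (suc b)} r)
                                   (earlier b a b<a)

          unsplit : ∀ s → s₀ ≤ s → γ (q * P) (s * P + ρ) ≡ γ (q * P) ((q + s) * P + ρ)
          unsplit s s₀≤s with q ≟ 1
          -- A single phase may coincide with the monotone pattern and so yield no additional class,
          -- but then the `q`-fold step is the step itself.
          ... | yes refl = subst (λ m → γ m (s * P + ρ) ≡ γ m ((1 + s) * P + ρ)) (sym (+-identityʳ P)) (zq s s₀≤s)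
          ... | no q≢1 = dne λ ≢ → few (q * P) (ap P q)
                (subst (λ n → AtLeast (Pat (ap P (suc q))) (2 + n)) (sym (length-ap P q))
                  (split row-equiv (pat-equiv (ap P (suc q)))
                    (λ i j r k k<q → pat-γ r (k * P) P (∈-ap (m<n⇒m<1+n k<q)) (∈-ap {k = suc k} (s≤s k<q)))
                    (s * P + ρ) ((q + s) * P + ρ)
                    (λ k _ → trans (at-phase k s) (trans (zq (k + s) (≤-trans s₀≤s (m≤n+m s k)))
                      (trans (cong z (swap-+ q k s)) (sym (at-phase k (q + s))))))
                    (λ r → ≢ (pat-γ r 0 (q * P) (∈-ap {k = 0} z<s) (subst (_∈ ap P (suc q))
                      (sym (+-identityʳ (q * P))) (∈-ap ≤-refl))))
                    (phases q≢1)))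

        good : (∃[ q ] Per q) → ∃[ q ] 1 ≤ q × Good ρ q s₀
        good (q , per) with least Per q per
        ... | q , (1≤q , zq) , min = q , 1≤q , 1≤q , iterate
          where
          iterate : ∀ s → s₀ ≤ s → ∀ k → γ (q * P) (k * (q * P) + (s * P + ρ)) ≡ γ (q * P) (s * P + ρ)
          iterate s s₀≤s zero    = refl
          iterate s s₀≤s (suc k) = trans (cong (γ (q * P)) (lem k q P s ρ))
            (trans (sym (unsplit q 1≤q zq min (k * q + s) (≤-trans s₀≤s (m≤n+m s _))))
              (trans (cong (γ (q * P)) (lem′ k q P s ρ)) (iterate s s₀≤s k)))
            where
            lem : ∀ k q P s ρ → suc k * (q * P) + (s * P + ρ) ≡ (q + (k * q + s)) * P + ρ
            lem = solve-∀
            lem′ : ∀ k q P s ρ → (k * q + s) * P + ρ ≡ k * (q * P) + (s * P + ρ)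
            lem′ = solve-∀

      absurd : ⊥
      absurd = case combine Good mult (λ ρ q le (1≤q , g) → 1≤q , λ s le′ → g s (≤-trans le le′)) P
                      (λ ρ _ → phase ρ) of λ where
          (q , N , 1≤q , good) → ¬up (Monotonicity.eventually-monotone⇒UPₒ em O few (q * P) (N * P)
              (1≤* 1≤q 1≤P) (mono q N good) γ-UP)
        where
        phase : ∀ ρ → ∃₂ λ q N → 1 ≤ q × Good ρ q N
        phase ρ = case constant-progression P of λ where
          (c , g , const) → case step-UP P 1≤P ρ of λ where
            (q , s₀ , 1≤q , per) → case Phases.good c g const ρ s₀ (q , 1≤q , per) of λ where
              (q , 1≤q , good) → q , s₀ , 1≤q , good
        mult : ∀ ρ q N c → 1 ≤ c → Good ρ q N → Good ρ (c * q) N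
        mult ρ q N c 1≤c (1≤q , g) = 1≤* 1≤c 1≤q , λ s N≤s k → trans
            (subst (λ x → γ (c * q * P) (x + (s * P + ρ)) ≡ γ (q * P) (s * P + ρ)) (lem′ k c q P) (value s N≤s (k * c)))
            (sym (value s N≤s 0))
          where
          lem : ∀ j kc Q x → j * Q + (kc * Q + x) ≡ (j + kc) * Q + x
          lem = solve-∀
          lem′ : ∀ k c q P → k * c * (q * P) ≡ k * (c * q * P)
          lem′ = solve-∀
          value : ∀ s → N ≤ s → ∀ k′ → γ (c * q * P) (k′ * (q * P) + (s * P + ρ)) ≡ γ (q * P) (s * P + ρ)
          value s N≤s k′ = trans (cong (λ m → γ m (k′ * (q * P) + (s * P + ρ))) (*-assoc c q P))
            (chain _ (q * P) _ (λ j → trans (cong (γ (q * P)) (lem j k′ (q * P) _)) (g s N≤s (j + k′)))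
              (1≤* 1≤q 1≤P) c 1≤c)
        mono : ∀ q N → (∀ ρ → ρ < P → Good ρ q N) → ∀ i → N * P ≤ i → γ (q * P) i ≡ γ (q * P) (q * P + i)
        mono q N good i le with residue P i 1≤P
        ... | s , ρ , ρ<P , refl = trans (sym (proj₂ (good ρ ρ<P) s N≤s 1))
              (cong (λ x → γ (q * P) (x + (s * P + ρ))) (+-identityʳ (q * P)))
          where
          N≤s : N ≤ s
          N≤s = ≮⇒≥ λ s<N → <⇒≱ (<-≤-trans (+-monoʳ-< (s * P) ρ<P)
            (≤-trans (≤-reflexive (+-comm (s * P) P)) (*-monoˡ-≤ P s<N))) le

    γ₁-aperiodic : ¬ UP (γ 1)
    γ₁-aperiodic (P , N₀ , 1≤P , per) = PeriodicSteps.absurd P N₀ 1≤P per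

-- The direction of a block depends only on its number of descents

iv : ℕ → List ℕ
iv zero    = []
iv (suc n) = n ∷ iv n

length-iv : ∀ n → length (iv n) ≡ n
length-iv zero    = refl
length-iv (suc n) = cong suc (length-iv n)

∈-iv : ∀ {n k} → k < n → k ∈ iv n
∈-iv {suc n} k<sn with m<1+n⇒m<n∨m≡n k<sn
... | inj₁ k<n  = there (∈-iv k<n)
... | inj₂ refl = here refl

-- The interval [0, n] without k.
skip-at : ℕ → ℕ → ℕ
skip-at k n with n <? k
... | yes _ = n
... | no _  = suc n

skip : ℕ → ℕ → List ℕ
skip k zero    = []
skip k (suc n) = skip-at k n ∷ skip k n

length-skip : ∀ k n → length (skip k n) ≡ n
length-skip k zero    = refl
length-skip k (suc n) = cong suc (length-skip k n)

skip-at∈ : ∀ k {n s} → s < n → skip-at k s ∈ skip k n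
skip-at∈ k {suc n} s<sn with m<1+n⇒m<n∨m≡n s<sn
... | inj₁ s<n  = there (skip-at∈ k s<n)
... | inj₂ refl = here refl

∈-skip : ∀ {k n} → k ≤ n → ∀ s → s ≤ n → s ≢ k → s ∈ skip k n
∈-skip {k} {n} k≤n s s≤n s≢k with <-cmp s k
... | tri≈ _ s≡k _ = contradiction s≡k s≢k
... | tri< s<k _ _ = subst (_∈ skip k n) below (skip-at∈ k (<-≤-trans s<k k≤n))
  where
  below : skip-at k s ≡ s
  below with s <? k
  ... | yes _   = refl
  ... | no s≮k = contradiction s<k s≮k
∈-skip {k} {n} k≤n (suc s) s≤n s≢k | tri> _ _ k<s = subst (_∈ skip k n) above (skip-at∈ k s≤n)
  where
  above : skip-at k s ≡ suc s
  above with s <? k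
  ... | no _    = refl
  ... | yes s<k = contradiction s<k (≤⇒≯ (s≤s⁻¹ k<s))

num : (ℕ → Bool) → ℕ → ℕ
num f zero    = 0
num f (suc n) = bit (f n) + num f n

num-mono : ∀ {f g : ℕ → Bool} → ∀ n → (∀ s → s < n → f s ≡ true → g s ≡ true) → num f n ≤ num g n
num-mono zero    h = z≤n
num-mono {f} {g} (suc n) h =
  +-mono-≤ (le (f n) (g n) (h n ≤-refl)) (num-mono n λ s s<n → h s (m<n⇒m<1+n s<n))
  where
  le : ∀ a b → (a ≡ true → b ≡ true) → bit a ≤ bit b
  le true  b i = ≤-reflexive (cong bit (sym (i refl)))
  le false b i = z≤n

num-strict : ∀ {f g : ℕ → Bool} n → (∀ s → s < n → f s ≡ true → g s ≡ true) →
             ∀ k → k < n → f k ≡ false → g k ≡ true → num f n < num g n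
num-strict {f} {g} (suc n) h k k<sn fk gk with m<1+n⇒m<n∨m≡n k<sn
... | inj₂ refl rewrite fk | gk = s≤s (num-mono n λ s s<n → h s (m<n⇒m<1+n s<n))
... | inj₁ k<n = +-mono-≤-< (le (f n) (g n) (h n ≤-refl))
        (num-strict n (λ s s<n → h s (m<n⇒m<1+n s<n)) k k<n fk gk)
  where
  le : ∀ a b → (a ≡ true → b ≡ true) → bit a ≤ bit b
  le true  b i = ≤-reflexive (cong bit (sym (i refl)))
  le false b i = z≤n

lt? : ℕ → ℕ → Bool
lt? x y with x <? y
... | yes _ = true
... | no _  = false

lt?-true : ∀ {x y} → x < y → lt? x y ≡ true
lt?-true {x} {y} lt with x <? y
... | yes _ = refl
... | no ¬p = contradiction lt ¬p

lt?-false : ∀ {x y} → ¬ (x < y) → lt? x y ≡ false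
lt?-false {x} {y} nlt with x <? y
... | yes p = contradiction p nlt
... | no _  = refl

true⇒lt : ∀ {x y} → lt? x y ≡ true → x < y
true⇒lt {x} {y} q with x <? y
... | yes p = p
true⇒lt () | no _

module Heights (em : ExcludedMiddle 0ℓ) (O : Order) (few : FewPatterns O)
               (¬up : ¬ Patterns.UPₒ O) where
  open Classical em
  open WordsClassical em
  open Patterns O
  open PatternsClassical em O
  open Aperiodic em O few using (γ₁-aperiodic)

  -- The letter true is a descent.
  W : ℕ → Bool
  W i = not (γ 1 i)

  open Word W public

  W-aperiodic : ¬ UP W
  W-aperiodic (P , N , 1≤P , h) =
    γ₁-aperiodic ¬up (P , N , 1≤P , λ i le → Bool.not-injective (h i le))

  pat⇒blk : ∀ n i j → Pat (iv (suc n)) i j → Blk n i j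
  pat⇒blk n i j r = blk λ k k<n → cong not (same r k (suc k) (∈-iv (m<n⇒m<1+n k<n)) (∈-iv (s≤s k<n)))

  few-iv : ∀ n → ¬ AtLeast (Pat (iv (suc n))) (2 + n)
  few-iv n = subst (λ k → ¬ AtLeast (Pat (iv (suc n))) (2 + k)) (length-iv n) (few n (iv n))

  few-blocks : ∀ n → ¬ AtLeast (Blk n) (2 + n)
  few-blocks n al = few-iv n (atLeast-antitone {R = Blk n} {R′ = Pat (iv (suc n))} (pat⇒blk n) al)

  -- The patterns of an interval refine the factors; there are `suc n` factors and no more patterns,
  -- so no factor is split.
  blk⇒pat : ∀ n {i j} → Blk n i j → Pat (iv (suc n)) i j
  blk⇒pat n = split-unique (blk-equiv n) (pat-equiv (iv (suc n))) (pat⇒blk n)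
                (morse-hedlund W W-aperiodic n) (few-iv n)

  blk⇒γ : ∀ m {i j} → Blk m i j → γ m i ≡ γ m j
  blk⇒γ m r = same (blk⇒pat m r) 0 m (∈-iv z<s) (∈-iv ≤-refl)

  module C = Complexity W W-aperiodic few-blocks

  W-balanced : Word.Balanced W
  W-balanced = C.balanced

  open Balance.Balanced em W W-aperiodic W-balanced public

  -- Otherwise the block between `k` and `k₂` would have the same count everywhere. The resulting
  -- `r` separates two coordinates in which count vectors differ.
  nonconstant-difference : ∀ k k₂ → k ≢ k₂ → ∀ p → ∃[ r ] cnt k r + cnt k₂ p ≢ cnt k₂ r + cnt k p
  nonconstant-difference k k₂ k≢k₂ p = dne λ none → go (λ r → dne λ ≢ → none (r , ≢))
    where
    window : ∀ k l → (∀ r → cnt k r + cnt (k + suc l) p ≡ cnt (k + suc l) r + cnt k p) → ⊥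
    window k l h = constant-counts (suc l) (cnt (suc l) (k + p)) (s≤s z≤n)
      λ _ → k , λ j _ → trans (cong (cnt (suc l)) (+-comm (j * suc l) k)) (eq (j * suc l))
      where
      eq : ∀ r → cnt (suc l) (k + r) ≡ cnt (suc l) (k + p)
      eq r = lin 6 (λ a b c d e f → (c ≈ᵉ a ⊕ b) ⇒ (f ≈ᵉ d ⊕ e) ⇒ (a ⊕ f ≈ᵉ c ⊕ d) ⇒ (⊢ (b ≈ᵉ e))) refl
        (cnt k r) (cnt (suc l) (k + r)) (cnt (k + suc l) r)
        (cnt k p) (cnt (suc l) (k + p)) (cnt (k + suc l) p)
        (cnt-+ k (suc l) r) (cnt-+ k (suc l) p) (h r)
    go : (∀ r → cnt k r + cnt k₂ p ≡ cnt k₂ r + cnt k p) → ⊥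
    go h with <-cmp k k₂
    ... | tri≈ _ k≡k₂ _ = k≢k₂ k≡k₂
    ... | tri< k<k₂ _ _ with split-< k<k₂
    ...   | l , refl = window k l h
    go h | tri> _ _ k₂<k with split-< k₂<k
    ...   | l , refl = window k₂ l (sym ∘ h)

  module CountDetermines (m : ℕ) where

    -- V = [0, L] contains [a, b] with a long margin on the left.
    module Margin (R : ℕ) (hit : ∀ b i → ∃[ k ] k < R × W (k + i) ≡ b) where

      a b L : ℕ
      a = suc R
      b = a + m
      -- One element beyond `b`, so that the letter at `2 + k` can still be read off when an element
      -- `suc k < b` is removed.
      L = suc b

      -- Equal margins on both sides of two different middle parts force all letters
      -- of the left margin to agree with the first letter of the right one.
      no-shift : ∀ k x y → R < k → (∀ s → s ≤ k → cnt s x ≡ cnt s y) →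
                 W (2 + k + x) ≡ W (2 + k + y) → cnt (2 + k) x < cnt (2 + k) y → ⊥
      no-shift k x y R<k eq last lt with hit (not (W (2 + k + x))) x
      ... | s , s<R , q with split-≤ (≤-trans (<⇒≤ (<-trans s<R R<k)) (m≤n+m k 2))
      ... | n , n+s = Bool.not-¬ refl (trans (sym u≡v) q)
        where
        s<k = <-trans s<R R<k
        u≡ : W (s + x) ≡ W (s + y)
        u≡ = Blk.at (cnt⇒blk k eq) s s<k
        dec : ∀ z → cnt (2 + k) z ≡ cnt s z + cnt n (s + z)
        dec z = trans (cong (λ l → cnt l z) (trans (sym n+s) (+-comm n s))) (cnt-+ s n z)
        end : ∀ z → cnt (suc n) (s + z) ≡ cnt n (s + z) + bit (W (2 + k + z))
        end z = trans (cnt-snoc n (s + z)) (cong (λ i → cnt n (s + z) + bit (W i))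
                  (trans (sym (+-assoc n s z)) (cong (_+ z) n+s)))
        X<Y : cnt n (s + x) < cnt n (s + y)
        X<Y = +-cancelˡ-< (cnt s x) _ _ (subst₂ _<_ (dec x)
          (trans (dec y) (cong (_+ cnt n (s + y)) (sym (eq s (<⇒≤ s<k))))) lt)
        u≡v : W (s + x) ≡ W (2 + k + x)
        u≡v = bit-injective (lin 6 (λ X Y X′ Y′ u v → (X ≺ Y) ⇒ (u ⊕ X′ ≈ᵉ X ⊕ v) ⇒ (u ⊕ Y′ ≈ᵉ Y ⊕ v) ⇒
            (Y ≼ con 1 ⊕ X′) ⇒ (Y′ ≼ con 1 ⊕ X) ⇒ (⊢ (u ≈ᵉ v))) refl
          (cnt n (s + x)) (cnt n (s + y)) (cnt n (suc s + x)) (cnt n (suc s + y))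
          (bit (W (s + x))) (bit (W (2 + k + x))) X<Y
          (end x) (subst₂ (λ f g → bit f + cnt n (suc s + y) ≡ cnt n (s + y) + bit g) (sym u≡) (sym last) (end y))
          (W-balanced n (s + y) (suc s + x)) (W-balanced n (suc s + y) (s + x)))

      -- q arises from p by exchanging 01 for 10 around k.
      record Crossing (k p q : ℕ) : Set where
        field
          off : ∀ s → s ≤ L → s ≢ k → cnt s p ≡ cnt s q
          up  : cnt k q ≡ suc (cnt k p)
      open Crossing

      -- If `x` exceeded `p` at some `s` other than `k`, it would exceed `q` there as well. At `k`
      -- it is at most `p` and hence below `q`, so the excess of `x` over `q` would change by two.
      crossing-≤ : ∀ {k p q x y} → k ≤ L → Crossing k p q → Crossing k x y → ∀ s → s ≤ L → cnt s x ≤ cnt s p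
      crossing-≤ {k} {p} {q} {x} {y} k≤L c d s s≤L with s ≟ k
      ... | yes refl = lin 4 (λ x y p q → (y ≈ᵉ con 1 ⊕ x) ⇒ (y ≼ con 1 ⊕ p) ⇒ (⊢ (x ≼ p))) refl
              (cnt s x) (cnt s y) (cnt s p) (cnt s q) (up d) (W-balanced s y p)
      ... | no s≢k = ≮⇒≥ λ lt → 1≰0 (lin 7 (λ xs qs ps xk qk pk yk →
              (ps ≺ xs) ⇒ (ps ≈ᵉ qs) ⇒ (xs ⊕ qk ≼ con 1 ⊕ (qs ⊕ xk)) ⇒ (qk ≈ᵉ con 1 ⊕ pk) ⇒
              (yk ≈ᵉ con 1 ⊕ xk) ⇒ (yk ≼ con 1 ⊕ pk) ⇒ (⊢ (con 1 ≼ con 0))) refl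
              (cnt s x) (cnt s q) (cnt s p) (cnt k x) (cnt k q) (cnt k p) (cnt k y)
              lt (off c s s≤L s≢k) (balanced₂ s k x q) (up c) (up d) (W-balanced k y p))

      crossing-blk : ∀ {k p q x y} → k ≤ L → Crossing k p q → Crossing k x y → Blk L p x × Blk L q y
      crossing-blk {k} {p} {q} {x} {y} k≤L c d = cnt⇒blk L eq , cnt⇒blk L eq′
        where
        eq : ∀ s → s ≤ L → cnt s p ≡ cnt s x
        eq s s≤L = ≤-antisym (crossing-≤ k≤L d c s s≤L) (crossing-≤ k≤L c d s s≤L)
        eq′ : ∀ s → s ≤ L → cnt s q ≡ cnt s y
        eq′ s s≤L with s ≟ k
        ... | yes refl = trans (up c) (trans (cong suc (eq s s≤L)) (sym (up d)))
        ... | no s≢k = trans (sym (off c s s≤L s≢k)) (trans (eq s s≤L) (off d s s≤L s≢k))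

      γ-at : ∀ x → γ m (a + x) ≡ lt (a + x) (b + x)
      γ-at x = cong (lt (a + x)) (trans (sym (+-assoc m a x)) (cong (_+ x) (+-comm m a)))

      γ-blk : ∀ {x y} → Blk L x y → γ m (a + x) ≡ γ m (a + y)
      γ-blk r = blk⇒γ m (blk-shift m a (blk-≤ (≤-trans (≤-reflexive (+-comm m a)) (n≤1+n b)) _ _ r))

      -- Without k the window has fewer patterns than there are factors of length L; two factors
      -- that merge must be a crossing pair, and crossing pairs are unique.
      merge : ∀ k → R < k → suc k < b → ∃₂ λ x y → Crossing (suc k) x y × Pat (skip (suc k) L) x y
      merge k R<k sk<b = from (collision (Pat V) few-V (proj₁ mh))
        where
        V = skip (suc k) L
        sk≤L : suc k ≤ L
        sk≤L = ≤-trans (<⇒≤ sk<b) (n≤1+n b)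
        few-V : ¬ AtLeast (Pat V) (suc L)
        few-V = subst (λ n → ¬ AtLeast (Pat V) (2 + n)) (length-skip (suc k) b)
                  (few (skip-at (suc k) b) (skip (suc k) b))
        mh = morse-hedlund W W-aperiodic L
        module _ {x y} (r : Pat V x y) where
          letter : ∀ s → suc s ≤ L → s ≢ suc k → s ≢ k → W (s + x) ≡ W (s + y)
          letter s s<L s≢ s≢′ = cong not (same r s (suc s) (∈-skip sk≤L s (<⇒≤ s<L) s≢)
            (∈-skip sk≤L (suc s) s<L (s≢′ ∘ suc-injective)))
          left : ∀ s → s ≤ k → cnt s x ≡ cnt s y
          left s s≤k = blk⇒cnt s (blk λ t t<s → let t<k = <-≤-trans t<s s≤k in
            letter t (≤-trans (<⇒≤ (s≤s t<k)) sk≤L) (<⇒≢ (m<n⇒m<1+n t<k)) (<⇒≢ t<k))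
          last : W (2 + k + x) ≡ W (2 + k + y)
          last = letter (2 + k) (s≤s sk<b) 1+n≢n (λ q → m≢1+n+m k (sym q))
          off′ : cnt (2 + k) x ≡ cnt (2 + k) y → ∀ s → s ≤ L → s ≢ suc k → cnt s x ≡ cnt s y
          off′ e s s≤L s≢ with <-cmp s (suc k)
          ... | tri< s<sk _ _ = left s (s≤s⁻¹ s<sk)
          ... | tri≈ _ s≡ _   = contradiction s≡ s≢
          ... | tri> _ _ sk<s with split-≤ sk<s
          ...   | t , refl = begin
            cnt (t + (2 + k)) x                ≡⟨ cong (λ n → cnt n x) (+-comm t (2 + k)) ⟩
            cnt (2 + k + t) x                  ≡⟨ cnt-+ (2 + k) t x ⟩
            cnt (2 + k) x + cnt t (2 + k + x)  ≡⟨ cong₂ _+_ e (blk⇒cnt t rest) ⟩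
            cnt (2 + k) y + cnt t (2 + k + y)  ≡⟨ cnt-+ (2 + k) t y ⟨
            cnt (2 + k + t) y                  ≡⟨ cong (λ n → cnt n y) (+-comm t (2 + k)) ⟨
            cnt (t + (2 + k)) y                ∎
            where
            open ≡-Reasoning
            rest : Blk t (2 + k + x) (2 + k + y)
            rest = blk λ u u<t → trans (cong W (sym (+-assoc u (2 + k) x))) (trans
              (letter (u + (2 + k)) (<-≤-trans (+-monoˡ-< (2 + k) u<t) s≤L)
                (λ q → <⇒≢ (m≤n+m (2 + k) u) (sym q))
                (λ q → <⇒≢ (<⇒≤ (m≤n+m (2 + k) u)) (sym q)))
              (cong W (+-assoc u (2 + k) y)))
          classify : ¬ Blk L x y → Crossing (suc k) x y ⊎ Crossing (suc k) y x
          classify ¬blk with <-cmp (cnt (2 + k) x) (cnt (2 + k) y)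
          ... | tri< lt _ _ = ⊥-elim (no-shift k x y R<k left last lt)
          ... | tri> _ _ gt = ⊥-elim (no-shift k y x R<k (λ s s≤k → sym (left s s≤k)) (sym last) gt)
          ... | tri≈ _ e _ with <-cmp (cnt (suc k) x) (cnt (suc k) y)
          ...   | tri< lt _ _ = inj₁ record { off = off′ e ; up = ≤-antisym (W-balanced (suc k) y x) lt }
          ...   | tri> _ _ gt = inj₂ record { off = λ s s≤L s≢ → sym (off′ e s s≤L s≢)
                                            ; up = ≤-antisym (W-balanced (suc k) x y) gt }
          ...   | tri≈ _ e′ _ = contradiction (cnt⇒blk L all) ¬blk
            where
            all : ∀ s → s ≤ L → cnt s x ≡ cnt s y
            all s s≤L with s ≟ suc k
            ... | yes refl = e′
            ... | no s≢    = off′ e s s≤L s≢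
        from : (∃₂ λ i j → Pat V (proj₁ mh i) (proj₁ mh j) × i ≢ j) →
               ∃₂ λ x y → Crossing (suc k) x y × Pat V x y
        from (i , j , r , i≢j) = [ (λ c → _ , _ , c , r) , (λ c → _ , _ , c , P.sym r) ]′
          (classify r (λ b → i≢j (proj₂ mh i j b)))

      outside : ∀ k p q → (∀ t → t ≤ m → a + t ≢ k) →
                (∀ s → s ≤ L → s ≢ k → cnt s p + cnt a q ≡ cnt s q + cnt a p) → γ m (a + p) ≡ γ m (a + q)
      outside k p q ne off = blk⇒γ m (cnt⇒blk m λ t t≤m → lin 6 (λ ap aq tp tq sp sq →
          (sp ≈ᵉ ap ⊕ tp) ⇒ (sq ≈ᵉ aq ⊕ tq) ⇒ (sp ⊕ aq ≈ᵉ sq ⊕ ap) ⇒ (⊢ (tp ≈ᵉ tq))) refl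
        (cnt a p) (cnt a q) (cnt t (a + p)) (cnt t (a + q)) (cnt (a + t) p) (cnt (a + t) q)
        (cnt-+ a t p) (cnt-+ a t q)
        (off (a + t) (≤-trans (+-monoʳ-≤ a t≤m) (n≤1+n b)) (ne t t≤m)))

      -- For `k` strictly between `a` and `b` the pair is a crossing, hence the one that merges
      -- without `k`; as `a` and `b` stay in the window, their comparison is the same on both sides.
      -- For other `k` the blocks from `a` to `b` coincide.
      single : ∀ k p q → k ≤ L → k ≢ a → k ≢ b →
               (∀ s → s ≤ L → s ≢ k → cnt s p + cnt a q ≡ cnt s q + cnt a p) →
               cnt k q + cnt a p ≡ suc (cnt k p + cnt a q) → γ m (a + p) ≡ γ m (a + q)
      single k p q k≤L k≢a k≢b off up with <-cmp a k | <-cmp k b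
      ... | tri≈ _ a≡k _ | _ = contradiction (sym a≡k) k≢a
      ... | _ | tri≈ _ k≡b _ = contradiction k≡b k≢b
      ... | tri> a≮k _ _ | _ = outside k p q (λ t t≤m q → a≮k (subst (a <_) q (m<m+n a (n≢0⇒n>0 λ t≡0 →
              k≢a (trans (sym q) (trans (cong (a +_) t≡0) (+-identityʳ a))))))) off
      ... | _ | tri> _ _ b<k = outside k p q (λ t t≤m q → <⇒≱ b<k (subst (_≤ b) q (+-monoʳ-≤ a t≤m))) off
      single (suc k) p q k≤L k≢a k≢b off up | tri< a<k _ _ | tri< k<b _ _ =
        case merge k (s≤s⁻¹ a<k) k<b of λ where
          (x , y , d , r) → let bx , by = crossing-blk k≤L c d in begin
            γ m (a + p)            ≡⟨ γ-blk bx ⟩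
            γ m (a + x)            ≡⟨ γ-at x ⟩
            lt (a + x) (b + x)     ≡⟨ same r a b (∈-skip k≤L a (≤-trans (m≤m+n a m) (n≤1+n b)) (k≢a ∘ sym))
                                                 (∈-skip k≤L b (n≤1+n b) (k≢b ∘ sym)) ⟩
            lt (a + y) (b + y)     ≡⟨ γ-at y ⟨
            γ m (a + y)            ≡⟨ γ-blk by ⟨
            γ m (a + q)            ∎
        where
        open ≡-Reasoning
        base : cnt a q ≡ cnt a p
        -- At `s = 0` the counts vanish and only the normalisation remains.
        base = off 0 z≤n λ ()
        c : Crossing (suc k) p q
        c = record
          { off = λ s s≤L s≢ → +-cancelʳ-≡ (cnt a q) _ _ (trans (off s s≤L s≢) (cong (cnt s q +_) (sym base)))
          ; up  = +-cancelʳ-≡ (cnt a p) _ _ (trans up (cong (λ z → suc (cnt (suc k) p + z)) base))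
          }

      infix 4 _≼ₚ_
      -- Compares count vectors normalised at `a`. In this normalisation, equal counts over the `m`
      -- letters after `a` mean agreement at `b`.
      _≼ₚ_ : ℕ → ℕ → Set
      p ≼ₚ q = ∀ s → s ≤ L → cnt s p + cnt a q ≤ cnt s q + cnt a p

      above : ℕ → ℕ → ℕ → Bool
      above p q s = lt? (cnt s p + cnt a q) (cnt s q + cnt a p)

      -- A position r that is low at k and high at k₂ is squeezed in between p and q.
      between : ∀ p q r k k₂ → p ≼ₚ q → k ≤ L → k₂ ≤ L →
        cnt k p + cnt a q < cnt k q + cnt a p → cnt k₂ p + cnt a q < cnt k₂ q + cnt a p →
        cnt k r + cnt k₂ p < cnt k₂ r + cnt k p →
        p ≼ₚ r × r ≼ₚ q × num (above p r) (suc L) < num (above p q) (suc L)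
                        × num (above r q) (suc L) < num (above p q) (suc L)
      between p q r k k₂ p≼q k≤L k₂≤L up up₂ sep = lo , hi ,
          num-strict (suc L) (λ s s≤L t → lt?-true (lin 6 (λ sp ap sq aq sr ar →
              (sp ⊕ ar ≺ sr ⊕ ap) ⇒ (sr ⊕ aq ≼ sq ⊕ ar) ⇒ (⊢ (sp ⊕ aq ≺ sq ⊕ ap))) refl
              (cnt s p) (cnt a p) (cnt s q) (cnt a q) (cnt s r) (cnt a r) (true⇒lt t) (hi s (s≤s⁻¹ s≤L))))
            k (s≤s k≤L) (lt?-false λ lt → 1≰0 (lin 6 (λ kp ap kr ar k₂p k₂r →
              (kp ⊕ ar ≺ kr ⊕ ap) ⇒ (kr ⊕ k₂p ≺ k₂r ⊕ kp) ⇒ (k₂r ⊕ ap ≼ con 1 ⊕ (k₂p ⊕ ar)) ⇒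
              (⊢ (con 1 ≼ con 0))) refl
              (cnt k p) (cnt a p) (cnt k r) (cnt a r) (cnt k₂ p) (cnt k₂ r)
              lt sep (b₂ k₂ a r p)))
            (lt?-true up) ,
          num-strict (suc L) (λ s s≤L t → lt?-true (lin 6 (λ sp ap sq aq sr ar →
              (sr ⊕ aq ≺ sq ⊕ ar) ⇒ (sp ⊕ ar ≼ sr ⊕ ap) ⇒ (⊢ (sp ⊕ aq ≺ sq ⊕ ap))) refl
              (cnt s p) (cnt a p) (cnt s q) (cnt a q) (cnt s r) (cnt a r) (true⇒lt t) (lo s (s≤s⁻¹ s≤L))))
            k₂ (s≤s k₂≤L) (lt?-false λ lt → 1≰0 (lin 9 (λ kp ap kr ar k₂p k₂r kq aq k₂q →
              (k₂r ⊕ aq ≺ k₂q ⊕ ar) ⇒ (k₂q ⊕ ap ≼ con 1 ⊕ (k₂p ⊕ aq)) ⇒ (kr ⊕ k₂p ≺ k₂r ⊕ kp) ⇒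
              (kp ⊕ aq ≺ kq ⊕ ap) ⇒ (kq ⊕ ar ≼ con 1 ⊕ (kr ⊕ aq)) ⇒
              (⊢ (con 1 ≼ con 0))) refl
              (cnt k p) (cnt a p) (cnt k r) (cnt a r) (cnt k₂ p) (cnt k₂ r) (cnt k q) (cnt a q) (cnt k₂ q)
              lt (b₂ k₂ a q p) sep up (b₂ k a q r)))
            (lt?-true up₂)
        where
        b₂ : ∀ s t p q → cnt s p + cnt t q ≤ suc (cnt s q + cnt t p)
        b₂ = balanced₂
        lo : p ≼ₚ r
        lo s s≤L = lin 8 (λ sp ap sr ar kp kr k₂p k₂r →
            (sp ⊕ k₂r ≼ con 1 ⊕ (sr ⊕ k₂p)) ⇒ (kr ⊕ k₂p ≺ k₂r ⊕ kp) ⇒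
            (kp ⊕ ar ≼ kr ⊕ ap) ⇒ (⊢ (sp ⊕ ar ≼ sr ⊕ ap))) refl
          (cnt s p) (cnt a p) (cnt s r) (cnt a r) (cnt k p) (cnt k r) (cnt k₂ p) (cnt k₂ r)
          (b₂ s k₂ p r) sep (lin 6 (λ kp ap kq aq kr ar → (kp ⊕ aq ≺ kq ⊕ ap) ⇒
            (kq ⊕ ar ≼ con 1 ⊕ (kr ⊕ aq)) ⇒ (⊢ (kp ⊕ ar ≼ kr ⊕ ap))) refl
            (cnt k p) (cnt a p) (cnt k q) (cnt a q) (cnt k r) (cnt a r) up (b₂ k a q r))
        hi : r ≼ₚ q
        hi s s≤L = lin 6 (λ sr ar sq aq kr kq →
            (sr ⊕ kq ≼ con 1 ⊕ (sq ⊕ kr)) ⇒ (kr ⊕ aq ≺ kq ⊕ ar) ⇒ (⊢ (sr ⊕ aq ≼ sq ⊕ ar))) refl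
          (cnt s r) (cnt a r) (cnt s q) (cnt a q) (cnt k r) (cnt k q)
          (b₂ s k r q) (lin 8 (λ kp ap kq aq kr ar k₂p k₂r →
            (kp ⊕ aq ≺ kq ⊕ ap) ⇒ (kr ⊕ k₂p ≺ k₂r ⊕ kp) ⇒ (k₂r ⊕ ap ≼ con 1 ⊕ (k₂p ⊕ ar)) ⇒
            (⊢ (kr ⊕ aq ≺ kq ⊕ ar))) refl
            (cnt k p) (cnt a p) (cnt k q) (cnt a q) (cnt k r) (cnt a r) (cnt k₂ p) (cnt k₂ r)
            up sep (b₂ k₂ a r p))

      -- Walks up the chain from `p` to `q`, by induction on the number of coordinates in which they
      -- differ. If there are two, some `r` lies strictly between; if there is one, `single`
      -- applies. Agreement at `b` is inherited by everything in between.
      climb : ∀ n p q → num (above p q) (suc L) < n → p ≼ₚ q →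
              cnt b p + cnt a q ≡ cnt b q + cnt a p → γ m (a + p) ≡ γ m (a + q)
      climb (suc n) p q fuel p≼q at-b = case em {∃[ k ] k ≤ L × cnt k p + cnt a q < cnt k q + cnt a p} of λ where
          (no none) → level λ s s≤L → ≤-antisym (p≼q s s≤L) (≮⇒≥ λ lt → none (s , s≤L , lt))
          (yes (k , k≤L , up)) →
            case em {∃[ k₂ ] k₂ ≤ L × k₂ ≢ k × cnt k₂ p + cnt a q < cnt k₂ q + cnt a p} of λ where
              (no alone) → single k p q k≤L
                (λ { refl → <⇒≢ up (+-comm (cnt k p) (cnt k q)) }) (λ { refl → <⇒≢ up at-b })
                (λ s s≤L s≢k → ≤-antisym (p≼q s s≤L) (≮⇒≥ λ lt → alone (s , s≤L , s≢k , lt)))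
                (≤-antisym (balanced₂ k a q p) up)
              (yes (k₂ , k₂≤L , k₂≢k , up₂)) → case nonconstant-difference k k₂ (k₂≢k ∘ sym) p of λ where
                (r , ≢) → case <-cmp (cnt k r + cnt k₂ p) (cnt k₂ r + cnt k p) of λ where
                  (tri≈ _ e _) → contradiction e ≢
                  (tri< lt _ _) → via r (between p q r k k₂ p≼q k≤L k₂≤L up up₂ lt)
                  (tri> _ _ gt) → via r (between p q r k₂ k p≼q k₂≤L k≤L up₂ up gt)
        where
        level : (∀ s → s ≤ L → cnt s p + cnt a q ≡ cnt s q + cnt a p) → γ m (a + p) ≡ γ m (a + q)
        level h = γ-blk (cnt⇒blk L λ s s≤L → +-cancelʳ-≡ (cnt a q) _ _
          (trans (h s s≤L) (cong (cnt s q +_) (sym (h 0 z≤n)))))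
        b≤L : b ≤ L
        b≤L = n≤1+n b
        via : ∀ r → p ≼ₚ r × r ≼ₚ q × num (above p r) (suc L) < num (above p q) (suc L)
                          × num (above r q) (suc L) < num (above p q) (suc L) → γ m (a + p) ≡ γ m (a + q)
        via r (lo , hi , less₁ , less₂) = trans
            (climb n p r (<-≤-trans less₁ (s≤s⁻¹ fuel)) lo at₁) (climb n r q (<-≤-trans less₂ (s≤s⁻¹ fuel)) hi at₂)
          where
          at₁ : cnt b p + cnt a r ≡ cnt b r + cnt a p
          at₁ = lin 6 (λ p p′ r r′ q q′ → (p ⊕ r′ ≼ r ⊕ p′) ⇒ (r ⊕ q′ ≼ q ⊕ r′) ⇒ (p ⊕ q′ ≈ᵉ q ⊕ p′) ⇒
                  (⊢ (p ⊕ r′ ≈ᵉ r ⊕ p′))) refl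
                (cnt b p) (cnt a p) (cnt b r) (cnt a r) (cnt b q) (cnt a q) (lo b b≤L) (hi b b≤L) at-b
          at₂ : cnt b r + cnt a q ≡ cnt b q + cnt a r
          at₂ = lin 6 (λ p p′ r r′ q q′ → (p ⊕ r′ ≼ r ⊕ p′) ⇒ (r ⊕ q′ ≼ q ⊕ r′) ⇒ (p ⊕ q′ ≈ᵉ q ⊕ p′) ⇒
                  (⊢ (r ⊕ q′ ≈ᵉ q ⊕ r′))) refl
                (cnt b p) (cnt a p) (cnt b r) (cnt a r) (cnt b q) (cnt a q) (lo b b≤L) (hi b b≤L) at-b

      total : ∀ p q → p ≼ₚ q ⊎ q ≼ₚ p
      total p q = case em {∃[ s ] s ≤ L × cnt s p + cnt a q < cnt s q + cnt a p} of λ where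
        (yes (s , _ , lt)) → inj₁ λ t _ → lin 6 (λ sp ap sq aq tp tq → (sp ⊕ aq ≺ sq ⊕ ap) ⇒
            (tp ⊕ sq ≼ con 1 ⊕ (tq ⊕ sp)) ⇒ (⊢ (tp ⊕ aq ≼ tq ⊕ ap))) refl
          (cnt s p) (cnt a p) (cnt s q) (cnt a q) (cnt t p) (cnt t q) lt (balanced₂ t s p q)
        (no none) → inj₂ λ s s≤L → ≮⇒≥ λ lt → none (s , s≤L , lt)

      window-γ : ∀ p q → cnt m (a + p) ≡ cnt m (a + q) → γ m (a + p) ≡ γ m (a + q)
      window-γ p q e = case total p q of λ where
          (inj₁ p≼q) → climb _ p q ≤-refl p≼q (at-end p q e)
          (inj₂ q≼p) → sym (climb _ q p ≤-refl q≼p (at-end q p (sym e)))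
        where
        at-end : ∀ p q → cnt m (a + p) ≡ cnt m (a + q) → cnt b p + cnt a q ≡ cnt b q + cnt a p
        at-end p q e = lin 6 (λ bp ap bq aq mp mq → (bp ≈ᵉ ap ⊕ mp) ⇒ (bq ≈ᵉ aq ⊕ mq) ⇒ (mp ≈ᵉ mq) ⇒
            (⊢ (bp ⊕ aq ≈ᵉ bq ⊕ ap))) refl
          (cnt b p) (cnt a p) (cnt b q) (cnt a q) (cnt m (a + p)) (cnt m (a + q))
          (cnt-+ a m p) (cnt-+ a m q) e

      -- Recurrence moves both blocks to places that have a left margin of `a` letters.
      any-γ : ∀ i j → cnt m i ≡ cnt m j → γ m i ≡ γ m j
      any-γ i j e = case C.recurrent m a i of λ where
        (i′ , le , r) → case C.recurrent m a j of λ where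
          (j′ , le′ , r′) → case split-≤ le of λ where
            (p , refl) → case split-≤ le′ of λ where
              (q , refl) → trans (blk⇒γ m r) (trans (subst₂ (λ x y → γ m x ≡ γ m y)
                  (+-comm a p) (+-comm a q)
                  (window-γ p q (subst₂ (λ x y → cnt m x ≡ cnt m y) (+-comm p a) (+-comm q a)
                    (trans (sym (blk⇒cnt m r)) (trans e (blk⇒cnt m r′))))))
                  (sym (blk⇒γ m r′)))

    count⇒γ : ∀ i j → cnt m i ≡ cnt m j → γ m i ≡ γ m j
    count⇒γ = case run-bound true of λ where
      (R , hit) → case run-bound false of λ where
        (R′ , hit′) → Margin.any-γ (R + R′) λ where
          true  i → let k , k< , q = hit i in k , ≤-trans k< (m≤m+n R R′) , q
          false i → let k , k< , q = hit′ i in k , ≤-trans k< (m≤n+m R′ R) , q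

-- Separating the slopes of rising and falling blocks

module Slopes (em : ExcludedMiddle 0ℓ) (O : Order) (few : FewPatterns O)
              (¬up : ¬ Patterns.UPₒ O) where
  open Classical em
  open Patterns O
  open Heights em O few ¬up
  open CountDetermines using (count⇒γ)

  γ-false : ∀ {m i} → 1 ≤ m → γ m i ≡ false → lt (m + i) i ≡ true
  γ-false {m} {i} 1≤m q = lt-flip (m+i≢i i 1≤m) q

  -- Where the count over m letters increases from x to x + 1, the step at x is up and the step at
  -- x + m is down.
  no-inversion : ∀ m i j → γ m i ≡ false → γ m j ≡ true → cnt m j ≡ suc (cnt m i) → ⊥
  no-inversion zero    i j _ _ ()
  no-inversion m@(suc _) i j γi γj light-heavy = case C.recurrent m i j of λ where
      (j′ , i≤j′ , r) → case split-≤ i≤j′ of λ where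
        (n , refl) → case first-change (λ s → γ m (s + i)) false n γi (trans (sym (blk⇒γ m r)) γj) of λ where
          (s , _ , γx , γx′) → inverted (s + i) γx γx′
    where
    true≢false : true ≢ false
    true≢false ()
    inverted : ∀ x → γ m x ≡ false → γ m (suc x) ≡ true → ⊥
    inverted x γx γx′ = lt-asym (lt-trans below (lt-trans (up-at x Wx) above)) (down-at (m + x) Wmx)
      where
      low : ∀ y → cnt m y ≢ cnt m i → cnt m y ≡ cnt m j
      low y ≢ = ≤-antisym (subst (cnt m y ≤_) (sym light-heavy) (W-balanced m y i))
        (subst (_≤ cnt m y) (sym light-heavy) (≤∧≢⇒< (s≤s⁻¹ (subst (_≤ suc (cnt m y)) light-heavy (W-balanced m j y))) (≢ ∘ sym)))
      heavy : cnt m (suc x) ≡ suc (cnt m i)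
      heavy = trans (low (suc x) λ e → true≢false (trans (sym γx′) (trans (count⇒γ m (suc x) i e) γi))) light-heavy
      light : cnt m x ≡ cnt m i
      light = dne λ ≢ → true≢false (trans (sym γj) (trans (count⇒γ m j x (sym (low x ≢))) γx))
      letters : bit (W (m + x)) ≡ suc (bit (W x))
      letters = +-cancelˡ-≡ (cnt m i) _ _ (begin
        cnt m i + bit (W (m + x))       ≡⟨ cong (_+ bit (W (m + x))) light ⟨
        cnt m x + bit (W (m + x))       ≡⟨ cnt-snoc m x ⟨
        bit (W x) + cnt m (suc x)       ≡⟨ cong (bit (W x) +_) heavy ⟩
        bit (W x) + suc (cnt m i)       ≡⟨ +-comm (bit (W x)) _ ⟩
        suc (cnt m i) + bit (W x)       ≡⟨ +-suc (cnt m i) (bit (W x)) ⟨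
        cnt m i + suc (bit (W x))       ∎)
        where open ≡-Reasoning
      Wx  = proj₂ (bit-suc {W (m + x)} {W x} letters)
      Wmx = proj₁ (bit-suc {W (m + x)} {W x} letters)
      up-at : ∀ y → W y ≡ false → lt y (suc y) ≡ true
      up-at y q = Bool.not-injective q
      down-at : ∀ y → W y ≡ true → lt (suc y) y ≡ true
      down-at y q = γ-false {1} {y} ≤-refl (Bool.not-injective q)
      below : lt (m + x) x ≡ true
      below = γ-false {m} {x} (s≤s z≤n) γx
      above : lt (suc x) (suc (m + x)) ≡ true
      above = subst (λ z → lt (suc x) z ≡ true) (+-suc m x) γx′

  not-both : ∀ m m′ → 1 ≤ m → 1 ≤ m′ → (∀ i → γ m i ≡ true) → (∀ i → γ m′ i ≡ false) → ⊥
  not-both m m′ 1≤m 1≤m′ ups downs = case trans (sym (chain true m 0 (λ _ → ups _) 1≤m m′ 1≤m′))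
    (trans (cong (λ n → γ n 0) (*-comm m′ m)) (chain false m′ 0 (λ _ → downs _) 1≤m′ m 1≤m)) of λ ()

  strict-blocks-≥ : ∀ M K → (∀ x → K ≤ cnt M x) → ∀ L i j → j < L → cnt M (j * M + i) ≢ K → L * K < cnt (L * M) i
  strict-blocks-≥ M K low (suc L) i zero    _ ≢ = subst (suc L * K <_) (sym (cnt-+ M (L * M) i))
    (+-mono-<-≤ (≤∧≢⇒< (low i) (≢ ∘ sym)) (cnt-blocks-≥ M K L (M + i) λ _ _ → low _))
  strict-blocks-≥ M K low (suc L) i (suc j) j<L ≢ = subst (suc L * K <_) (sym (cnt-+ M (L * M) i))
    (+-mono-≤-< (low i) (strict-blocks-≥ M K low L (M + i) j (s≤s⁻¹ j<L)
      (≢ ∘ trans (cong (cnt M) (lem M (j * M) i)))))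
    where
    lem : ∀ M x i → M + x + i ≡ x + (M + i)
    lem = solve-∀

  strict-blocks-≤ : ∀ M K → (∀ x → cnt M x ≤ K) → ∀ L i j → j < L → cnt M (j * M + i) ≢ K → cnt (L * M) i < L * K
  strict-blocks-≤ M K up (suc L) i zero    _ ≢ = subst (_< suc L * K) (sym (cnt-+ M (L * M) i))
    (+-mono-<-≤ (≤∧≢⇒< (up i) ≢) (cnt-blocks-≤ M K L (M + i) λ _ _ → up _))
  strict-blocks-≤ M K up (suc L) i (suc j) j<L ≢ = subst (_< suc L * K) (sym (cnt-+ M (L * M) i))
    (+-mono-≤-< (up i) (strict-blocks-≤ M K up L (M + i) j (s≤s⁻¹ j<L)
      (≢ ∘ trans (cong (cnt M) (lem M (j * M) i)))))
    where
    lem : ∀ M x i → M + x + i ≡ x + (M + i)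
    lem = solve-∀

  Goes : Bool → ℕ → ℕ → Set
  Goes b m o = ∃[ i ] cnt m i ≡ o × γ m i ≡ b

  -- At a common starting position the shorter of the two blocks can be cut off the longer one.
  separation : ∀ n m m′ o o′ → m + m′ < n → 1 ≤ m → 1 ≤ m′ → Goes true m o → Goes false m′ o′ → o * m′ < o′ * m
  separation (suc n) m m′ o o′ fuel 1≤m 1≤m′ (i , ci , γi) (j , cj , γj) = ≰⇒> contra
    where
    common : ∀ x → cnt m x ≡ o → γ m x ≡ true → cnt m′ x ≡ o′ → γ m′ x ≡ false → o′ * m ≤ o * m′ → ⊥
    common x c γx c′ γx′ le with <-cmp m m′
    ... | tri≈ _ refl _ = case trans (sym γx) γx′ of λ ()
    ... | tri< m<m′ _ _ = case split-< m<m′ of λ where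
        (l , refl) → <⇒≱ (separation n m (suc l) o (cnt (suc l) (m + x))
              (<-≤-trans (+-monoʳ-< m (m<n+m (suc l) 1≤m)) (s≤s⁻¹ fuel)) 1≤m (s≤s z≤n) (x , c , γx)
              (m + x , refl , Bool.¬-not λ q → case trans (sym γx′) (trans (cong (lt x) (lem m l x)) (lt-trans γx q)) of λ ()))
            (+-cancelˡ-≤ (o * m) _ _ (subst₂ _≤_
              (trans (cong (_* m) (trans (sym c′) (trans (cnt-+ m (suc l) x) (cong (_+ cnt (suc l) (m + x)) c)))) (*-distribʳ-+ m o (cnt (suc l) (m + x))))
              (*-distribˡ-+ o m (suc l)) le))
      where
      lem : ∀ m l x → m + suc l + x ≡ suc l + (m + x)
      lem = solve-∀
    common x c γx c′ γx′ le | tri> _ _ m′<m = case split-< m′<m of λ where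
        (l , refl) → <⇒≱ (separation n (suc l) m′ (cnt (suc l) (m′ + x)) o′
              (<-≤-trans (subst (suc l + m′ <_) (cong (_+ m′) (+-comm (suc l) m′)) (+-monoˡ-< m′ (m<m+n (suc l) 1≤m′)))
                (s≤s⁻¹ fuel)) (s≤s z≤n) 1≤m′
              (m′ + x , refl , lt-trans (γ-false {m′} {x} 1≤m′ γx′) (trans (cong (lt x) (sym (lem m′ l x))) γx)) (x , c′ , γx′))
            (+-cancelˡ-≤ (o′ * m′) _ _ (subst₂ _≤_ (*-distribˡ-+ o′ m′ (suc l))
              (trans (cong (_* m′) (trans (sym c) (trans (cnt-+ m′ (suc l) x) (cong (_+ cnt (suc l) (m′ + x)) c′)))) (*-distribʳ-+ m′ o′ (cnt (suc l) (m′ + x)))) le))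
      where
      lem : ∀ m l x → m + suc l + x ≡ suc l + (m + x)
      lem = solve-∀
    -- Here `o` is the smaller count over `m` letters and `o′` the larger one over `m′`, so counting
    -- `m * m′` letters in both ways gives the inequality directly.
    far : suc o ≡ cnt m j → o′ ≡ suc (cnt m′ i) → o′ * m ≤ o * m′ → ⊥
    far p q le = <⇒≱ (<-≤-trans many (≤-trans few′ (≤-reflexive (*-comm m o′)))) (subst (o′ * m ≤_) (*-comm o m′) le)
      where
      low : ∀ x → o ≤ cnt m x
      low x = s≤s⁻¹ (≤-trans (≤-reflexive p) (W-balanced m j x))
      many : m′ * o < cnt (m′ * m) j
      many = strict-blocks-≥ m o low m′ j 0 1≤m′ (λ e → 1+n≢n (trans p e))
      few′ : cnt (m′ * m) j ≤ m * o′
      few′ = subst (λ k → cnt k j ≤ m * o′) (*-comm m m′)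
        (cnt-blocks-≤ m′ o′ m j λ _ _ → ≤-trans (W-balanced m′ _ i) (≤-reflexive (sym q)))
    -- Here the heavier `m`-block rises and the lighter `m′`-block falls. Without inversions both
    -- kinds of `m`-blocks rise and both kinds of `m′`-blocks fall, which `not-both` excludes.
    crossed : o ≡ suc (cnt m j) → suc o′ ≡ cnt m′ i → ⊥
    crossed p q = not-both m m′ 1≤m 1≤m′ (two m i j (trans ci p) γi up-j) (two m′ i j (trans (sym q) (cong suc (sym cj))) down-i γj)
      where
      up-j : γ m j ≡ true
      up-j = Bool.¬-not λ γj → no-inversion m j i γj γi (trans ci p)
      down-i : γ m′ i ≡ false
      down-i = Bool.¬-not λ γi → no-inversion m′ j i γj γi (trans (sym q) (cong suc (sym cj)))
      two : ∀ m i j {b} → cnt m i ≡ suc (cnt m j) → γ m i ≡ b → γ m j ≡ b → ∀ x → γ m x ≡ b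
      two m i j e γi γj x with cnt m x ≟ cnt m j
      ... | yes q = trans (count⇒γ m x j q) γj
      ... | no ≢  = trans (count⇒γ m x i (≤-antisym (≤-trans (W-balanced m x j) (≤-reflexive (sym e)))
              (≤-trans (≤-reflexive e) (≤∧≢⇒< (s≤s⁻¹ (≤-trans (≤-reflexive (sym e)) (W-balanced m i x))) (≢ ∘ sym))))) γi
    contra : o′ * m ≤ o * m′ → ⊥
    contra le with <-cmp (cnt m j) o | <-cmp (cnt m′ i) o′
    ... | tri≈ _ c _ | _ = common j c (trans (count⇒γ m j i (trans c (sym ci))) γi) cj γj le
    ... | _ | tri≈ _ c _ = common i ci γi c (trans (count⇒γ m′ i j (trans c (sym cj))) γj) le
    ... | tri< a _ _ | tri< b _ _ = 1≰0 (lin 4 (λ a b o o′ → (a ≺ o) ⇒ (b ≺ o′) ⇒ (o ⊕ o′ ≼ con 1 ⊕ (a ⊕ b)) ⇒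
            (⊢ (con 1 ≼ con 0))) refl (cnt m j) (cnt m′ i) o o′ a b
            (subst₂ (λ x y → x + y ≤ suc (cnt m j + cnt m′ i)) ci cj (balanced₂ m m′ i j)))
    ... | tri> _ _ a | tri> _ _ b = 1≰0 (lin 4 (λ a b o o′ → (o ≺ a) ⇒ (o′ ≺ b) ⇒ (a ⊕ b ≼ con 1 ⊕ (o ⊕ o′)) ⇒
            (⊢ (con 1 ≼ con 0))) refl (cnt m j) (cnt m′ i) o o′ a b
            (subst₂ (λ x y → cnt m j + cnt m′ i ≤ suc (x + y)) ci cj (balanced₂ m m′ j i)))
    ... | tri> _ _ a | tri< b _ _ = far (≤-antisym a (≤-trans (W-balanced m j i) (s≤s (≤-reflexive ci))))
            (≤-antisym (≤-trans (≤-reflexive (sym cj)) (W-balanced m′ j i)) b) le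
    ... | tri< a _ _ | tri> _ _ b = crossed (≤-antisym (≤-trans (≤-reflexive (sym ci)) (W-balanced m i j)) a)
            (≤-antisym b (≤-trans (W-balanced m′ i j) (s≤s (≤-reflexive cj))))

  -- The slope o / m is not a limit of other slopes, uniformly: a difference of slopes
  -- X / (m m′) forces m′ ≤ D X.
  gap : ∀ m o → 1 ≤ m → ∃[ D ] (∀ m′ i X → 1 ≤ X →
          o * m′ + X ≡ cnt m′ i * m ⊎ cnt m′ i * m + X ≡ o * m′ → m′ ≤ D * X)
  gap m o 1≤m = case em {∃[ L ] (∀ i → ∃[ j ] j < L × cnt m (j * m + i) ≢ o)} of λ where
      (yes (L , often)) → L + L * m , bound L often
      (no none) → ⊥-elim (constant-counts m o 1≤m λ L → dne λ ¬ex → none (L , λ i → dne λ ¬hit →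
        ¬ex (i , λ j j<L → dne λ ≢ → ¬hit (j , j<L , ≢))))
    where
    module _ (L : ℕ) (often : ∀ i → ∃[ j ] j < L × cnt m (j * m + i) ≢ o) where
      B = L * m
      -- Counts `B * m′` letters in two ways: every `B`-block deviates from `L * o` by at least one,
      -- always to the same side, while every `m′`-block deviates from `cnt m′ i` by at most one.
      weigh : ∀ m′ i → (m′ + L * (o * m′) ≤ L * (cnt m′ i * m) + B) ⊎ (L * (cnt m′ i * m) + m′ ≤ L * (o * m′) + B)
      weigh m′ i with one-sided m o
      ... | inj₁ low = inj₁ (subst₂ _≤_ (lem₁ m′ L o) (lem₂ L m (cnt m′ i)) (≤-trans
              (cnt-blocks-≥ B (suc (L * o)) m′ i λ l _ →
                let j , j<L , ≢ = often (l * B + i) in strict-blocks-≥ m o low L _ j j<L ≢)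
              (subst (λ k → cnt k i ≤ B * suc (cnt m′ i)) (*-comm B m′)
                (cnt-blocks-≤ m′ (suc (cnt m′ i)) B i λ _ _ → W-balanced m′ _ i))))
        where
        lem₁ : ∀ m L o → m * suc (L * o) ≡ m + L * (o * m)
        lem₁ = solve-∀
        lem₂ : ∀ L m c → L * m * suc c ≡ L * (c * m) + L * m
        lem₂ = solve-∀
      ... | inj₂ up = inj₂ (begin
          L * (cnt m′ i * m) + m′          ≡⟨ cong (_+ m′) (lem₁ L (cnt m′ i) m) ⟩
          B * cnt m′ i + m′                ≤⟨ +-monoˡ-≤ m′ (*-monoʳ-≤ B (suc-pred-≤ (cnt m′ i))) ⟩
          B * suc (pred (cnt m′ i)) + m′   ≡⟨ lem₂ B (pred (cnt m′ i)) m′ ⟩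
          (B * pred (cnt m′ i) + m′) + B   ≤⟨ +-monoˡ-≤ B (+-monoˡ-≤ m′ (≤-trans
            (cnt-blocks-≥ m′ (pred (cnt m′ i)) B i λ l _ → pred-mono-≤ (W-balanced m′ i (l * m′ + i)))
            (subst (λ k → cnt k i ≤ m′ * pred (L * o)) (*-comm m′ B)
              (cnt-blocks-≤ B (pred (L * o)) m′ i λ l _ → let j , j<L , ≢ = often (l * B + i) in
                <⇒≤pred (strict-blocks-≤ m o up L _ j j<L ≢))))) ⟩
          (m′ * pred (L * o) + m′) + B     ≡⟨ cong (_+ B) (lem₃ m′ (pred (L * o))) ⟩
          m′ * suc (pred (L * o)) + B      ≡⟨ cong (λ k → m′ * k + B) (suc-pred (L * o) {{>-nonZero L*o>0}}) ⟩
          m′ * (L * o) + B                 ≡⟨ cong (_+ B) (lem₄ m′ L o) ⟩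
          L * (o * m′) + B                 ∎)
        where
        open ≤-Reasoning
        L*o>0 : 0 < L * o
        L*o>0 = let j , j<L , ≢ = often i in ≤-trans (s≤s z≤n) (strict-blocks-≤ m o up L i j j<L ≢)
        suc-pred-≤ : ∀ n → n ≤ suc (pred n)
        suc-pred-≤ zero    = z≤n
        suc-pred-≤ (suc n) = ≤-refl
        lem₁ : ∀ L c m → L * (c * m) ≡ L * m * c
        lem₁ = solve-∀
        lem₂ : ∀ B c m → B * suc c + m ≡ (B * c + m) + B
        lem₂ = solve-∀
        lem₃ : ∀ m k → m * k + m ≡ m * suc k
        lem₃ = solve-∀
        lem₄ : ∀ m L o → m * (L * o) ≡ L * (o * m)
        lem₄ = solve-∀
      bound : ∀ m′ i X → 1 ≤ X → o * m′ + X ≡ cnt m′ i * m ⊎ cnt m′ i * m + X ≡ o * m′ → m′ ≤ (L + B) * X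
      bound m′ i X 1≤X e = ≤-trans (short e) (subst (L * X + B ≤_) (sym (*-distribʳ-+ X L B))
          (+-monoʳ-≤ (L * X) (subst (_≤ B * X) (*-identityʳ B) (*-monoʳ-≤ B 1≤X))))
        where
        c = cnt m′ i * m
        d = o * m′
        short : o * m′ + X ≡ cnt m′ i * m ⊎ cnt m′ i * m + X ≡ o * m′ → m′ ≤ L * X + B
        short e with e | weigh m′ i
        ... | inj₁ q | inj₁ le = lin 5 (λ m′ Ld Lc B LX → (m′ ⊕ Ld ≼ Lc ⊕ B) ⇒ (Ld ⊕ LX ≈ᵉ Lc) ⇒ (⊢ (m′ ≼ LX ⊕ B))) refl
              m′ (L * d) (L * c) B (L * X) le (trans (sym (*-distribˡ-+ L d X)) (cong (L *_) q))
        ... | inj₁ q | inj₂ le = lin 5 (λ m′ Ld Lc B LX → (Lc ⊕ m′ ≼ Ld ⊕ B) ⇒ (Ld ⊕ LX ≈ᵉ Lc) ⇒ (⊢ (m′ ≼ LX ⊕ B))) refl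
              m′ (L * d) (L * c) B (L * X) le (trans (sym (*-distribˡ-+ L d X)) (cong (L *_) q))
        ... | inj₂ q | inj₁ le = lin 5 (λ m′ Ld Lc B LX → (m′ ⊕ Ld ≼ Lc ⊕ B) ⇒ (Lc ⊕ LX ≈ᵉ Ld) ⇒ (⊢ (m′ ≼ LX ⊕ B))) refl
              m′ (L * d) (L * c) B (L * X) le (trans (sym (*-distribˡ-+ L c X)) (cong (L *_) q))
        ... | inj₂ q | inj₂ le = lin 5 (λ m′ Ld Lc B LX → (Lc ⊕ m′ ≼ Ld ⊕ B) ⇒ (Lc ⊕ LX ≈ᵉ Ld) ⇒ (⊢ (m′ ≼ LX ⊕ B))) refl
              m′ (L * d) (L * c) B (L * X) le (trans (sym (*-distribˡ-+ L c X)) (cong (L *_) q))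

-- Count vectors of a balanced word

-- In a balanced word the count vectors (cnt a i) for a in a window, normalised at one element,
-- form a chain in which each of the other coordinates takes two values.
module Chains (em : ExcludedMiddle 0ℓ) (w : ℕ → Bool) (¬up : ¬ UP w) (bal : Word.Balanced w) where
  open Classical em
  open Word w
  open Balance.Balanced em w ¬up bal using (balanced₂)

  record SameCounts (x : ℕ) (L : List ℕ) (i j : ℕ) : Set where
    constructor counts
    field eq : ∀ a → a ∈ L → cnt a i + cnt x j ≡ cnt a j + cnt x i

  module _ (x : ℕ) where

    -- Whether the coordinate `a` of the normalised vector of `i` is the upper one of its two
    -- values.
    high : ℕ → ℕ → Bool
    high i a with em {∃[ j ] cnt a j + cnt x i < cnt a i + cnt x j}
    ... | yes _ = true
    ... | no _  = false

    high-true : ∀ i a → (∃[ j ] cnt a j + cnt x i < cnt a i + cnt x j) → high i a ≡ true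
    high-true i a ex with em {∃[ j ] cnt a j + cnt x i < cnt a i + cnt x j}
    ... | yes _ = refl
    ... | no ne = contradiction ex ne

    high-from : ∀ i a → high i a ≡ true → ∃[ j ] cnt a j + cnt x i < cnt a i + cnt x j
    high-from i a q with em {∃[ j ] cnt a j + cnt x i < cnt a i + cnt x j}
    ... | yes ex = ex
    high-from i a () | no _

    rank : List ℕ → ℕ → ℕ
    rank []      i = 0
    rank (a ∷ L) i = bit (high i a) + rank L i

    rank-≤ : ∀ L i → rank L i ≤ length L
    rank-≤ []      i = z≤n
    rank-≤ (a ∷ L) i = +-mono-≤ (bit≤1 (high i a)) (rank-≤ L i)

    bit-mono : ∀ {a b} → (a ≡ true → b ≡ true) → bit a ≤ bit b
    bit-mono {true}  h = ≤-reflexive (cong bit (sym (h refl)))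
    bit-mono {false} h = z≤n

    module _ {i j b : ℕ} (i>j : cnt b j + cnt x i < cnt b i + cnt x j) where

      high-mono : ∀ a → high j a ≡ true → high i a ≡ true
      high-mono a q = case high-from j a q of λ where
          (r , lt) → high-true i a (r , lin 6 (λ ai aj ar xi xj xr → (ar ⊕ xj ≺ aj ⊕ xr) ⇒ (aj ⊕ xi ≼ ai ⊕ xj) ⇒
            (⊢ (ar ⊕ xi ≺ ai ⊕ xr))) refl (cnt a i) (cnt a j) (cnt a r) (cnt x i) (cnt x j) (cnt x r) lt above)
        where
        above : cnt a j + cnt x i ≤ cnt a i + cnt x j
        above = lin 6 (λ ai aj bi bj xi xj → (bj ⊕ xi ≺ bi ⊕ xj) ⇒ (aj ⊕ bi ≼ con 1 ⊕ (ai ⊕ bj)) ⇒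
            (⊢ (aj ⊕ xi ≼ ai ⊕ xj))) refl (cnt a i) (cnt a j) (cnt b i) (cnt b j) (cnt x i) (cnt x j)
          i>j (balanced₂ a b j i)

      rank-mono : ∀ L → rank L j ≤ rank L i
      rank-mono []      = z≤n
      rank-mono (a ∷ L) = +-mono-≤ (bit-mono (high-mono a)) (rank-mono L)

      rank-strict : ∀ L → b ∈ L → rank L j < rank L i
      rank-strict (.b ∷ L) (here refl) = subst₂ (λ p q → bit p + rank L j < bit q + rank L i)
          (sym low) (sym (high-true i b (j , i>j))) (s≤s (rank-mono L))
        where
        low : high j b ≡ false
        low = Bool.¬-not λ q → case high-from j b q of λ where
          (r , lt) → 1≰0 (lin 6 (λ bi bj br xi xj xr → (bj ⊕ xi ≺ bi ⊕ xj) ⇒ (br ⊕ xj ≺ bj ⊕ xr) ⇒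
              (bi ⊕ xr ≼ con 1 ⊕ (br ⊕ xi)) ⇒ (⊢ (con 1 ≼ con 0))) refl
            (cnt b i) (cnt b j) (cnt b r) (cnt x i) (cnt x j) (cnt x r) i>j lt (balanced₂ b x i r))
      rank-strict (a ∷ L) (there b∈) = +-mono-≤-< (bit-mono (high-mono a)) (rank-strict L b∈)

    -- The rank is the position in the chain: vectors that differ in some coordinate have different
    -- ranks, and ranks range over `0` to `length L`.
    few-counts : ∀ L → ¬ AtLeast (SameCounts x L) (2 + length L)
    few-counts L = finite-code (λ i → fromℕ< (s≤s (rank-≤ L i))) λ i j q → counts λ a a∈ →
      let same-rank : rank L i ≡ rank L j
          same-rank = trans (sym (Fin.toℕ-fromℕ< (s≤s (rank-≤ L i)))) (trans (cong toℕ q) (Fin.toℕ-fromℕ< (s≤s (rank-≤ L j))))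
      in ≤-antisym (≮⇒≥ λ gt → <⇒≢ (rank-strict {i} {j} {a} gt L a∈) (sym same-rank))
                   (≮⇒≥ λ lt → <⇒≢ (rank-strict {j} {i} {a} lt L a∈) same-rank)

  few-patterns : (O : Order) → (∀ m i j → cnt m i ≡ cnt m j → Patterns.γ O m i ≡ Patterns.γ O m j) → FewPatterns O
  few-patterns O det x L al = few-counts x L (atLeast-antitone {R = Pat (x ∷ L)} {R′ = SameCounts x L} same-pat al)
    where
    open Patterns O
    diff : ∀ {i j} a m → cnt a i + cnt x j ≡ cnt a j + cnt x i →
           cnt (a + m) i + cnt x j ≡ cnt (a + m) j + cnt x i → γ m (a + i) ≡ γ m (a + j)
    diff {i} {j} a m p q = det m _ _ (lin 8 (λ ai aj xi xj mi mj si sj → (si ≈ᵉ ai ⊕ mi) ⇒ (sj ≈ᵉ aj ⊕ mj) ⇒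
        (ai ⊕ xj ≈ᵉ aj ⊕ xi) ⇒ (si ⊕ xj ≈ᵉ sj ⊕ xi) ⇒ (⊢ (mi ≈ᵉ mj))) refl
      (cnt a i) (cnt a j) (cnt x i) (cnt x j) (cnt m (a + i)) (cnt m (a + j)) (cnt (a + m) i) (cnt (a + m) j)
      (cnt-+ a m i) (cnt-+ a m j) p q)
    same-pat : ∀ i j → SameCounts x L i j → Pat (x ∷ L) i j
    same-pat i j (counts eq) = pat cmp
      where
      eq′ : ∀ a → a ∈ x ∷ L → cnt a i + cnt x j ≡ cnt a j + cnt x i
      eq′ a (here refl) = +-comm (cnt a i) (cnt a j)
      eq′ a (there a∈)  = eq a a∈
      up : ∀ a m → a ∈ x ∷ L → a + suc m ∈ x ∷ L → lt (a + i) (a + suc m + i) ≡ lt (a + j) (a + suc m + j)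
      up a m a∈ b∈ = subst₂ _≡_ (cong (lt (a + i)) (lem a m i)) (cong (lt (a + j)) (lem a m j))
          (diff a (suc m) (eq′ a a∈) (eq′ _ b∈))
        where
        lem : ∀ a m i → suc m + (a + i) ≡ a + suc m + i
        lem = solve-∀
      cmp : ∀ a b → a ∈ x ∷ L → b ∈ x ∷ L → lt (a + i) (b + i) ≡ lt (a + j) (b + j)
      cmp a b a∈ b∈ with <-cmp a b
      ... | tri≈ _ refl _ = trans (lt-irrefl _) (sym (lt-irrefl _))
      ... | tri< a<b _ _ with split-< a<b
      ...   | l , refl = up a l a∈ b∈
      cmp a b a∈ b∈ | tri> _ _ b<a with split-< b<a
      ...   | l , refl = trans (lt-total (ne i)) (trans (cong not (up b l b∈ a∈)) (sym (lt-total (ne j))))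
        where
        ne : ∀ i → b + suc l + i ≢ b + i
        ne i q = <⇒≢ b<a (sym (+-cancelʳ-≡ i _ _ q))

-- Rational sequences

ι : ℕ → ℚ
ι zero    = 0ℚ
ι (suc n) = 1ℚ ℚ.+ ι n

ι-+ : ∀ m n → ι (m + n) ≡ ι m ℚ.+ ι n
ι-+ zero    n = sym (ℚ.+-identityˡ (ι n))
ι-+ (suc m) n = trans (cong (1ℚ ℚ.+_) (ι-+ m n)) (sym (ℚ.+-assoc 1ℚ (ι m) (ι n)))

ι-* : ∀ m n → ι (m * n) ≡ ι m ℚ.* ι n
ι-* zero    n = sym (ℚ.*-zeroˡ (ι n))
ι-* (suc m) n = trans (ι-+ n (m * n)) (trans (cong (ι n ℚ.+_) (ι-* m n))
  (solve 2 (λ a b → a :+ b :* a := (con 1ℚ :+ b) :* a) refl (ι n) (ι m)))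
  where open +-*-Solver

0≤1 : 0ℚ ℚ.≤ 1ℚ
0≤1 = ℚ.nonNegative⁻¹ 1ℚ

0≤ι : ∀ n → 0ℚ ℚ.≤ ι n
0≤ι zero    = ℚ.≤-refl
0≤ι (suc n) = ℚ.+-mono-≤ 0≤1 (0≤ι n)

ι-mono : ∀ {m n} → m ≤ n → ι m ℚ.≤ ι n
ι-mono {n = n} z≤n = 0≤ι n
ι-mono (s≤s m≤n)   = ℚ.+-monoʳ-≤ 1ℚ (ι-mono m≤n)

0<ι : ∀ k → 0ℚ ℚ.< ι (suc k)
0<ι k = ℚ.<-≤-trans (ℚ.positive⁻¹ 1ℚ) (subst (ℚ._≤ ι (suc k)) (ℚ.+-identityʳ 1ℚ) (ℚ.+-monoʳ-≤ 1ℚ (0≤ι k)))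

ι-positive : ∀ k → ℚ.Positive (ι (suc k))
ι-positive k = ℚ.positive (0<ι k)

ι-inverse : ℕ → ℚ
ι-inverse k = (ℚ.1/ ι (suc k)) {{ℚ.pos⇒nonZero (ι (suc k)) {{ι-positive k}}}}

ι-*-inverse : ∀ k → ι (suc k) ℚ.* ι-inverse k ≡ 1ℚ
ι-*-inverse k = ℚ.*-inverseʳ (ι (suc k)) {{ℚ.pos⇒nonZero (ι (suc k)) {{ι-positive k}}}}

-- The fraction `c / (k + 1)`; block lengths enter through their predecessors, which keeps
-- denominators nonzero.
ratio : ℕ → ℕ → ℚ
ratio c k = ι c ℚ.* ι-inverse k

*-ratio : ∀ c k → ι (suc k) ℚ.* ratio c k ≡ ι c
*-ratio c k = begin
  ι (suc k) ℚ.* (ι c ℚ.* ι-inverse k)   ≡⟨ lem (ι (suc k)) (ι c) (ι-inverse k) ⟩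
  ι c ℚ.* (ι (suc k) ℚ.* ι-inverse k)   ≡⟨ cong (ι c ℚ.*_) (ι-*-inverse k) ⟩
  ι c ℚ.* 1ℚ                            ≡⟨ ℚ.*-identityʳ (ι c) ⟩
  ι c                                   ∎
  where
  open ≡-Reasoning
  lem : ∀ a b c → a ℚ.* (b ℚ.* c) ≡ b ℚ.* (a ℚ.* c)
  lem = solve 3 (λ a b c → a :* (b :* c) := b :* (a :* c)) refl
    where open +-*-Solver

ratio-≤1 : ∀ {c k} → c ≤ suc k → ratio c k ℚ.≤ 1ℚ
ratio-≤1 {c} {k} c≤ = ℚ.*-cancelˡ-≤-pos (ι (suc k)) {{ι-positive k}}
  (subst₂ ℚ._≤_ (sym (*-ratio c k)) (sym (ℚ.*-identityʳ (ι (suc k)))) (ι-mono c≤))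

maxUpTo : (ℕ → ℚ) → ℕ → ℚ
maxUpTo f zero    = f 0
maxUpTo f (suc n) = maxUpTo f n ℚ.⊔ f (suc n)

maxUpTo-mono : ∀ f {m n} → m ≤ n → maxUpTo f m ℚ.≤ maxUpTo f n
maxUpTo-mono f {n = zero}  z≤n = ℚ.≤-refl
maxUpTo-mono f {m} {suc n} m≤  with m≤n⇒m<n∨m≡n m≤
... | inj₂ refl = ℚ.≤-refl
... | inj₁ m<   = ℚ.≤-trans (maxUpTo-mono f (s≤s⁻¹ m<)) (ℚ.p≤p⊔q _ _)

≤-maxUpTo : ∀ f {k n} → k ≤ n → f k ℚ.≤ maxUpTo f n
≤-maxUpTo f {zero}  k≤n = maxUpTo-mono f k≤n
≤-maxUpTo f {suc k} k≤n = ℚ.≤-trans (ℚ.p≤q⊔p (maxUpTo f k) (f (suc k))) (maxUpTo-mono f k≤n)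

maxUpTo-attained : ∀ f n → ∃[ k ] maxUpTo f n ≡ f k
maxUpTo-attained f zero    = 0 , refl
maxUpTo-attained f (suc n) with ℚ.⊔-sel (maxUpTo f n) (f (suc n))
... | inj₁ q = let k , e = maxUpTo-attained f n in k , trans q e
... | inj₂ q = suc n , q

toℚᵘ-ι : ∀ n → toℚᵘ (ι n) ℚᵘ.≃ mkℚᵘ (ℤ.+ n) 0
toℚᵘ-ι zero    = ℚᵘ.≃-refl
toℚᵘ-ι (suc n) = ℚᵘ.≃-trans (ℚ.toℚᵘ-homo-+ 1ℚ (ι n))
  (ℚᵘ.≃-trans (ℚᵘ.+-congʳ (toℚᵘ 1ℚ) (toℚᵘ-ι n))
    (*≡* (cong (λ z → (ℤ.+ 1 ℤ.+ z) ℤ.* ℤ.+ 1) (ℤ.*-identityʳ (ℤ.+ n)))))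

archimedean : ∀ ε → 0ℚ ℚ.< ε → ∃[ k ] 1ℚ ℚ.< ι k ℚ.* ε
archimedean ε@(mkℚ (ℤ.+ zero) d _) 0<ε = contradiction (ℚ.positive {ε} 0<ε) λ ()
archimedean ε@(mkℚ ℤ.-[1+ _ ] d _) 0<ε = contradiction (ℚ.positive {ε} 0<ε) λ ()
archimedean ε@(mkℚ ℤ.+[1+ a ] d _) 0<ε = k , ℚ.toℚᵘ-cancel-< (ℚᵘ.<-respʳ-≃
    (ℚᵘ.≃-sym (ℚᵘ.≃-trans (ℚ.toℚᵘ-homo-* (ι k) ε) (ℚᵘ.*-congʳ {toℚᵘ ε} (toℚᵘ-ι k))))
    (*<* (subst₂ ℤ._<_ (ℤ.pos-* 1 (1 * suc d)) (trans (ℤ.pos-* (k * suc a) 1) (cong (ℤ._* ℤ.+ 1) (ℤ.pos-* k (suc a))))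
      (ℤ.+<+ below))))
  where
  -- `ε` is at least `1 / (d + 1)`.
  k = 2 + d
  below : 1 * (1 * suc d) < k * suc a * 1
  below = subst₂ _<_ (sym (trans (*-identityˡ _) (*-identityˡ (suc d)))) (sym (*-identityʳ (k * suc a)))
    (≤-trans (≤-reflexive (sym (*-identityʳ k))) (*-monoʳ-≤ k (s≤s z≤n)))

module MonotoneSequences (em : ExcludedMiddle 0ℓ) where
  open Classical em

  -- Otherwise a jump of at least `ε` follows every index, and sufficiently many jumps exceed the
  -- bound 1.
  monotone-cauchy : ∀ f → (∀ {m n} → m ≤ n → f m ℚ.≤ f n) → (∀ n → 0ℚ ℚ.≤ f n) → (∀ n → f n ℚ.≤ 1ℚ) → IsCauchy f
  monotone-cauchy f mono 0≤f f≤1 ε 0<ε = case em {∃[ N ] (∀ n → N ≤ n → f n ℚ.< f N ℚ.+ ε)} of λ where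
      (yes (N , near)) → N , λ m n N≤m N≤n → close (f m) (f n) (f N) (mono N≤m) (mono N≤n) (near m N≤m) (near n N≤n)
      (no jumps) → case archimedean ε 0<ε of λ where
        (k , big) → case climb (jump jumps) k of λ where
          (n , le) → contradiction (ℚ.<-≤-trans big (ℚ.≤-trans le (f≤1 n))) (ℚ.<-irrefl refl)
    where
    jump : ¬ (∃[ N ] (∀ n → N ≤ n → f n ℚ.< f N ℚ.+ ε)) → ∀ N → ∃[ n ] f N ℚ.+ ε ℚ.≤ f n
    jump none N = dne λ ¬ex → none (N , λ n _ → ℚ.≰⇒> λ le → ¬ex (n , le))
    climb : (∀ N → ∃[ n ] f N ℚ.+ ε ℚ.≤ f n) → ∀ k → ∃[ n ] ι k ℚ.* ε ℚ.≤ f n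
    climb j zero    = 0 , subst (ℚ._≤ f 0) (sym (ℚ.*-zeroˡ ε)) (0≤f 0)
    climb j (suc k) = case climb j k of λ where
        (n , le) → case j n of λ where
          (n′ , le′) → n′ , ℚ.≤-trans (subst (ℚ._≤ f n ℚ.+ ε) (lem (ι k) ε) (ℚ.+-monoˡ-≤ ε le)) le′
      where
      lem : ∀ a e → a ℚ.* e ℚ.+ e ≡ (1ℚ ℚ.+ a) ℚ.* e
      lem = solve 2 (λ a e → a :* e :+ e := (con 1ℚ :+ a) :* e) refl
        where open +-*-Solver
    close : ∀ x y c → c ℚ.≤ x → c ℚ.≤ y → x ℚ.< c ℚ.+ ε → y ℚ.< c ℚ.+ ε → ℚ.∣ x ℚ.- y ∣ ℚ.< ε
    close x y c c≤x c≤y x< y< with ℚ.∣p∣≡p∨∣p∣≡-p (x ℚ.- y)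
    ... | inj₁ q = subst (ℚ._< ε) (sym q) (subst₂ ℚ._<_ (lem₁ x y) (lem₂ c ε)
            (ℚ.+-mono-<-≤ x< (ℚ.neg-antimono-≤ c≤y)) )
      where
      lem₁ : ∀ x y → x ℚ.+ ℚ.- y ≡ x ℚ.- y
      lem₁ x y = refl
      lem₂ : ∀ c e → c ℚ.+ e ℚ.+ ℚ.- c ≡ e
      lem₂ = solve 2 (λ c e → c :+ e :+ :- c := e) refl
        where open +-*-Solver
    ... | inj₂ q = subst (ℚ._< ε) (sym q) (subst₂ ℚ._<_ (lem₁ x y) (lem₂ c ε)
            (ℚ.+-mono-<-≤ y< (ℚ.neg-antimono-≤ c≤x)))
      where
      open +-*-Solver
      lem₁ : ∀ x y → y ℚ.+ ℚ.- x ≡ ℚ.- (x ℚ.- y)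
      lem₁ = solve 2 (λ x y → y :+ :- x := :- (x :- y)) refl
      lem₂ : ∀ c e → c ℚ.+ e ℚ.+ ℚ.- c ≡ e
      lem₂ = solve 2 (λ c e → c :+ e :+ :- c := e) refl

-- Real numbers and walks

p<p+ε : ∀ p {ε} → 0ℚ ℚ.< ε → p ℚ.< p ℚ.+ ε
p<p+ε p {ε} 0<ε = subst (ℚ._< p ℚ.+ ε) (ℚ.+-identityʳ p) (ℚ.+-monoʳ-< p 0<ε)

p≤∣p∣ : ∀ p → p ℚ.≤ ℚ.∣ p ∣
p≤∣p∣ p with ℚ.∣p∣≡p∨∣p∣≡-p p
... | inj₁ q = ℚ.≤-reflexive (sym q)
... | inj₂ q = ℚ.≤-trans (subst (ℚ._≤ 0ℚ) (neg-neg p) (ℚ.neg-antimono-≤ (subst (0ℚ ℚ.≤_) q (ℚ.0≤∣p∣ p)))) (ℚ.0≤∣p∣ p)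
  where
  neg-neg : ∀ p → ℚ.- (ℚ.- p) ≡ p
  neg-neg = solve 1 (λ p → :- (:- p) := p) refl
    where open +-*-Solver

∣p-q∣≡∣q-p∣ : ∀ p q → ℚ.∣ p ℚ.- q ∣ ≡ ℚ.∣ q ℚ.- p ∣
∣p-q∣≡∣q-p∣ p q = trans (sym (ℚ.∣-p∣≡∣p∣ (p ℚ.- q))) (cong ℚ.∣_∣ (lem p q))
  where
  lem : ∀ p q → ℚ.- (p ℚ.- q) ≡ q ℚ.- p
  lem = solve 2 (λ p q → :- (p :- q) := q :- p) refl
    where open +-*-Solver

<ℝ-irrefl : ∀ a → ¬ (a D.< a)
<ℝ-irrefl a (ε , 0<ε , N , h) = ℚ.<-irrefl refl (ℚ.<-trans (p<p+ε (approx a N) 0<ε) (h N ≤-refl))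

<ℝ-trans : ∀ a b c → a D.< b → b D.< c → a D.< c
<ℝ-trans a b c (ε , 0<ε , N , h) (ε′ , 0<ε′ , N′ , h′) = ε , 0<ε , N ⊔ N′ , λ n le →
  ℚ.<-trans (h n (≤-trans (m≤m⊔n N N′) le))
    (ℚ.<-trans (p<p+ε (approx b n) 0<ε′) (h′ n (≤-trans (m≤n⊔m N N′) le)))

<ℝ-≉ : ∀ a b → a D.< b → ¬ (b D.≈ a)
<ℝ-≉ a b (ε , 0<ε , N , h) eq = let N′ , near = eq ε 0<ε
                                    n = N ⊔ N′
                                in ℚ.<-irrefl refl (ℚ.<-trans
  (subst (ℚ._< approx b n ℚ.- approx a n) (lem (approx a n) ε) (ℚ.+-monoˡ-< (ℚ.- approx a n) (h n (m≤m⊔n N N′))))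
  (ℚ.≤-<-trans (p≤∣p∣ _) (near n (m≤n⊔m N N′))))
  where
  lem : ∀ a e → a ℚ.+ e ℚ.+ ℚ.- a ≡ e
  lem = solve 2 (λ a e → a :+ e :+ :- a := e) refl
    where open +-*-Solver

≈ℝ-sym : ∀ a b → a D.≈ b → b D.≈ a
≈ℝ-sym a b eq ε 0<ε = let N , near = eq ε 0<ε in
  N , λ n le → subst (ℚ._< ε) (∣p-q∣≡∣q-p∣ (approx a n) (approx b n)) (near n le)

½-positive : ∀ {ε} → 0ℚ ℚ.< ε → 0ℚ ℚ.< ½ ℚ.* ε
½-positive {ε} 0<ε = subst (ℚ._< ½ ℚ.* ε) (ℚ.*-zeroʳ ½) (ℚ.*-monoʳ-<-pos ½ 0<ε)

module RealOrder (em : ExcludedMiddle 0ℓ) where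
  open Classical em

  -- A distance of `ε` at one late index, with oscillations below `ε / 4` in each sequence, leaves a
  -- gap of `ε / 2` with fixed sign.
  apart⇒< : ∀ a b ε → 0ℚ ℚ.< ε →
    (∃[ N ] ∀ m n → N ≤ m → N ≤ n → ℚ.∣ approx a m ℚ.- approx a n ∣ ℚ.< ½ ℚ.* (½ ℚ.* ε)) →
    (∃[ N ] ∀ m n → N ≤ m → N ≤ n → ℚ.∣ approx b m ℚ.- approx b n ∣ ℚ.< ½ ℚ.* (½ ℚ.* ε)) →
    (∀ N → ∃[ n ] N ≤ n × ε ℚ.≤ ℚ.∣ approx a n ℚ.- approx b n ∣) → a D.< b ⊎ b D.< a
  apart⇒< a b ε 0<ε (Na , ca) (Nb , cb) far = case far (Na ⊔ Nb) of λ where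
      (n , le , big) → case ℚ.∣p∣≡p∨∣p∣≡-p (approx a n ℚ.- approx b n) of λ where
        (inj₁ q) → inj₂ (½ ℚ.* ε , ½-positive 0<ε , Na ⊔ Nb , λ k le′ →
          gap (approx a n) (approx b n) (approx a k) (approx b k) (subst (ε ℚ.≤_) q big)
            (ℚ.≤-<-trans (p≤∣p∣ _) (ca n k (left le) (left le′)))
            (ℚ.≤-<-trans (p≤∣p∣ _) (cb k n (right le′) (right le))))
        (inj₂ q) → inj₁ (½ ℚ.* ε , ½-positive 0<ε , Na ⊔ Nb , λ k le′ →
          gap (approx b n) (approx a n) (approx b k) (approx a k)
            (subst (ε ℚ.≤_) (trans q (flip (approx a n) (approx b n))) big)
            (ℚ.≤-<-trans (p≤∣p∣ _) (cb n k (right le) (right le′)))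
            (ℚ.≤-<-trans (p≤∣p∣ _) (ca k n (left le′) (left le))))
    where
    open +-*-Solver
    left : ∀ {n} → Na ⊔ Nb ≤ n → Na ≤ n
    left = ≤-trans (m≤m⊔n Na Nb)
    right : ∀ {n} → Na ⊔ Nb ≤ n → Nb ≤ n
    right = ≤-trans (m≤n⊔m Na Nb)
    flip : ∀ p q → ℚ.- (p ℚ.- q) ≡ q ℚ.- p
    flip = solve 2 (λ p q → :- (p :- q) := q :- p) refl
    gap : ∀ p q p′ q′ → ε ℚ.≤ p ℚ.- q → p ℚ.- p′ ℚ.< ½ ℚ.* (½ ℚ.* ε) → q′ ℚ.- q ℚ.< ½ ℚ.* (½ ℚ.* ε) →
          q′ ℚ.+ ½ ℚ.* ε ℚ.< p′
    gap p q p′ q′ big np nq = subst₂ ℚ._<_ (lem₁ p q p′ q′ ε) (lem₂ p q p′ ε)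
      (ℚ.+-monoˡ-< (p′ ℚ.- p ℚ.+ q ℚ.- ½ ℚ.* ε) (ℚ.+-mono-<-≤ (ℚ.+-mono-< np nq) big))
      where
      lem₁ : ∀ p q p′ q′ ε → ((p ℚ.- p′) ℚ.+ (q′ ℚ.- q) ℚ.+ ε) ℚ.+ (p′ ℚ.- p ℚ.+ q ℚ.- ½ ℚ.* ε) ≡ q′ ℚ.+ ½ ℚ.* ε
      lem₁ = solve 5 (λ p q p′ q′ ε → ((p :- p′) :+ (q′ :- q) :+ ε) :+ (p′ :- p :+ q :- con ½ :* ε) := q′ :+ con ½ :* ε) refl
      lem₂ : ∀ p q p′ ε → (½ ℚ.* (½ ℚ.* ε) ℚ.+ ½ ℚ.* (½ ℚ.* ε) ℚ.+ (p ℚ.- q)) ℚ.+ (p′ ℚ.- p ℚ.+ q ℚ.- ½ ℚ.* ε) ≡ p′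
      lem₂ = solve 4 (λ p q p′ ε → (con ½ :* (con ½ :* ε) :+ con ½ :* (con ½ :* ε) :+ (p :- q)) :+ (p′ :- p :+ q :- con ½ :* ε) := p′) refl

  <ℝ-total : ∀ a b → ¬ (a D.≈ b) → a D.< b ⊎ b D.< a
  <ℝ-total a b a≉b = case ¬∀⇒∃¬ a≉b of λ where
      (ε , ne) → case em {0ℚ ℚ.< ε} of λ where
        (no ¬p) → contradiction (λ p → contradiction p ¬p) ne
        (yes 0<ε) → apart⇒< a b ε 0<ε
          (cauchy a _ (½-positive (½-positive 0<ε))) (cauchy b _ (½-positive (½-positive 0<ε)))
          λ N → dne λ none → ne λ _ → N , λ n le → ℚ.≰⇒> λ big → none (n , le , big)

isOne : Fin 2 → Bool
isOne 0F = false
isOne 1F = true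

isOne-injective : ∀ a b → isOne a ≡ isOne b → a ≡ b
isOne-injective 0F 0F _ = refl
isOne-injective 1F 1F _ = refl
isOne-injective 0F 1F ()
isOne-injective 1F 0F ()

approx-· : ∀ k a n → approx (k · a) n ≡ ι k ℚ.* approx a n
approx-· zero    a n = sym (ℚ.*-zeroˡ (approx a n))
approx-· (suc k) a n = trans (cong (approx a n ℚ.+_) (approx-· k a n)) (lem (ι k) (approx a n))
  where
  lem : ∀ k a → a ℚ.+ k ℚ.* a ≡ (1ℚ ℚ.+ k) ℚ.* a
  lem = solve 2 (λ k a → a :+ k :* a := (con 1ℚ :+ k) :* a) refl
    where open +-*-Solver

-- Height differences of a walk in terms of letter counts

module Walks (w : Word) (x y a₀ : ℝ) where

  down : ℕ → Bool
  down = isOne ∘ w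

  ones zeros : ℕ → ℕ → ℕ
  ones  = Word.cnt down
  zeros = Word.cnt (not ∘ down)

  height : ℕ → ℝ
  height = walk w x y a₀

  val : ℕ → ℕ → ℕ → ℚ
  val z o n = ι z ℚ.* approx x n ℚ.- ι o ℚ.* approx y n

  walk-step : ∀ i n → approx (height (suc i)) n ≡ approx (height i) n ℚ.+ val (bit (not (down i))) (bit (down i)) n
  walk-step i n with w i
  ... | 0F = lem (approx (height i) n) (approx x n) (approx y n)
    where
    lem : ∀ a x y → a ℚ.+ x ≡ a ℚ.+ ((1ℚ ℚ.+ 0ℚ) ℚ.* x ℚ.- 0ℚ ℚ.* y)
    lem = solve 3 (λ a x y → a :+ x := a :+ ((con 1ℚ :+ con 0ℚ) :* x :- con 0ℚ :* y)) refl
      where open +-*-Solver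
  ... | 1F = lem (approx (height i) n) (approx x n) (approx y n)
    where
    lem : ∀ a x y → a ℚ.- y ≡ a ℚ.+ (0ℚ ℚ.* x ℚ.- (1ℚ ℚ.+ 0ℚ) ℚ.* y)
    lem = solve 3 (λ a x y → a :- y := a :+ (con 0ℚ :* x :- (con 1ℚ :+ con 0ℚ) :* y)) refl
      where open +-*-Solver

  val-+ : ∀ z z′ o o′ n → val (z + z′) (o + o′) n ≡ val z o n ℚ.+ val z′ o′ n
  val-+ z z′ o o′ n = trans (cong₂ (λ p q → p ℚ.* approx x n ℚ.- q ℚ.* approx y n) (ι-+ z z′) (ι-+ o o′))
    (lem (ι z) (ι z′) (ι o) (ι o′) (approx x n) (approx y n))
    where
    lem : ∀ z z′ o o′ x y → (z ℚ.+ z′) ℚ.* x ℚ.- (o ℚ.+ o′) ℚ.* y ≡ (z ℚ.* x ℚ.- o ℚ.* y) ℚ.+ (z′ ℚ.* x ℚ.- o′ ℚ.* y)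
    lem = solve 6 (λ z z′ o o′ x y → (z :+ z′) :* x :- (o :+ o′) :* y := (z :* x :- o :* y) :+ (z′ :* x :- o′ :* y)) refl
      where open +-*-Solver

  walk-diff : ∀ m i n → approx (height (m + i)) n ≡ approx (height i) n ℚ.+ val (zeros m i) (ones m i) n
  walk-diff zero    i n = lem (approx (height i) n) (approx x n) (approx y n)
    where
    lem : ∀ a x y → a ≡ a ℚ.+ (0ℚ ℚ.* x ℚ.- 0ℚ ℚ.* y)
    lem = solve 3 (λ a x y → a := a :+ (con 0ℚ :* x :- con 0ℚ :* y)) refl
      where open +-*-Solver
  walk-diff (suc m) i n = begin
    approx (height (suc (m + i))) n
      ≡⟨ walk-step (m + i) n ⟩
    approx (height (m + i)) n ℚ.+ val z′ o′ n
      ≡⟨ cong (ℚ._+ val z′ o′ n) (walk-diff m i n) ⟩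
    approx (height i) n ℚ.+ val (zeros m i) (ones m i) n ℚ.+ val z′ o′ n
      ≡⟨ ℚ.+-assoc (approx (height i) n) _ _ ⟩
    approx (height i) n ℚ.+ (val (zeros m i) (ones m i) n ℚ.+ val z′ o′ n)
      ≡⟨ cong (approx (height i) n ℚ.+_) (val-+ (zeros m i) z′ (ones m i) o′ n) ⟨
    approx (height i) n ℚ.+ val (zeros m i + z′) (ones m i + o′) n
      ≡⟨ cong₂ (λ z o → approx (height i) n ℚ.+ val z o n) (Word.cnt-snoc (not ∘ down) m i) (Word.cnt-snoc down m i) ⟨
    approx (height i) n ℚ.+ val (zeros (suc m) i) (ones (suc m) i) n ∎
    where
    open ≡-Reasoning
    z′ = bit (not (down (m + i)))
    o′ = bit (down (m + i))

  -- The sign of `z · x − o · y`, with the uniform gap of the strict order of reals; the starting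
  -- height has cancelled.
  Positive Negative : ℕ → ℕ → Set
  Positive z o = ∃[ ε ] (0ℚ ℚ.< ε) × (∃[ N ] ∀ n → N ≤ n → ε ℚ.< val z o n)
  Negative z o = ∃[ ε ] (0ℚ ℚ.< ε) × (∃[ N ] ∀ n → N ≤ n → ε ℚ.< ℚ.- val z o n)

  rising⇒Positive : ∀ m i → height i D.< height (m + i) → Positive (zeros m i) (ones m i)
  rising⇒Positive m i (ε , 0<ε , N , h) = ε , 0<ε , N , λ n le → subst₂ ℚ._<_
    (lem₁ (approx (height i) n) ε) (trans (cong (ℚ._- approx (height i) n) (walk-diff m i n)) (lem₁ (approx (height i) n) (val (zeros m i) (ones m i) n)))
    (ℚ.+-monoˡ-< (ℚ.- approx (height i) n) (h n le))
    where
    lem₁ : ∀ a e → a ℚ.+ e ℚ.- a ≡ e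
    lem₁ = solve 2 (λ a e → a :+ e :- a := e) refl
      where open +-*-Solver

  Positive⇒rising : ∀ m i → Positive (zeros m i) (ones m i) → height i D.< height (m + i)
  Positive⇒rising m i (ε , 0<ε , N , h) = ε , 0<ε , N , λ n le →
    subst (approx (height i) n ℚ.+ ε ℚ.<_) (sym (walk-diff m i n)) (ℚ.+-monoʳ-< (approx (height i) n) (h n le))

  Negative⇒falling : ∀ m i → Negative (zeros m i) (ones m i) → height (m + i) D.< height i
  Negative⇒falling m i (ε , 0<ε , N , h) = ε , 0<ε , N , λ n le → subst₂ ℚ._<_
    (cong (ℚ._+ ε) (sym (walk-diff m i n))) (lem (approx (height i) n) (val (zeros m i) (ones m i) n))
    (ℚ.+-monoʳ-< (approx (height i) n ℚ.+ val (zeros m i) (ones m i) n) (h n le))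
    where
    lem : ∀ a v → a ℚ.+ v ℚ.+ ℚ.- v ≡ a
    lem = solve 2 (λ a v → a :+ v :+ :- v := a) refl
      where open +-*-Solver

  Positive⇒0<x : Positive 1 0 → 0ℝ D.< x
  Positive⇒0<x (ε , 0<ε , N , h) = ε , 0<ε , N , λ n le →
    subst₂ ℚ._<_ (sym (ℚ.+-identityˡ ε)) (lem (approx x n) (approx y n)) (h n le)
    where
    lem : ∀ x y → (1ℚ ℚ.+ 0ℚ) ℚ.* x ℚ.- 0ℚ ℚ.* y ≡ x
    lem = solve 2 (λ x y → (con 1ℚ :+ con 0ℚ) :* x :- con 0ℚ :* y := x) refl
      where open +-*-Solver

  Negative⇒0<y : Negative 0 1 → 0ℝ D.< y
  Negative⇒0<y (ε , 0<ε , N , h) = ε , 0<ε , N , λ n le →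
    subst₂ ℚ._<_ (sym (ℚ.+-identityˡ ε)) (lem (approx x n) (approx y n)) (h n le)
    where
    lem : ∀ x y → ℚ.- (0ℚ ℚ.* x ℚ.- (1ℚ ℚ.+ 0ℚ) ℚ.* y) ≡ y
    lem = solve 2 (λ x y → :- (con 0ℚ :* x :- (con 1ℚ :+ con 0ℚ) :* y) := y) refl
      where open +-*-Solver

  Positive⇒≉ : ∀ z o → Positive z o → ¬ ((z · x) D.≈ (o · y))
  Positive⇒≉ z o (ε , 0<ε , N , h) = <ℝ-≉ (o · y) (z · x) (ε , 0<ε , N , λ n le →
    subst₂ ℚ._<_ (cong (ℚ._+ ε) (sym (approx-· o y n))) (trans (lem (ι z ℚ.* approx x n) (ι o ℚ.* approx y n)) (sym (approx-· z x n)))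
      (ℚ.+-monoʳ-< (ι o ℚ.* approx y n) (h n le)))
    where
    lem : ∀ a b → b ℚ.+ (a ℚ.- b) ≡ a
    lem = solve 2 (λ a b → b :+ (a :- b) := a) refl
      where open +-*-Solver

  Negative⇒≉ : ∀ z o → Negative z o → ¬ ((z · x) D.≈ (o · y))
  Negative⇒≉ z o (ε , 0<ε , N , h) eq = <ℝ-≉ (z · x) (o · y) (ε , 0<ε , N , λ n le →
    subst₂ ℚ._<_ (cong (ℚ._+ ε) (sym (approx-· z x n))) (trans (lem (ι z ℚ.* approx x n) (ι o ℚ.* approx y n)) (sym (approx-· o y n)))
      (ℚ.+-monoʳ-< (ι z ℚ.* approx x n) (h n le))) (≈ℝ-sym (z · x) (o · y) eq)
    where
    lem : ∀ a b → a ℚ.+ ℚ.- (a ℚ.- b) ≡ b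
    lem = solve 2 (λ a b → a :+ :- (a :- b) := b) refl
      where open +-*-Solver

count-ones : ∀ n (f : ℕ → Fin 2) → ∣ tabulate {n = n} (f ∘ toℕ) ∣₁ ≡ Word.cnt (isOne ∘ f) n 0
count-ones zero    f = refl
count-ones (suc n) f with f 0 | count-ones n (f ∘ suc)
... | 0F | ih = trans ih (cnt-cong (isOne ∘ f ∘ suc) (isOne ∘ f) n λ k _ → cong (isOne ∘ f) (sym (+-suc k 0)))
... | 1F | ih = cong suc (trans ih (cnt-cong (isOne ∘ f ∘ suc) (isOne ∘ f) n λ k _ → cong (isOne ∘ f) (sym (+-suc k 0))))

count-zeros : ∀ n (f : ℕ → Fin 2) → ∣ tabulate {n = n} (f ∘ toℕ) ∣₀ ≡ Word.cnt (not ∘ isOne ∘ f) n 0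
count-zeros zero    f = refl
count-zeros (suc n) f with f 0 | count-zeros n (f ∘ suc)
... | 1F | ih = trans ih (cnt-cong (not ∘ isOne ∘ f ∘ suc) (not ∘ isOne ∘ f) n λ k _ → cong (not ∘ isOne ∘ f) (sym (+-suc k 0)))
... | 0F | ih = cong suc (trans ih (cnt-cong (not ∘ isOne ∘ f ∘ suc) (not ∘ isOne ∘ f) n λ k _ → cong (not ∘ isOne ∘ f) (sym (+-suc k 0))))

module Blocks (w : Word) where
  open Word (isOne ∘ w) using (Blk; blk; at)

  block-ones : ∀ n i → ∣ block w n i ∣₁ ≡ Word.cnt (isOne ∘ w) n i
  block-ones n i = trans (count-ones n (w ∘ (i +_))) (cnt-cong (isOne ∘ w ∘ (i +_)) (isOne ∘ w) n λ k _ →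
    cong (isOne ∘ w) (trans (cong (i +_) (+-identityʳ k)) (+-comm i k)))

  block-zeros : ∀ n i → ∣ block w n i ∣₀ ≡ Word.cnt (not ∘ isOne ∘ w) n i
  block-zeros n i = trans (count-zeros n (w ∘ (i +_))) (cnt-cong (not ∘ isOne ∘ w ∘ (i +_)) (not ∘ isOne ∘ w) n λ k _ →
    cong (not ∘ isOne ∘ w) (trans (cong (i +_) (+-identityʳ k)) (+-comm i k)))

  block⇒blk : ∀ n i j → block w n i ≡ block w n j → Blk n i j
  block⇒blk n i j q = blk λ k k<n → subst (λ l → isOne (w (l + i)) ≡ isOne (w (l + j))) (Fin.toℕ-fromℕ< k<n)
    (cong isOne (let l = Fin.fromℕ< k<n in
      trans (cong w (+-comm (toℕ l) i)) (trans (sym (Vec.lookup∘tabulate (λ k → w (i + toℕ k)) l))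
        (trans (cong (λ v → Vec.lookup v l) q) (trans (Vec.lookup∘tabulate (λ k → w (j + toℕ k)) l)
          (cong w (+-comm j (toℕ l))))))))

  blk⇒block : ∀ n i j → Blk n i j → block w n i ≡ block w n j
  blk⇒block n i j r = Vec.tabulate-cong λ k → isOne-injective _ _ (trans (cong (isOne ∘ w) (+-comm i (toℕ k)))
    (trans (at r (toℕ k) (Fin.toℕ<n k)) (cong (isOne ∘ w) (+-comm (toℕ k) j))))

-- The step lengths x and y

bounded-below : ∀ (v : ℕ → ℚ) N D → (∀ n → N ≤ n → 1ℚ ℚ.≤ ι (suc D) ℚ.* v n) →
                ∃[ ε ] (0ℚ ℚ.< ε) × (∃[ N ] ∀ n → N ≤ n → ε ℚ.< v n)
bounded-below v N D h = ε , 0<ε , N , λ n le → ℚ.*-cancelˡ-<-nonNeg (ι (suc D)) {{ℚ.nonNegative (0≤ι (suc D))}}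
    (ℚ.<-≤-trans (subst (ℚ._< 1ℚ) (sym half) ½<1) (h n le))
  where
  open +-*-Solver
  -- The factor ½ makes the bound `1 / (D + 1)` strict.
  ε = ½ ℚ.* ι-inverse D
  0<ε : 0ℚ ℚ.< ε
  0<ε = ½-positive (ℚ.positive⁻¹ (ι-inverse D) {{ℚ.1/pos⇒pos (ι (suc D)) {{ι-positive D}}}})
  half : ι (suc D) ℚ.* ε ≡ ½
  half = trans (lem (ι (suc D)) (ι-inverse D)) (trans (cong (½ ℚ.*_) (ι-*-inverse D)) (ℚ.*-identityʳ ½))
    where
    lem : ∀ a b → a ℚ.* (½ ℚ.* b) ≡ ½ ℚ.* (a ℚ.* b)
    lem = solve 2 (λ a b → a :* (con ½ :* b) := con ½ :* (a :* b)) refl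
  ½<1 : ½ ℚ.< 1ℚ
  ½<1 = subst₂ ℚ._<_ (ℚ.+-identityʳ ½) refl (ℚ.+-monoʳ-< ½ (ℚ.positive⁻¹ ½))

module Weights (em : ExcludedMiddle 0ℓ) (O : Order) (few : FewPatterns O)
               (¬up : ¬ Patterns.UPₒ O) where
  open Classical em
  open Patterns O
  open Heights em O few ¬up
  open Slopes em O few ¬up
  open MonotoneSequences em

  -- The number of steps in the direction opposite to b.
  against : Bool → ℕ → ℕ → ℕ
  against true  = cnt
  against false = Word.cnt (not ∘ W)

  against-sum : ∀ b m i → against b m i + against (not b) m i ≡ m
  against-sum true  m i = cnt-not W m i
  against-sum false m i = trans (+-comm (against false m i) (cnt m i)) (cnt-not W m i)

  some-step : ∀ b → ∃[ j ] γ 1 j ≡ b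
  some-step b = dne λ none → W-aperiodic (1 , 0 , ≤-refl , λ i _ → cong not
    (trans (Bool.¬-not λ q → none (i , q)) (sym (Bool.¬-not λ q → none (suc i , q)))))

  private
    -- In fractions, `c′ / m′ + 1 / (m (D + 1)) ≤ c / m`: the bound on `m′` keeps the difference
    -- `X / (m m′)` away from zero independently of `m′`.
    scale : ∀ c c′ m m′ D X → c′ * m + X ≡ c * m′ → m′ ≤ D * X →
            c′ * (m * suc D) + m′ ≤ m′ * (c * suc D)
    scale c c′ m m′ D X q le = subst₂ _≤_ (cong (_+ m′) (lem₁ c′ m D)) (lem₂ c m′ D)
      (subst (λ y → suc D * (c′ * m) + m′ ≤ suc D * y) q
        (subst (suc D * (c′ * m) + m′ ≤_) (sym (*-distribˡ-+ (suc D) (c′ * m) X))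
          (+-monoʳ-≤ (suc D * (c′ * m)) (≤-trans le (m≤n+m (D * X) X)))))
      where
      lem₁ : ∀ c m D → suc D * (c * m) ≡ c * (m * suc D)
      lem₁ = solve-∀
      lem₂ : ∀ c m D → suc D * (c * m) ≡ m * (c * suc D)
      lem₂ = solve-∀

    difference : ∀ {a b} → a < b → ∃[ X ] 1 ≤ X × a + X ≡ b
    difference a<b = let l , q = split-< a<b in suc l , s≤s z≤n , q

  -- `D` depends only on the block at `i`, so the inequality survives the passage to the supremum
  -- over all blocks of the other direction.
  uniform-gap : ∀ b k i → γ (suc k) i ≡ b → ∃[ D ] (∀ k′ i′ → γ (suc k′) i′ ≡ not b →
    against (not b) (suc k′) i′ * (suc k * suc D) + suc k′ ≤ suc k′ * (against (not b) (suc k) i * suc D))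
  uniform-gap true k i γi = case gap (suc k) (cnt (suc k) i) (s≤s z≤n) of λ where
      (D , bound) → D , λ k′ i′ γi′ → case difference (separation _ (suc k) (suc k′) _ _ ≤-refl (s≤s z≤n) (s≤s z≤n)
                                          (i , refl , γi) (i′ , refl , γi′)) of λ where
        (X , 1≤X , q) → scale (against false (suc k) i) (against false (suc k′) i′) (suc k) (suc k′) D X (complement k′ i′ X q) (bound (suc k′) i′ X 1≤X (inj₁ q))
    where
    complement : ∀ k′ i′ X → cnt (suc k) i * suc k′ + X ≡ cnt (suc k′) i′ * suc k →
                 against false (suc k′) i′ * suc k + X ≡ against false (suc k) i * suc k′
    complement k′ i′ X q = lin 6 (λ om om′ zm zm′ mm X → (om′ ⊕ X ≈ᵉ om) ⇒ (om ⊕ zm ≈ᵉ mm) ⇒ (om′ ⊕ zm′ ≈ᵉ mm) ⇒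
        (⊢ (zm ⊕ X ≈ᵉ zm′))) refl
      (cnt (suc k′) i′ * suc k) (cnt (suc k) i * suc k′) (against false (suc k′) i′ * suc k)
      (against false (suc k) i * suc k′) (suc k′ * suc k) X q
      (trans (sym (*-distribʳ-+ (suc k) (cnt (suc k′) i′) _)) (cong (_* suc k) (cnt-not W (suc k′) i′)))
      (trans (sym (*-distribʳ-+ (suc k′) (cnt (suc k) i) _)) (trans (cong (_* suc k′) (cnt-not W (suc k) i)) (*-comm (suc k) (suc k′))))
  uniform-gap false k i γi = case gap (suc k) (cnt (suc k) i) (s≤s z≤n) of λ where
      (D , bound) → D , λ k′ i′ γi′ → case difference (separation _ (suc k′) (suc k) _ _ ≤-refl (s≤s z≤n) (s≤s z≤n)
                                          (i′ , refl , γi′) (i , refl , γi)) of λ where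
        (X , 1≤X , q) → scale (cnt (suc k) i) (cnt (suc k′) i′) (suc k) (suc k′) D X q (bound (suc k′) i′ X 1≤X (inj₂ q))

  -- The slopes (number of opposite steps) / length of the blocks going in direction b;
  -- blocks going in the other direction contribute 0.
  slope : Bool → ℕ → ℕ → ℚ
  slope b i k with γ (suc k) i Bool.≟ b
  ... | yes _ = ratio (against b (suc k) i) k
  ... | no _  = 0ℚ

  slope-yes : ∀ b i k → γ (suc k) i ≡ b → slope b i k ≡ ratio (against b (suc k) i) k
  slope-yes b i k q with γ (suc k) i Bool.≟ b
  ... | yes _ = refl
  ... | no ≢  = contradiction q ≢

  slope-cases : ∀ b i k → (γ (suc k) i ≡ b × slope b i k ≡ ratio (against b (suc k) i) k) ⊎ slope b i k ≡ 0ℚ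
  slope-cases b i k with γ (suc k) i Bool.≟ b
  ... | yes q = inj₁ (q , refl)
  ... | no _  = inj₂ refl

  ratio-nonneg : ∀ c k → 0ℚ ℚ.≤ ratio c k
  ratio-nonneg c k = ℚ.*-cancelˡ-≤-pos (ι (suc k)) {{ι-positive k}}
    (subst₂ ℚ._≤_ (sym (ℚ.*-zeroʳ (ι (suc k)))) (sym (*-ratio c k)) (0≤ι c))

  slope-nonneg : ∀ b i k → 0ℚ ℚ.≤ slope b i k
  slope-nonneg b i k with slope-cases b i k
  ... | inj₁ (_ , q) = subst (0ℚ ℚ.≤_) (sym q) (ratio-nonneg (against b (suc k) i) k)
  ... | inj₂ q       = ℚ.≤-reflexive (sym q)

  slope-≤1 : ∀ b i k → slope b i k ℚ.≤ 1ℚ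
  slope-≤1 b i k with slope-cases b i k
  ... | inj₁ (_ , q) = subst (ℚ._≤ 1ℚ) (sym q) (ratio-≤1 (subst (against b (suc k) i ≤_) (against-sum b (suc k) i) (m≤m+n _ _)))
  ... | inj₂ q       = subst (ℚ._≤ 1ℚ) (sym q) 0≤1

  layer : Bool → ℕ → ℕ → ℚ
  layer b s i = maxUpTo (slope b i) s

  -- The inner maxima run over the slopes with `i` and `k` up to `s`, the outer one over `s`; this
  -- makes the sequence evidently monotone, and its limit is the supremum of all slopes.
  top : Bool → ℕ → ℚ
  top b = maxUpTo λ s → maxUpTo (layer b s) s

  top-attained : ∀ b n → ∃₂ λ i k → top b n ≡ slope b i k
  top-attained b n =
    let s , p = maxUpTo-attained (λ s → maxUpTo (layer b s) s) n
        i , q = maxUpTo-attained (layer b s) s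
        k , r = maxUpTo-attained (slope b i) s
    in i , k , trans p (trans q r)

  slope-≤-top : ∀ b i k n → i ⊔ k ≤ n → slope b i k ℚ.≤ top b n
  slope-≤-top b i k n le = ℚ.≤-trans (≤-maxUpTo (slope b i) (m≤n⊔m i k))
    (ℚ.≤-trans (≤-maxUpTo (layer b (i ⊔ k)) (m≤m⊔n i k)) (≤-maxUpTo (λ s → maxUpTo (layer b s) s) le))

  top-cauchy : ∀ b → IsCauchy (top b)
  top-cauchy b = monotone-cauchy (top b) (maxUpTo-mono (λ s → maxUpTo (layer b s) s))
    (λ n → let i , k , q = top-attained b n in subst (0ℚ ℚ.≤_) (sym q) (slope-nonneg b i k))
    (λ n → let i , k , q = top-attained b n in subst (ℚ._≤ 1ℚ) (sym q) (slope-≤1 b i k))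

  -- Each term of `top` is attained by a single slope, to which the bound applies, or is the default
  -- value 0.
  below-top : ∀ b k i D → (∀ k′ i′ → γ (suc k′) i′ ≡ not b →
      against (not b) (suc k′) i′ * (suc k * suc D) + suc k′ ≤ suc k′ * (against (not b) (suc k) i * suc D)) →
    ∀ n → ι (suc k * suc D) ℚ.* top (not b) n ℚ.+ 1ℚ ℚ.≤ ι (against (not b) (suc k) i * suc D)
  below-top b k i D bound n = case top-attained (not b) n of λ where
      (i′ , k′ , q) → subst (λ t → K ℚ.* t ℚ.+ 1ℚ ℚ.≤ T) (sym q) (case slope-cases (not b) i′ k′ of λ where
        (inj₁ (γi′ , r)) → subst (λ t → K ℚ.* t ℚ.+ 1ℚ ℚ.≤ T) (sym r) (at-ratio k′ i′ γi′)
        (inj₂ r) → subst (λ t → K ℚ.* t ℚ.+ 1ℚ ℚ.≤ T) (sym r)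
          (subst (ℚ._≤ T) (trans (ℚ.+-identityʳ 1ℚ) (sym (zero-lem K))) nonzero))
    where
    open +-*-Solver
    K = ι (suc k * suc D)
    T = ι (against (not b) (suc k) i * suc D)
    zero-lem : ∀ a → a ℚ.* 0ℚ ℚ.+ 1ℚ ≡ 1ℚ
    zero-lem = solve 1 (λ a → a :* con 0ℚ :+ con 1ℚ := con 1ℚ) refl
    -- The case of the default value 0: the bound for a single step in the direction `not b` already
    -- shows that the right-hand side is at least 1.
    nonzero : 1ℚ ℚ.+ 0ℚ ℚ.≤ T
    nonzero = ι-mono {1} (let j , γj = some-step (not b) in
      ≤-trans (m≤n+m 1 _) (subst (against (not b) 1 j * (suc k * suc D) + 1 ≤_) (*-identityˡ _) (bound 0 j γj)))
    at-ratio : ∀ k′ i′ → γ (suc k′) i′ ≡ not b → K ℚ.* ratio (against (not b) (suc k′) i′) k′ ℚ.+ 1ℚ ℚ.≤ T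
    at-ratio k′ i′ γi′ = ℚ.*-cancelˡ-≤-pos (ι (suc k′)) {{ι-positive k′}} (subst₂ ℚ._≤_ lhs (ι-* (suc k′) (against (not b) (suc k) i * suc D)) (ι-mono (bound k′ i′ γi′)))
      where
      c = against (not b) (suc k′) i′
      lem : ∀ m K r → m ℚ.* r ℚ.* K ℚ.+ m ≡ m ℚ.* (K ℚ.* r ℚ.+ 1ℚ)
      lem = solve 3 (λ m K r → m :* r :* K :+ m := m :* (K :* r :+ con 1ℚ)) refl
      lhs : ι (c * (suc k * suc D) + suc k′) ≡ ι (suc k′) ℚ.* (K ℚ.* ratio c k′ ℚ.+ 1ℚ)
      lhs = trans (ι-+ (c * (suc k * suc D)) (suc k′)) (trans (cong (ℚ._+ ι (suc k′))
        (trans (ι-* c (suc k * suc D)) (cong (ℚ._* K) (sym (*-ratio c k′))))) (lem (ι (suc k′)) K (ratio c k′)))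

  -- Adds two estimates: `top b` eventually dominates the slope of this block, and `below-top` keeps
  -- `top (not b)` strictly below its complementary slope.
  margin : ∀ b k i → γ (suc k) i ≡ b → ∃[ D ] (∀ n → i ⊔ k ≤ n →
    1ℚ ℚ.≤ ι (suc D) ℚ.* (ι (against (not b) (suc k) i) ℚ.- ι (against b (suc k) i)
                          ℚ.+ ι (suc k) ℚ.* (top b n ℚ.- top (not b) n)))
  margin b k i γi = case uniform-gap b k i γi of λ where
      (D , bound) → D , λ n le → from D n (below-top b k i D bound n)
        (subst (ℚ._≤ ι (suc k) ℚ.* top b n) (trans (cong (ι (suc k) ℚ.*_) (slope-yes b i k γi)) (*-ratio (against b (suc k) i) k))
          (ℚ.*-monoˡ-≤-nonNeg (ι (suc k)) {{ℚ.nonNegative (0≤ι (suc k))}} (slope-≤-top b i k n le)))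
    where
    open +-*-Solver
    t  = against b (suc k) i
    t′ = against (not b) (suc k) i
    from : ∀ D n → ι (suc k * suc D) ℚ.* top (not b) n ℚ.+ 1ℚ ℚ.≤ ι (t′ * suc D) → ι t ℚ.≤ ι (suc k) ℚ.* top b n →
           1ℚ ℚ.≤ ι (suc D) ℚ.* (ι t′ ℚ.- ι t ℚ.+ ι (suc k) ℚ.* (top b n ℚ.- top (not b) n))
    from D n upper lower = subst₂ ℚ._≤_
      (lem₁ (ι (suc D)) (ι t) (ι (suc k)) (top (not b) n))
      (lem₂ (ι (suc D)) (ι t) (ι t′) (ι (suc k)) (top b n) (top (not b) n))
      (ℚ.+-monoˡ-≤ (ℚ.- (ι (suc k) ℚ.* ι (suc D) ℚ.* top (not b) n ℚ.+ ι (suc D) ℚ.* ι t)) (ℚ.+-mono-≤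
        (subst₂ ℚ._≤_ (cong (λ z → z ℚ.* top (not b) n ℚ.+ 1ℚ) (ι-* (suc k) (suc D))) (ι-* t′ (suc D)) upper)
        (ℚ.*-monoˡ-≤-nonNeg (ι (suc D)) {{ℚ.nonNegative (0≤ι (suc D))}} lower)))
      where
      lem₁ : ∀ D t m F → (m ℚ.* D ℚ.* F ℚ.+ 1ℚ ℚ.+ D ℚ.* t) ℚ.+ ℚ.- (m ℚ.* D ℚ.* F ℚ.+ D ℚ.* t) ≡ 1ℚ
      lem₁ = solve 4 (λ D t m F → (m :* D :* F :+ con 1ℚ :+ D :* t) :+ :- (m :* D :* F :+ D :* t) := con 1ℚ) refl
      lem₂ : ∀ D t t′ m T F → (t′ ℚ.* D ℚ.+ D ℚ.* (m ℚ.* T)) ℚ.+ ℚ.- (m ℚ.* D ℚ.* F ℚ.+ D ℚ.* t)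
             ≡ D ℚ.* (t′ ℚ.- t ℚ.+ m ℚ.* (T ℚ.- F))
      lem₂ = solve 6 (λ D t t′ m T F → (t′ :* D :+ D :* (m :* T)) :+ :- (m :* D :* F :+ D :* t)
             := D :* (t′ :- t :+ m :* (T :- F))) refl

  1ℝ : ℝ
  1ℝ = mkℝ (λ _ → 1ℚ) λ ε 0<ε → 0 , λ _ _ _ _ → 0<ε

  topℝ : Bool → ℝ
  topℝ b = mkℝ (top b) (top-cauchy b)

  -- Up to the factor 2 these are s and 1 − s, where s lies between the slopes of the rising and
  -- those of the falling blocks.
  x y : ℝ
  x = 1ℝ D.+ (topℝ true D.- topℝ false)
  y = 1ℝ D.+ (topℝ false D.- topℝ true)

  val : ℕ → ℕ → ℕ → ℚ
  val z o n = ι z ℚ.* approx x n ℚ.- ι o ℚ.* approx y n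

  rising : ∀ k i → γ (suc k) i ≡ true →
    ∃[ ε ] (0ℚ ℚ.< ε) × (∃[ N ] ∀ n → N ≤ n → ε ℚ.< val (against false (suc k) i) (against true (suc k) i) n)
  rising k i γi = case margin true k i γi of λ where
      (D , big) → bounded-below _ (i ⊔ k) D λ n le → subst (λ v → 1ℚ ℚ.≤ ι (suc D) ℚ.* v) (eq n) (big n le)
    where
    open +-*-Solver
    z = against false (suc k) i
    o = against true (suc k) i
    lem : ∀ z o T F → z ℚ.- o ℚ.+ (o ℚ.+ z) ℚ.* (T ℚ.- F) ≡ z ℚ.* (1ℚ ℚ.+ (T ℚ.+ ℚ.- F)) ℚ.- o ℚ.* (1ℚ ℚ.+ (F ℚ.+ ℚ.- T))
    lem = solve 4 (λ z o T F → z :- o :+ (o :+ z) :* (T :- F) := z :* (con 1ℚ :+ (T :+ :- F)) :- o :* (con 1ℚ :+ (F :+ :- T))) refl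
    eq : ∀ n → ι z ℚ.- ι o ℚ.+ ι (suc k) ℚ.* (top true n ℚ.- top false n) ≡ val z o n
    eq n = trans (cong (λ m → ι z ℚ.- ι o ℚ.+ m ℚ.* (top true n ℚ.- top false n))
      (trans (cong ι (sym (against-sum true (suc k) i))) (ι-+ o z))) (lem (ι z) (ι o) (top true n) (top false n))

  falling : ∀ k i → γ (suc k) i ≡ false →
    ∃[ ε ] (0ℚ ℚ.< ε) × (∃[ N ] ∀ n → N ≤ n → ε ℚ.< ℚ.- val (against false (suc k) i) (against true (suc k) i) n)
  falling k i γi = case margin false k i γi of λ where
      (D , big) → bounded-below _ (i ⊔ k) D λ n le → subst (λ v → 1ℚ ℚ.≤ ι (suc D) ℚ.* v) (eq n) (big n le)
    where
    open +-*-Solver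
    z = against false (suc k) i
    o = against true (suc k) i
    lem : ∀ z o T F → o ℚ.- z ℚ.+ (z ℚ.+ o) ℚ.* (F ℚ.- T) ≡ ℚ.- (z ℚ.* (1ℚ ℚ.+ (T ℚ.+ ℚ.- F)) ℚ.- o ℚ.* (1ℚ ℚ.+ (F ℚ.+ ℚ.- T)))
    lem = solve 4 (λ z o T F → o :- z :+ (z :+ o) :* (F :- T) := :- (z :* (con 1ℚ :+ (T :+ :- F)) :- o :* (con 1ℚ :+ (F :+ :- T)))) refl
    eq : ∀ n → ι o ℚ.- ι z ℚ.+ ι (suc k) ℚ.* (top false n ℚ.- top true n) ≡ ℚ.- val z o n
    eq n = trans (cong (λ m → ι o ℚ.- ι z ℚ.+ m ℚ.* (top false n ℚ.- top true n))
      (trans (cong ι (sym (against-sum false (suc k) i))) (ι-+ z o))) (lem (ι z) (ι o) (top true n) (top false n))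

-- Windows and factors

insert : ∀ h x os → Linked _<_ (h ∷ os) → h < x →
  ∃[ os′ ] Linked _<_ (h ∷ os′) × length os′ ≤ suc (length os) × x ∈ os′ × (∀ {a} → a ∈ os → a ∈ os′)
insert h x [] _ h<x = x ∷ [] , h<x ∷ [-] , ≤-refl , here refl , λ ()
insert h x (o ∷ os) (h<o ∷ inc) h<x with <-cmp x o
... | tri< x<o _ _ = x ∷ o ∷ os , h<x ∷ x<o ∷ inc , ≤-refl , here refl , there
... | tri≈ _ refl _ = o ∷ os , h<o ∷ inc , n≤1+n _ , here refl , λ a∈ → a∈
... | tri> _ _ o<x = let os′ , inc′ , len , x∈ , sub = insert o x os inc o<x in
  o ∷ os′ , h<o ∷ inc′ , s≤s len , there x∈ , λ { (here q) → here q ; (there a∈) → there (sub a∈) }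

snoc : ∀ h os → Linked _<_ (h ∷ os) →
  ∃[ os′ ] Linked _<_ (h ∷ os′) × length os′ ≡ suc (length os) × (∀ {a} → a ∈ os → a ∈ os′)
snoc h []       _           = suc h ∷ [] , ≤-refl ∷ [-] , refl , λ ()
snoc h (o ∷ os) (h<o ∷ inc) = let os′ , inc′ , len , sub = snoc o os inc in
  o ∷ os′ , h<o ∷ inc′ , cong suc len , λ { (here q) → here q ; (there a∈) → there (sub a∈) }

-- `c` is the minimum of the list, and `T` is the list sorted and shifted by `c`. Repetitions
-- disappear, hence only an inequality for the size.
toWindow : ∀ x L → ∃₂ λ (T : Window) c → # T ≤ suc (length L) ×
           (∀ {a} → a ∈ x ∷ L → ∃[ b ] b ∈ elements T × a ≡ b + c)
toWindow x [] = record { offsets = [] ; increasing = [-] } , x , ≤-refl , λ { (here refl) → 0 , here refl , refl }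
toWindow x (x′ ∷ L) with toWindow x′ L
... | T , c , len , cover with <-cmp x c
... | tri≈ _ refl _ = T , c , m≤n⇒m≤1+n len , λ { (here refl) → 0 , here refl , refl ; (there a∈) → cover a∈ }
... | tri< x<c _ _ with split-< x<c
...   | l , refl = record
        { offsets    = List.map (suc l +_) (elements T)
        ; increasing = subst (0 <_) (sym (+-identityʳ (suc l))) z<s ∷
            Linked.map⁺ (Linked.map (+-monoʳ-< (suc l)) (Window.increasing T)) }
      , x , s≤s (≤-trans (≤-reflexive (List.length-map (suc l +_) (elements T))) len) , λ where
          (here refl) → 0 , here refl , refl
          (there a∈)  → let b , b∈ , q = cover a∈ in
            suc l + b , there (List.∈-map⁺ (suc l +_) b∈) , trans q (lem b x l)
  where
  lem : ∀ b x l → b + (x + suc l) ≡ suc l + b + x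
  lem = solve-∀
toWindow x (x′ ∷ L) | T , c , len , cover | tri> _ _ c<x with split-< c<x
...   | l , refl = let os , inc , len′ , l∈ , sub = insert 0 (suc l) (Window.offsets T) (Window.increasing T) z<s in
        record { offsets = os ; increasing = inc } , c , s≤s (≤-trans len′ len) , λ where
          (here refl) → suc l , there l∈ , +-comm c (suc l)
          (there a∈)  → case cover a∈ of λ where
            (b , here q , r)   → b , here q , r
            (b , there b∈ , r) → b , there (sub b∈) , r

pad : ∀ l (T : Window) → ∃[ T′ ] # T′ ≡ l + # T × (∀ {a} → a ∈ elements T → a ∈ elements T′)
pad zero    T = T , refl , λ a∈ → a∈
pad (suc l) T = let T′ , len , sub = pad l T
                    os , inc , len′ , sub′ = snoc 0 (Window.offsets T′) (Window.increasing T′)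
                in record { offsets = os ; increasing = inc } , trans (cong suc len′) (cong suc len) ,
                   λ a∈ → case sub a∈ of λ where
                     (here q)    → here q
                     (there a∈′) → there (sub′ a∈′)

bool-ext : ∀ {a b} → (a ≡ true → b ≡ true) → (b ≡ true → a ≡ true) → a ≡ b
bool-ext {true}  {b}     f g = sym (f refl)
bool-ext {false} {true}  f g = g refl
bool-ext {false} {false} f g = refl

-- Complexity of the order given by a real sequence

module Main (em : ExcludedMiddle 0ℓ) (α : Permutation) where
  open Classical em
  open RealOrder em

  decide : ℕ → ℕ → Bool
  decide i j with em {α [ i < j ]}
  ... | yes _ = true
  ... | no _  = false

  decide-true : ∀ {i j} → α [ i < j ] → decide i j ≡ true
  decide-true {i} {j} p with em {α [ i < j ]}
  ... | yes _ = refl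
  ... | no ¬p = contradiction p ¬p

  true-decide : ∀ {i j} → decide i j ≡ true → α [ i < j ]
  true-decide {i} {j} q with em {α [ i < j ]}
  ... | yes p = p
  true-decide () | no _

  α-trans : ∀ i j k → α [ i < j ] → α [ j < k ] → α [ i < k ]
  α-trans i j k = <ℝ-trans (seq α i) (seq α j) (seq α k)

  α-asym : ∀ i j → α [ i < j ] → ¬ α [ j < i ]
  α-asym i j p q = <ℝ-irrefl (seq α i) (α-trans i j i p q)

  O : Order
  O = record
    { lt        = decide
    ; lt-irrefl = λ i → Bool.¬-not (<ℝ-irrefl (seq α i) ∘ true-decide {i} {i})
    ; lt-trans  = λ {i} {j} {k} p q → decide-true (α-trans i j k (true-decide p) (true-decide q))
    ; lt-total  = λ {i} {j} i≢j → bool-ext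
        (λ p → cong not (Bool.¬-not λ q → α-asym i j (true-decide p) (true-decide q)))
        (λ p → [ decide-true , (λ q → case trans (sym p) (cong not (decide-true {j} {i} q)) of λ ()) ]′
          (<ℝ-total (seq α i) (seq α j) (i≢j ∘ distinct α)))
    }

  open Patterns O
  open PatternsClassical em O

  UPₒ⇒UltimatelyPeriodic : UPₒ → UltimatelyPeriodic α
  UPₒ⇒UltimatelyPeriodic (t , N , 1≤t , per) = t , N , 1≤t , λ i j _ N<i N<j →
    case split-≤ (<⇒≤ N<i) of λ where
      (a , refl) → case split-≤ (<⇒≤ N<j) of λ where
        (b , refl) → let q = trans (same (pat-period t N 1≤t per (a ∷ b ∷ []) N ≤-refl) a b (here refl) (there (here refl)))
                               (cong₂ lt (lem a t N) (lem b t N)) in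
          mk⇔ (λ p → true-decide (trans (sym q) (decide-true p))) (λ p → true-decide (trans q (decide-true p)))
    where
    lem : ∀ a t N → a + (t + N) ≡ a + N + t
    lem = solve-∀

  pat⇒factor : ∀ T i j → Pat (elements T) i j → RB._⇔_ (factor α T i) (factor α T j)
  pat⇒factor T i j r =
    (λ { {a , a∈} {b , b∈} p → true-decide (trans (sym (same r a b a∈ b∈)) (decide-true p)) }) ,
    (λ { {a , a∈} {b , b∈} p → true-decide (trans (same r a b a∈ b∈) (decide-true p)) })

  factor⇒pat : ∀ T i j → RB._⇔_ (factor α T i) (factor α T j) → Pat (elements T) i j
  factor⇒pat T i j (f , g) = pat λ a b a∈ b∈ → bool-ext
    (λ p → decide-true (f {a , a∈} {b , b∈} (true-decide p))) (λ p → decide-true (g {a , a∈} {b , b∈} (true-decide p)))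

  count⇒atLeast : ∀ T k → FactorCount α T k → AtLeast (Pat (elements T)) k
  count⇒atLeast T k (e , inj , _) = e , λ a b r → inj (pat⇒factor T _ _ r)

  atLeast⇒count : ∀ T k → AtLeast (Pat (elements T)) k → ¬ AtLeast (Pat (elements T)) (suc k) → FactorCount α T k
  atLeast⇒count T k al@(e , inj) ¬al = e , (λ {a} {b} r → inj a b (factor⇒pat T _ _ r)) ,
    λ i → let a , r = atLeast-or-class (pat-equiv (elements T)) al ¬al i in a , pat⇒factor T _ _ r

  Windows : ℕ → ℕ → Set
  Windows n k = ∃[ T ] (# T ≡ n) × AtLeast (Pat (elements T)) k

  windows-≤ : ∀ {n k l} → k ≤ l → Windows n l → Windows n k
  windows-≤ k≤l (T , len , al) = T , len , atLeast-≤ {R = Pat (elements T)} k≤l al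

  max-complexity : ∀ n p → Windows n p → ¬ Windows n (suc p) → MaxPatternComplexity α n p
  max-complexity n p (T , len , al) none = (T , len , atLeast⇒count T p al λ al′ → none (T , len , al′)) ,
    λ T′ k len′ c → ≮⇒≥ λ p<k → none (T′ , len′ , atLeast-≤ {R = Pat (elements T′)} p<k (count⇒atLeast T′ k c))

  list-window : ∀ x L k → AtLeast (Pat (x ∷ L)) k → ∃[ n ] n ≤ length L × Windows (suc n) k
  list-window x L k (e , inj) = case toWindow x L of λ where
    (T , c , len , cover) → length (Window.offsets T) , s≤s⁻¹ len , T , refl ,
      (λ a → c + e a) , λ a b r → inj a b (pat-shift c cover (e a) (e b) r)

  many-windows : ¬ UPₒ → ∀ n → 1 ≤ n → Windows n n
  many-windows ¬up (suc n) _ = case many-patterns ¬up n of λ where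
    (L , refl , al) → case list-window 0 L _ al of λ where
      (m , m≤ , T , len , al′) → case split-≤ m≤ of λ where
        (l , q) → case pad l T of λ where
          (T′ , len′ , sub) → T′ , trans len′ (trans (cong (l +_) len) (trans (+-suc l m) (cong suc q))) ,
            atLeast-antitone {R = Pat (elements T)} {R′ = Pat (elements T′)} (pat-⊆ sub) al′

  -- `Windows n` is closed downwards and bounded by `patternBound n`, so the maximum exists
  -- classically.
  complexity-≥ : ¬ UltimatelyPeriodic α → ∀ n → 1 ≤ n → ∃[ p ] (MaxPatternComplexity α n p × n ≤ p)
  complexity-≥ ¬up n 1≤n = case greatest (Windows n) (patternBound n) (windows-≤ z≤n many) bounded of λ where
      (p , _ , wp , ¬wp) → p , max-complexity n p wp ¬wp , ≮⇒≥ λ p<n → ¬wp (windows-≤ p<n many)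
    where
    many = many-windows (¬up ∘ UPₒ⇒UltimatelyPeriodic) n 1≤n
    bounded : ¬ Windows n (suc (patternBound n))
    bounded (T , refl , al) = pat-finite (elements T) al

  -- The hypothesis bounds exact counts only, so the exact number of patterns of the window is
  -- produced as the greatest `k`.
  max⇒few : (∀ n → 1 ≤ n → MaxPatternComplexity α n n) → FewPatterns O
  max⇒few max x L al = case list-window x L _ al of λ where
    (n , n≤ , T , len , al′) → case greatest (AtLeast (Pat (elements T))) (patternBound (length (elements T)))
        ((λ ()) , λ ()) (pat-finite (elements T)) of λ where
      (k , _ , alk , ¬alk) → ¬alk (atLeast-≤ {R = Pat (elements T)} (≤-trans (s≤s (proj₂ (max (suc n) (s≤s z≤n)) T k len (atLeast⇒count T k alk ¬alk)))
        (s≤s (s≤s n≤))) al′)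

  max⇒¬UPₒ : (∀ n → 1 ≤ n → MaxPatternComplexity α n n) → ¬ UPₒ
  max⇒¬UPₒ max (t , N , 1≤t , per) = case max (suc (N + t)) (s≤s z≤n) of λ where
    ((T , _ , c) , _) → 1+n≰n (periodic-bound t N 1≤t per (count⇒atLeast T _ c))

  -- Sturmian permutations have complexity n

  module FromSturmian (w : Word) (x y a₀ : D.ℝ) (sturmian : SturmianWord w) (0<x : 0ℝ D.< x) (0<y : 0ℝ D.< y)
                      (iso : seq α ∼ walk w x y a₀) where
    open Walks w x y a₀
    open Blocks w
    open Word down using (Blk; blk; at; blk-equiv; cnt)

    few-blocks : ∀ n → ¬ AtLeast (Blk n) (2 + n)
    few-blocks n al = case sturmian n of λ where
      (e , _ , surj) → 1+n≰n (covering-≤ (blk-equiv n) e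
        (λ i → let a , q = surj i in a , block⇒blk n (e a) i q) al)

    -- With period `P` from `N` on there are at most `N + P` factors of any length, whereas length
    -- `N + P` calls for one more.
    aperiodic : ¬ UP down
    aperiodic (P , N , 1≤P , per) = case sturmian (N + P) of λ where
        (e , inj , _) → 1+n≰n (covering-≤ (blk-equiv (N + P)) toℕ cover
          (e , λ a b r → inj (blk⇒block (N + P) (e a) (e b) r)))
      where
      shifted : ∀ n c i → N ≤ i → Blk n i (c * P + i)
      shifted n c i N≤i = blk λ k _ → trans (up-multiple down P N per c (k + i) (≤-trans N≤i (m≤n+m i k)))
        (cong down (swap-+ (c * P) k i))
      cover : ∀ i → ∃[ a ] Blk (N + P) (toℕ {N + P} a) i
      cover i with i <? N + P
      ... | yes i< = Fin.fromℕ< i< , subst (λ z → Blk (N + P) z i) (sym (Fin.toℕ-fromℕ< i<)) (Word.B.refl down)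
      ... | no i≮ with split-≤ (≤-trans (m≤m+n N P) (≮⇒≥ i≮))
      ... | l , refl with residue P l 1≤P
      ... | s , r , r<P , refl = Fin.fromℕ< (+-monoʳ-< N r<P) ,
            subst₂ (Blk (N + P)) (sym (Fin.toℕ-fromℕ< (+-monoʳ-< N r<P))) (lem s P r N) (shifted (N + P) s (N + r) (m≤m+n N r))
        where
        lem : ∀ s P r N → s * P + (N + r) ≡ s * P + r + N
        lem = solve-∀

    down-balanced : Word.Balanced down
    down-balanced = WordsClassical.Complexity.balanced em down aperiodic few-blocks

    iso-to : ∀ i j → α [ i < j ] → height i D.< height j
    iso-to i j = Equivalence.to (iso i j)

    iso-from : ∀ i j → height i D.< height j → α [ i < j ]
    iso-from i j = Equivalence.from (iso i j)

    -- For fixed `m` the ones fix the zeros, and the height difference depends on nothing else.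
    count-determines : ∀ m i j → cnt m i ≡ cnt m j → γ m i ≡ γ m j
    count-determines m i j q = bool-ext (transfer i j q) (transfer j i (sym q))
      where
      zeros≡ : ∀ i j → cnt m i ≡ cnt m j → zeros m i ≡ zeros m j
      zeros≡ i j q = +-cancelˡ-≡ (cnt m i) _ _ (trans (cnt-not down m i) (trans (sym (cnt-not down m j)) (cong (_+ zeros m j) (sym q))))
      transfer : ∀ i j → cnt m i ≡ cnt m j → γ m i ≡ true → γ m j ≡ true
      transfer i j q p = decide-true (iso-from j (m + j) (Positive⇒rising m j
        (subst₂ Positive (zeros≡ i j q) q (rising⇒Positive m i (iso-to i (m + i) (true-decide p))))))

    few : FewPatterns O
    few = Chains.few-patterns em down aperiodic down-balanced O count-determines

    step-direction : ∀ i → γ 1 i ≡ not (down i)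
    step-direction i = by-letter (w i) refl
      where
      by-letter : ∀ c → w i ≡ c → γ 1 i ≡ not (isOne c)
      by-letter 0F q = decide-true (iso-from i (suc i) (subst (λ c → height i D.< D.step c x y (height i)) (sym q) up))
        where
        up : height i D.< (height i D.+ x)
        up = let ε , 0<ε , N , h = 0<x in ε , 0<ε , N , λ n le →
          ℚ.+-monoʳ-< (D.approx (height i) n) (subst (ℚ._< D.approx x n) (ℚ.+-identityˡ ε) (h n le))
      by-letter 1F q = Bool.¬-not λ p → <ℝ-irrefl (height i) (<ℝ-trans (height i) (height (suc i)) (height i) (iso-to i (suc i) (true-decide p))
          (subst (λ c → D.step c x y (height i) D.< height i) (sym q) lower))
        where
        lower : (height i D.- y) D.< height i
        lower = let ε , 0<ε , N , h = 0<y in ε , 0<ε , N , λ n le → subst₂ ℚ._<_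
            (lem (D.approx (height i) n) (D.approx y n) ε) (lem′ (D.approx (height i) n) (D.approx y n))
            (ℚ.+-monoʳ-< (D.approx (height i) n ℚ.- D.approx y n) (subst (ℚ._< D.approx y n) (ℚ.+-identityˡ ε) (h n le)))
          where
          open +-*-Solver
          lem : ∀ a y ε → a ℚ.- y ℚ.+ ε ≡ a ℚ.- y ℚ.+ ε
          lem a y ε = refl
          lem′ : ∀ a y → a ℚ.- y ℚ.+ y ≡ a
          lem′ = solve 2 (λ a y → a :- y :+ y := a) refl

    ¬UPₒ : ¬ UPₒ
    ¬UPₒ (t , N , 1≤t , per) = aperiodic (t , N , 1≤t , λ i le → Bool.not-injective
      (trans (sym (step-direction i)) (trans (per i le 1 ≤-refl) (step-direction (t + i)))))

    complexity : ∀ n → 1 ≤ n → MaxPatternComplexity α n n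
    complexity (suc n) 1≤n = max-complexity (suc n) (suc n) (many-windows ¬UPₒ (suc n) 1≤n) λ where
      (T , refl , al) → few 0 (Window.offsets T) al

  module Comparison (h : ℕ → D.ℝ)
                    (rise : ∀ k i → α [ i < suc k + i ] → h i D.< h (suc k + i))
                    (fall : ∀ k i → α [ suc k + i < i ] → h (suc k + i) D.< h i) where

    preserves : ∀ s r → α [ s < r ] → h s D.< h r
    preserves s r p = case <-cmp s r of λ where
      (tri≈ _ refl _) → contradiction p (<ℝ-irrefl (seq α s))
      (tri< s<r _ _) → case split-≤ s<r of λ where
        (l , refl) → subst (λ z → h s D.< h z) (sym (+-suc l s)) (rise l s (subst (λ z → α [ s < z ]) (+-suc l s) p))
      (tri> _ _ r<s) → case split-≤ r<s of λ where
        (l , refl) → subst (λ z → h z D.< h r) (sym (+-suc l r)) (fall l r (subst (λ z → α [ z < r ]) (+-suc l r) p))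

    reflects : ∀ s r → h s D.< h r → α [ s < r ]
    reflects s r p = case s ≟ r of λ where
      (yes refl) → contradiction p (<ℝ-irrefl (h s))
      (no s≢r) → case <ℝ-total (seq α s) (seq α r) (s≢r ∘ distinct α) of λ where
        (inj₁ q) → q
        (inj₂ q) → contradiction (<ℝ-trans (h s) (h r) (h s) p (preserves r s q)) (<ℝ-irrefl (h s))

    isomorphic : seq α ∼ h
    isomorphic s r = mk⇔ (preserves s r) (reflects s r)

  -- Permutations of complexity n are Sturmian

  module ToSturmian (few : FewPatterns O) (¬up : ¬ UPₒ) where
    open Heights em O few ¬up
    open Weights em O few ¬up

    letter : Bool → Fin 2
    letter true  = 1F
    letter false = 0F

    isOne-letter : ∀ b → isOne (letter b) ≡ b
    isOne-letter true  = refl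
    isOne-letter false = refl

    w : Word
    w = letter ∘ W

    open Walks w x y 0ℝ using (height; ones; zeros; Positive; Negative; Positive⇒rising; Negative⇒falling; Positive⇒≉; Negative⇒≉; Positive⇒0<x; Negative⇒0<y)
    open Blocks w

    ones≡ : ∀ m i → ones m i ≡ against true m i
    ones≡ m i = cnt-cong (isOne ∘ w) W m λ k _ → isOne-letter (W (k + i))

    zeros≡ : ∀ m i → zeros m i ≡ against false m i
    zeros≡ m i = cnt-cong (not ∘ isOne ∘ w) (not ∘ W) m λ k _ → cong not (isOne-letter (W (k + i)))

    positive : ∀ k i → γ (suc k) i ≡ true → Positive (zeros (suc k) i) (ones (suc k) i)
    positive k i γi = subst₂ Positive (sym (zeros≡ (suc k) i)) (sym (ones≡ (suc k) i)) (rising k i γi)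

    negative : ∀ k i → γ (suc k) i ≡ false → Negative (zeros (suc k) i) (ones (suc k) i)
    negative k i γi = subst₂ Negative (sym (zeros≡ (suc k) i)) (sym (ones≡ (suc k) i)) (falling k i γi)

    W-blk : ∀ n i j → Word.Blk (isOne ∘ w) n i j → Blk n i j
    W-blk n i j r = blk λ k k<n → trans (sym (isOne-letter _)) (trans (Word.at r k k<n) (isOne-letter _))

    blk-W : ∀ n i j → Blk n i j → Word.Blk (isOne ∘ w) n i j
    blk-W n i j r = Word.blk λ k k<n → trans (isOne-letter _) (trans (Blk.at r k k<n) (sym (isOne-letter _)))

    sturmian : SturmianWord w
    sturmian n = case WordsClassical.morse-hedlund em W W-aperiodic n of λ where
      (e , inj) → e , (λ {a} {b} q → inj a b (W-blk n (e a) (e b) (block⇒blk n (e a) (e b) q))) ,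
        λ i → case atLeast-or-class (blk-equiv n) (e , inj) (few-blocks n) i of λ where
          (a , r) → a , blk⇒block n (e a) i (blk-W n (e a) i r)

    nonResonant : NonResonant w x y
    nonResonant i n = subst₂ (λ z o → ¬ ((z · x) D.≈ (o · y))) (sym (block-zeros (suc n) i)) (sym (block-ones (suc n) i))
      (by-direction (γ (suc n) i) refl)
      where
      by-direction : ∀ b → γ (suc n) i ≡ b → ¬ ((zeros (suc n) i · x) D.≈ (ones (suc n) i · y))
      by-direction true  q = Positive⇒≉ (zeros (suc n) i) (ones (suc n) i) (positive n i q)
      by-direction false q = Negative⇒≉ (zeros (suc n) i) (ones (suc n) i) (negative n i q)

    single-step : ∀ b → ∃[ j ] γ 1 j ≡ b × against b 1 j ≡ 0 × against (not b) 1 j ≡ 1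
    single-step b = case some-step b of λ where
        (j , q) → j , q , count b j q , +-cancelˡ-≡ (against b 1 j) _ _
          (trans (against-sum b 1 j) (cong (_+ 1) (sym (count b j q))))
      where
      count : ∀ b j → γ 1 j ≡ b → against b 1 j ≡ 0
      count true  j q = cong (λ b → bit (not b) + 0) q
      count false j q = cong (λ b → bit (not (not b)) + 0) q

    0<x : 0ℝ D.< x
    0<x = case single-step true of λ where
      (j , q , o , z) → Positive⇒0<x (subst₂ Positive (trans (zeros≡ 1 j) z) (trans (ones≡ 1 j) o) (positive 0 j q))

    0<y : 0ℝ D.< y
    0<y = case single-step false of λ where
      (j , q , z , o) → Negative⇒0<y (subst₂ Negative (trans (zeros≡ 1 j) z) (trans (ones≡ 1 j) o) (negative 0 j q))

    isomorphic : seq α ∼ height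
    isomorphic = Comparison.isomorphic height
      (λ k i p → Positive⇒rising (suc k) i (positive k i (decide-true p)))
      (λ k i p → Negative⇒falling (suc k) i (negative k i (Bool.¬-not λ q → α-asym i (suc k + i) (true-decide q) p)))

    sturmianPermutation : SturmianPermutation α
    sturmianPermutation = w , x , y , 0ℝ , sturmian , 0<x , 0<y , nonResonant , isomorphic

  characterisation : (∀ n → 1 ≤ n → MaxPatternComplexity α n n) ⇔ SturmianPermutation α
  characterisation = mk⇔
    (λ max → ToSturmian.sturmianPermutation (max⇒few max) (max⇒¬UPₒ max))
    (λ { (w , x , y , a₀ , sturmian , 0<x , 0<y , _ , iso) → FromSturmian.complexity w x y a₀ sturmian 0<x 0<y iso })

theorem6 : ExcludedMiddle 0ℓ → (α : Permutation) →
    (¬ UltimatelyPeriodic α → ∀ n → 1 ≤ n → ∃[ p ] (MaxPatternComplexity α n p × n ≤ p))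
    × ((∀ n → 1 ≤ n → MaxPatternComplexity α n n) ⇔ SturmianPermutation α)
theorem6 em α = complexity-≥ , characterisation
  where open Main em α
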